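{- There is a polynomial-time algorithm that, given normalised $\mathcal{ELH}^r$-terminologies $\mathcal{T}_1$ and $\mathcal{T}_2$ and a (finite) signature $\Sigma$, computes the set $\mathsf{cWtn}^{\mathsf{rhs}}_\Sigma(\mathcal{T}_1,\mathcal{T}_2)$ of all concept names $A\in\Sigma$ such that there exists an $\mathcal{EL}$-concept $C$ for which either $C\sqsubseteq A\in\mathsf{cDiff}_\Sigma(\mathcal{T}_1,\mathcal{T}_2)$, or $\mathsf{ran}(r)\sqcap C\sqsubseteq A\in\mathsf{cDiff}_\Sigma(\mathcal{T}_1,\mathcal{T}_2)$ for some role name $r\in\Sigma$.
   Context: $\mathsf{N_C},\mathsf{N_R}$ are countably infinite, disjoint sets of concept names and role names. $\mathcal{EL}$-concepts: $C ::= A \mid \top \mid C\sqcap D \mid \exists r.C$ with $A\in\mathsf{N_C}$, $r\in\mathsf{N_R}$. $\mathcal{ELH}^r$-inclusions are: concept inclusions $C\sqsubseteq D$, $\mathsf{ran}(r)\sqsubseteq D$, $\mathsf{ran}(r)\sqcap C\sqsubseteq D$; concept equations $C\equiv D$; role inclusions $r\sqsubseteq s$ (with $C,D$ $\mathcal{EL}$-concepts, $r,s\in\mathsf{N_R}$). An $\mathcal{ELH}^r$-TBox is a finite set of $\mathcal{ELH}^r$-inclusions. Semantics: an interpretation $\mathcal{I}=(\Delta^{\mathcal I},\cdot^{\mathcal I})$ has a nonempty domain, $A^{\mathcal I}\subseteq\Delta^{\mathcal I}$, $r^{\mathcal I}\subseteq\Delta^{\mathcal I}\times\Delta^{\mathcal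 I}$; $\top^{\mathcal I}=\Delta^{\mathcal I}$, $(C\sqcap D)^{\mathcal I}=C^{\mathcal I}\cap D^{\mathcal I}$, $(\exists r.C)^{\mathcal I}=\{d\mid\exists e\in C^{\mathcal I}:(d,e)\in r^{\mathcal I}\}$, $\mathsf{ran}(r)^{\mathcal I}=\{d\mid\exists e:(e,d)\in r^{\mathcal I}\}$. Inclusions (equations) are satisfied if the corresponding set inclusion (equality) holds. $\mathcal T\models\alpha$ means every model of $\mathcal T$ satisfies $\alpha$. An $\mathcal{ELH}^r$-terminology is an $\mathcal{ELH}^r$-TBox all of whose concept inclusions and equations have the form $A\sqsubseteq C$, $A\equiv C$, $\mathsf{ran}(r)\sqsubseteq C$ or $\exists r.\top\sqsubseteq C$, with $A\in\mathsf{N_C}$, $C$ an $\mathcal{EL}$-concept with $C\neq\top$, $C\ne\top\sqcap\top$, etc., and in which no concept name occurs more than once on the left-hand side. A concept name $A$ is pseudo-primitive in $\mathcal T$ if there is no $A\equiv C\in\mathcal T$; it is non-conjunctive in $\mathcal T$ if it is pseudo-primitive in $\mathcal T$ or there is an $A\equiv\exists r.C\in\mathcal T$. The terminology is normalised if, apart from role inclusions, it consists of inclusions of the forms: $A\equiv\exists r.B$ or $A\equiv F$ ($A,B$ concept names, $F$ a nonempty conjunction of concept names non-conjunctive in $\mathcal T$); $E\sqsubseteq\exists r.B$, $E\sqsubseteq\exists r.\top$ or $E\sqsubseteq F$ ($B$ a concept name, $E$ a concept name or $\exists s.\top$ or $\mathsf{ran}(s)$, $F$ as before). A signature is a subset $\Sigma\subseteq\mathsf{N_C}\cup\mathsf{N_R}$.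 $\mathsf{cDiff}_\Sigma(\mathcal T_1,\mathcal T_2)$ is the set of all $\mathcal{ELH}^r$-inclusions $\alpha$ using only names from $\Sigma$ such that $\mathcal T_1\models\alpha$ and $\mathcal T_2\not\models\alpha$. -}

module Defs where

open import Data.List using (List; []; _∷_; _++_; map; foldr)
open import Data.List.Membership.Propositional using () renaming (_∈_ to _∈ˡ_; _∉_ to _∉ˡ_)
open import Data.List.Relation.Unary.All using (All)
open import Data.Nat using (ℕ; zero; suc; _+_; _*_; _^_; _≤_)
open import Data.Nat.Binary using (ℕᵇ; zero; 2[1+_]; 1+[2_])
open import Data.Product using (_×_; _,_; ∃-syntax)
open import Data.Sum using (_⊎_; inj₁; inj₂)
open import Level using (0ℓ) renaming (_⊔_ to _⊔ˡ_)
open import Relation.Binary using (Rel; REL; _⇒_)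
open import Relation.Binary.PropositionalEquality using (_≡_)
open import Relation.Nullary using (¬_)
open import Relation.Unary using (Pred; _∈_; _⊆_; _∩_; U; _≐_)

------------------------------------------------------------------------
-- Syntax

-- Names are binary words (ℕᵇ is bijective binary numeration), so the space
-- taken by a name in an input is its number of binary digits.

NC NR : Set
NC = ℕᵇ
NR = ℕᵇ

Name : Set
Name = NC ⊎ NR

infixr 7 _⊓_
infix  8 ∃⟨_⟩_
infix  4 _⊑_ _≡ᶜ_ _⊑ʳ_ ran⟨_⟩⊑_ ran⟨_⟩⊓_⊑_

data Concept : Set where
  atom  : NC → Concept
  ⊤     : Concept
  _⊓_   : Concept → Concept → Concept
  ∃⟨_⟩_ : NR → Concept → Concept

data Inclusion : Set where
  _⊑_         : Concept → Concept → Inclusion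
  ran⟨_⟩⊑_    : NR → Concept → Inclusion
  ran⟨_⟩⊓_⊑_  : NR → Concept → Concept → Inclusion
  _≡ᶜ_        : Concept → Concept → Inclusion
  _⊑ʳ_        : NR → NR → Inclusion

-- Only membership in the list is ever used: order and repetitions of
-- members are irrelevant.

TBox : Set
TBox = List Inclusion

Signature : Set₁
Signature = Pred Name 0ℓ

conceptNames : Concept → List Name
conceptNames (atom A)   = inj₁ A ∷ []
conceptNames ⊤          = []
conceptNames (C ⊓ D)    = conceptNames C ++ conceptNames D
conceptNames (∃⟨ r ⟩ C) = inj₂ r ∷ conceptNames C

names : Inclusion → List Name
names (C ⊑ D)           = conceptNames C ++ conceptNames D
names (ran⟨ r ⟩⊑ D)     = inj₂ r ∷ conceptNames D
names (ran⟨ r ⟩⊓ C ⊑ D) = inj₂ r ∷ conceptNames C ++ conceptNames D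
names (C ≡ᶜ D)          = conceptNames C ++ conceptNames D
names (r ⊑ʳ s)          = inj₂ r ∷ inj₂ s ∷ []

------------------------------------------------------------------------
-- Semantics

record Interpretation : Set₁ where
  field
    Δ       : Set
    element : Δ
    conc    : NC → Pred Δ 0ℓ
    role    : NR → Rel Δ 0ℓ

  ⟦_⟧ : Concept → Pred Δ 0ℓ
  ⟦ atom A ⟧     = conc A
  ⟦ ⊤ ⟧          = U
  ⟦ C ⊓ D ⟧      = ⟦ C ⟧ ∩ ⟦ D ⟧
  ⟦ ∃⟨ r ⟩ C ⟧ d = ∃[ e ] e ∈ ⟦ C ⟧ × role r d e

  ran : NR → Pred Δ 0ℓ
  ran r d = ∃[ e ] role r e d

infix 4 _satisfies_ _⊨_

_satisfies_ : Interpretation → Inclusion → Set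
I satisfies (C ⊑ D)           = Interpretation.⟦_⟧ I C ⊆ Interpretation.⟦_⟧ I D
I satisfies (ran⟨ r ⟩⊑ D)     = Interpretation.ran I r ⊆ Interpretation.⟦_⟧ I D
I satisfies (ran⟨ r ⟩⊓ C ⊑ D) =
  (Interpretation.ran I r ∩ Interpretation.⟦_⟧ I C) ⊆ Interpretation.⟦_⟧ I D
I satisfies (C ≡ᶜ D)          = Interpretation.⟦_⟧ I C ≐ Interpretation.⟦_⟧ I D
I satisfies (r ⊑ʳ s)          = Interpretation.role I r ⇒ Interpretation.role I s

_⊨_ : TBox → Inclusion → Set₁
T ⊨ α = (I : Interpretation) → All (I satisfies_) T → I satisfies α

------------------------------------------------------------------------
-- Terminologies

-- The concepts ⊤, ⊤ ⊓ ⊤, etc.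
data Vacuous : Pred Concept 0ℓ where
  top  : Vacuous ⊤
  both : ∀ {C D} → Vacuous C → Vacuous D → Vacuous (C ⊓ D)

-- HasBasicLHS C α: α is E ⊑ C for some E of the form A, ∃s.⊤ or ran(s).
data HasBasicLHS (C : Concept) : Pred Inclusion 0ℓ where
  name   : ∀ {A} → HasBasicLHS C (atom A ⊑ C)
  domain : ∀ {s} → HasBasicLHS C (∃⟨ s ⟩ ⊤ ⊑ C)
  range  : ∀ {s} → HasBasicLHS C (ran⟨ s ⟩⊑ C)

data TerminologyForm : Pred Inclusion 0ℓ where
  incl : ∀ {C α} → HasBasicLHS C α → ¬ Vacuous C → TerminologyForm α
  eqn  : ∀ {A C} → ¬ Vacuous C → TerminologyForm (atom A ≡ᶜ C)
  role : ∀ {r s} → TerminologyForm (r ⊑ʳ s)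

data HasNameOnLHS (A : NC) : Pred Inclusion 0ℓ where
  incl : ∀ {C} → HasNameOnLHS A (atom A ⊑ C)
  eqn  : ∀ {C} → HasNameOnLHS A (atom A ≡ᶜ C)

record IsTerminology (T : TBox) : Set where
  field
    form      : ∀ {α} → α ∈ˡ T → TerminologyForm α
    uniqueLHS : ∀ {A α β} → α ∈ˡ T → β ∈ˡ T →
                HasNameOnLHS A α → HasNameOnLHS A β → α ≡ β

PseudoPrimitive : TBox → Pred NC 0ℓ
PseudoPrimitive T A = ∀ C → (atom A ≡ᶜ C) ∉ˡ T

NonConjunctive : TBox → Pred NC 0ℓ
NonConjunctive T A =
  PseudoPrimitive T A ⊎ (∃[ r ] ∃[ C ] (atom A ≡ᶜ ∃⟨ r ⟩ C) ∈ˡ T)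

-- Nonempty conjunctions, however bracketed, of names satisfying P.
data ConjunctionOf (P : Pred NC 0ℓ) : Pred Concept 0ℓ where
  single : ∀ {A} → P A → ConjunctionOf P (atom A)
  _⊓_    : ∀ {F G} → ConjunctionOf P F → ConjunctionOf P G → ConjunctionOf P (F ⊓ G)

data NormalForm (T : TBox) : Pred Inclusion 0ℓ where
  eqn-∃   : ∀ {A r B} → NormalForm T (atom A ≡ᶜ ∃⟨ r ⟩ atom B)
  eqn-⊓   : ∀ {A F} → ConjunctionOf (NonConjunctive T) F → NormalForm T (atom A ≡ᶜ F)
  incl-∃  : ∀ {r B α} → HasBasicLHS (∃⟨ r ⟩ atom B) α → NormalForm T α
  incl-∃⊤ : ∀ {r α} → HasBasicLHS (∃⟨ r ⟩ ⊤) α → NormalForm T α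
  incl-⊓  : ∀ {F α} → ConjunctionOf (NonConjunctive T) F → HasBasicLHS F α → NormalForm T α
  role    : ∀ {r s} → NormalForm T (r ⊑ʳ s)

record IsNormalisedTerminology (T : TBox) : Set where
  field
    isTerminology : IsTerminology T
    normalForm    : ∀ {α} → α ∈ˡ T → NormalForm T α

------------------------------------------------------------------------
-- Logical difference

cDiff : Signature → TBox → TBox → Pred Inclusion _
cDiff Σ T₁ T₂ α = All Σ (names α) × T₁ ⊨ α × ¬ (T₂ ⊨ α)

cWtnʳʰˢ : Signature → TBox → TBox → Pred NC _
cWtnʳʰˢ Σ T₁ T₂ A =
  Σ (inj₁ A) ×
  (∃[ C ] ((C ⊑ atom A) ∈ cDiff Σ T₁ T₂
          ⊎ (∃[ r ] Σ (inj₂ r) × (ran⟨ r ⟩⊓ C ⊑ atom A) ∈ cDiff Σ T₁ T₂)))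

------------------------------------------------------------------------
-- Computation

-- The machine model is Jones' WHILE language over binary trees (Computability
-- and Complexity from a Programming Perspective, MIT Press 1997) in its
-- one-variable form I, with a conditional added; further variables are kept
-- as components of the single tree.  With trees stored as shared cells this
-- is polynomial-time equivalent to Turing machines.

infixr 5 _∙_

data Tree : Set where
  nil : Tree
  _∙_ : Tree → Tree → Tree

size : Tree → ℕ
size nil     = 1
size (s ∙ t) = 1 + size s + size t

data Expr : Set where
  var nil : Expr
  cons    : Expr → Expr → Expr
  hd tl   : Expr → Expr

head tail : Tree → Tree
head nil     = nil
head (s ∙ _) = s
tail nil     = nil
tail (_ ∙ t) = t

eval : Expr → Tree → Tree
eval var        x = x
eval nil        x = nil
eval (cons e f) x = eval e x ∙ eval f x
eval (hd e)     x = head (eval e x)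
eval (tl e)     x = tail (eval e x)

infixr 4 _⨾_

data Program : Set where
  var≔_         : Expr → Program
  _⨾_           : Program → Program → Program
  if_then_else_ : Expr → Program → Program → Program
  while_loop_     : Expr → Program → Program

IsCons : Pred Tree 0ℓ
IsCons x = ∃[ s ] ∃[ t ] x ≡ s ∙ t

-- p ⊢ x ⇓ y [ n ]: started on x, p halts with y after n assignments and tests.
-- Each of these evaluates an expression of the fixed text of p, so it stands
-- for a number of elementary tree operations bounded by a constant of p.

infix 3 _⊢_⇓_[_]

data _⊢_⇓_[_] : Program → Tree → Tree → ℕ → Set where
  assign     : ∀ {e x} → var≔ e ⊢ x ⇓ eval e x [ 1 ]
  seq        : ∀ {p q x y z m n} → p ⊢ x ⇓ y [ m ] → q ⊢ y ⇓ z [ n ] →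
               p ⨾ q ⊢ x ⇓ z [ m + n ]
  if-true    : ∀ {e p q x y n} → IsCons (eval e x) → p ⊢ x ⇓ y [ n ] →
               if e then p else q ⊢ x ⇓ y [ suc n ]
  if-false   : ∀ {e p q x y n} → eval e x ≡ nil → q ⊢ x ⇓ y [ n ] →
               if e then p else q ⊢ x ⇓ y [ suc n ]
  while-true : ∀ {e p x y z m n} → IsCons (eval e x) → p ⊢ x ⇓ y [ m ] →
               while e loop p ⊢ y ⇓ z [ n ] → while e loop p ⊢ x ⇓ z [ suc (m + n) ]
  while-false : ∀ {e p x} → eval e x ≡ nil → while e loop p ⊢ x ⇓ x [ 1 ]

-- Some program, on every (encoded) input x with the property Pre, halts within
-- polynomially many steps on (the encoding of) some y related to x by Post.
-- Every tree has positive size, so the bounds c * n ^ k cover all polynomials.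

PolyTimeSolvable : ∀ {a b p q} {X : Set a} {Y : Set b} →
                   (X → Tree) → (Y → Tree) → Pred X p → REL X Y q →
                   Set (a ⊔ˡ b ⊔ˡ p ⊔ˡ q)
PolyTimeSolvable encX encY Pre Post =
  ∃[ p ] ∃[ c ] ∃[ k ] ∀ x → Pre x →
    ∃[ y ] ∃[ n ] (p ⊢ encX x ⇓ encY y [ n ]) × n ≤ c * size (encX x) ^ k × Post x y

------------------------------------------------------------------------
-- Encodings

tag : ℕ → Tree
tag zero    = nil
tag (suc n) = nil ∙ tag n

encName : ℕᵇ → Tree
encName zero     = nil
encName 2[1+ n ] = tag 0 ∙ encName n
encName 1+[2 n ] = tag 1 ∙ encName n

encConcept : Concept → Tree
encConcept (atom A)   = tag 0 ∙ encName A
encConcept ⊤          = tag 1 ∙ nil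
encConcept (C ⊓ D)    = tag 2 ∙ encConcept C ∙ encConcept D
encConcept (∃⟨ r ⟩ C) = tag 3 ∙ encName r ∙ encConcept C

encInclusion : Inclusion → Tree
encInclusion (C ⊑ D)           = tag 0 ∙ encConcept C ∙ encConcept D
encInclusion (ran⟨ r ⟩⊑ D)     = tag 1 ∙ encName r ∙ encConcept D
encInclusion (ran⟨ r ⟩⊓ C ⊑ D) = tag 2 ∙ encName r ∙ encConcept C ∙ encConcept D
encInclusion (C ≡ᶜ D)          = tag 3 ∙ encConcept C ∙ encConcept D
encInclusion (r ⊑ʳ s)          = tag 4 ∙ encName r ∙ encName s

encSigName : Name → Tree
encSigName (inj₁ A) = tag 0 ∙ encName A
encSigName (inj₂ r) = tag 1 ∙ encName r

encList : ∀ {a} {A : Set a} → (A → Tree) → List A → Tree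
encList enc xs = foldr _∙_ nil (map enc xs)

Input : Set
Input = TBox × TBox × List Name

encInput : Input → Tree
encInput (T₁ , T₂ , Σ) =
  encList encInclusion T₁ ∙ encList encInclusion T₂ ∙ encList encSigName Σ

Output : Set
Output = List NC

encOutput : Output → Tree
encOutput = encList encName

-- In a terminology T₂, a non-conjunctive name A is prime: if ran(r) ⊓ C entails A, then
-- ran(r) or a single conjunct of C does, and a conjunct ∃r.D does so only through ∃r.⊤ or
-- through the definition A ≡ ∃s.B of A.  Hence there is a finite graph with a node for
-- every such A, carrying all labels and edges over Σ that do not force A, at whose node A
-- exactly those Σ-concepts hold that do not entail A.  A concept witnessing A on the
-- right-hand side therefore exists iff saturating this graph with T₁ derives A at the node
-- of some non-conjunctive name B that A entails in T₂ and that the range of the incoming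
-- role, if any, does not force.  Since the witness unravels the
-- graph into a tree, nodes are saturated together with a single incoming role.
-- The role hierarchies and the saturations of T₂ alone and of the graph with T₁ are
-- inflationary fixpoints, over polynomially many candidate facts, of conditions with
-- quantifiers bounded by computed lists; such functions are closed under composition and
-- compile to WHILE programs with polynomial time and space bounds.

module Submission where

open import Defs
open import Data.Bool using (Bool; true; false; _∧_; _∨_; not) renaming (if_then_else_ to ifᵇ_then_else_)
open import Data.Empty using (⊥)
open import Data.List using (List; []; _∷_; _++_; map; foldl; foldr; reverse; length; filter; concatMap)
open import Data.List.Membership.Propositional using (_∈_; _∉_; find; lose)
open import Data.List.Membership.Propositional.Properties
  using (∈-concatMap⁺; ∈-concatMap⁻; ∈-map⁺; ∈-map⁻; ∈-filter⁺; ∈-filter⁻; ∈-++⁺ˡ; ∈-++⁺ʳ; ∈-++⁻)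
open import Data.List.Properties
  using (++-identityʳ; reverse-++; reverse-involutive; reverse-foldl; length-filter; map-cong)
open import Data.List.Relation.Unary.All as All using (All; []; _∷_)
open import Data.List.Relation.Unary.All.Properties using (++⁺; ++⁻ˡ; ++⁻ʳ)
open import Data.List.Relation.Unary.Any using (any?; here; there)
open import Data.Maybe using (Maybe; just; nothing)
open import Data.Nat using (ℕ; zero; suc; _+_; _*_; _^_; _≤_; z≤n; s≤s)
open import Data.Nat.Binary using (ℕᵇ; zero; 2[1+_]; 1+[2_])
open import Data.Nat.Binary.Properties using (_≟_)
open import Data.Nat.Properties
  using (≤-refl; ≤-trans; ≤-reflexive; +-mono-≤; *-mono-≤; *-identityˡ; *-identityʳ;
         ^-identityʳ; *-monoʳ-≤; *-monoˡ-≤; ^-monoʳ-≤; m≤m+n; m≤n+m; *-distribʳ-+;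
         *-distribˡ-+; [m*n]*[o*p]≡[m*o]*[n*p]; ^-distribˡ-+-*; n≤1+n; m≤n⇒m≤1+n; +-monoˡ-≤;
         +-monoʳ-≤; +-comm; +-assoc; +-suc; *-suc; ≤⇒≯; module ≤-Reasoning)
open import Data.Product using (_×_; _,_; ∃-syntax; proj₁; proj₂; <_,_>)
open import Data.Sum using (_⊎_; inj₁; inj₂)
open import Data.Unit using (tt) renaming (⊤ to Unit)
open import Function using (_∘_; id; flip)
open import Function.Bundles using (_⇔_; mk⇔)
open import Relation.Binary.PropositionalEquality
  using (_≡_; refl; sym; trans; cong; cong₂; subst; subst₂; module ≡-Reasoning)
open import Relation.Nullary using (¬_; Dec; yes; no; does; contradiction)
open import Relation.Nullary.Decidable using (map′; ¬?; _×-dec_; _⊎-dec_)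

-- Polynomial-time functions between encoded types

-- Two points shape the proof. Entailment speaks of all interpretations and the argument is
-- constructive, so no entailment may be assumed decidable. Non-entailment is therefore handled as
-- underivability in the calculus `_⊢_⊩_`, and the case distinctions in the argument about the graph
-- are answered by the saturation of T₂ that the algorithm computes anyway. Moreover, a model has to
-- be built three times: to show the calculus complete, to show that concepts holding at a node do
-- not entail its name, and to show that the computed facts are all the consequences. One canonical
-- model, over an abstract truth relation `Holds` and a universe `U` of concepts, serves all three.
-- The witness concepts lie in no fixed finite set, so the program never builds them: a computed
-- fact only attests that one exists, and the proof assembles it along the saturation.

infixl 6 _⊕_
infixl 7 _⊗_
infix  9 _⟨_⟩

-- Bounds are kept as syntax with natural coefficients: every such polynomial is monotone, and
-- bounds compose by substitution.
data Poly : Set where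
  X       : Poly
  const   : ℕ → Poly
  _⊕_ _⊗_ : Poly → Poly → Poly

_⟨_⟩ : Poly → ℕ → ℕ
X       ⟨ n ⟩ = n
const c ⟨ n ⟩ = c
(p ⊕ q) ⟨ n ⟩ = p ⟨ n ⟩ + q ⟨ n ⟩
(p ⊗ q) ⟨ n ⟩ = p ⟨ n ⟩ * q ⟨ n ⟩

_⟦_⟧ₚ : Poly → Poly → Poly
X       ⟦ q ⟧ₚ = q
const c ⟦ q ⟧ₚ = const c
(p ⊕ r) ⟦ q ⟧ₚ = p ⟦ q ⟧ₚ ⊕ r ⟦ q ⟧ₚ
(p ⊗ r) ⟦ q ⟧ₚ = p ⟦ q ⟧ₚ ⊗ r ⟦ q ⟧ₚ

⟨⟩-mono : ∀ p {m n} → m ≤ n → p ⟨ m ⟩ ≤ p ⟨ n ⟩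
⟨⟩-mono X         m≤n = m≤n
⟨⟩-mono (const c) m≤n = ≤-refl
⟨⟩-mono (p ⊕ q)   m≤n = +-mono-≤ (⟨⟩-mono p m≤n) (⟨⟩-mono q m≤n)
⟨⟩-mono (p ⊗ q)   m≤n = *-mono-≤ (⟨⟩-mono p m≤n) (⟨⟩-mono q m≤n)

⟦⟧ₚ-eval : ∀ p q n → (p ⟦ q ⟧ₚ) ⟨ n ⟩ ≡ p ⟨ q ⟨ n ⟩ ⟩
⟦⟧ₚ-eval X         q n = refl
⟦⟧ₚ-eval (const c) q n = refl
⟦⟧ₚ-eval (p ⊕ r)   q n = cong₂ _+_ (⟦⟧ₚ-eval p q n) (⟦⟧ₚ-eval r q n)
⟦⟧ₚ-eval (p ⊗ r)   q n = cong₂ _*_ (⟦⟧ₚ-eval p q n) (⟦⟧ₚ-eval r q n)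

⟦⟧ₚ-bound : ∀ p q n {a b} → a ≤ p ⟨ b ⟩ → b ≤ q ⟨ n ⟩ → a ≤ (p ⟦ q ⟧ₚ) ⟨ n ⟩
⟦⟧ₚ-bound p q n a≤ b≤ =
  ≤-trans a≤ (≤-trans (⟨⟩-mono p b≤) (≤-reflexive (sym (⟦⟧ₚ-eval p q n))))

-- The base is positive, so a power only grows with its exponent; hence the sum of the exponents
-- serves for a sum as well as for a product.
monomial-bound : ∀ p → ∃[ c ] ∃[ k ] ∀ n → p ⟨ suc n ⟩ ≤ c * suc n ^ k
monomial-bound X         = 1 , 1 , λ n →
  ≤-reflexive (sym (trans (*-identityˡ _) (^-identityʳ (suc n))))
monomial-bound (const c) = c , 0 , λ n → ≤-reflexive (sym (*-identityʳ c))
monomial-bound (p ⊕ q) with monomial-bound p | monomial-bound q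
... | c , k , p≤ | d , l , q≤ = c + d , k + l , λ n → begin
  p ⟨ suc n ⟩ + q ⟨ suc n ⟩                  ≤⟨ +-mono-≤ (p≤ n) (q≤ n) ⟩
  c * suc n ^ k + d * suc n ^ l
    ≤⟨ +-mono-≤ (*-monoʳ-≤ c (^-monoʳ-≤ (suc n) (m≤m+n k l)))
                (*-monoʳ-≤ d (^-monoʳ-≤ (suc n) (m≤n+m l k))) ⟩
  c * suc n ^ (k + l) + d * suc n ^ (k + l)  ≡⟨ *-distribʳ-+ (suc n ^ (k + l)) c d ⟨
  (c + d) * suc n ^ (k + l)                  ∎
  where open ≤-Reasoning
monomial-bound (p ⊗ q) with monomial-bound p | monomial-bound q
... | c , k , p≤ | d , l , q≤ = c * d , k + l , λ n → begin
  p ⟨ suc n ⟩ * q ⟨ suc n ⟩              ≤⟨ *-mono-≤ (p≤ n) (q≤ n) ⟩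
  c * suc n ^ k * (d * suc n ^ l)        ≡⟨ [m*n]*[o*p]≡[m*o]*[n*p] c (suc n ^ k) d (suc n ^ l) ⟩
  c * d * (suc n ^ k * suc n ^ l)        ≡⟨ cong (c * d *_) (^-distribˡ-+-* (suc n) k l) ⟨
  c * d * suc n ^ (k + l)                ∎
  where open ≤-Reasoning

infixr 6 _⊎ᵗ_
infixr 7 _×ᵗ_

data Ty : Set where
  name concept inclusion bool : Ty
  list opt                    : Ty → Ty
  _×ᵗ_ _⊎ᵗ_                   : Ty → Ty → Ty

El : Ty → Set
El name      = ℕᵇ
El concept   = Concept
El inclusion = Inclusion
El bool      = Bool
El (list σ)  = List (El σ)
El (opt σ)   = Maybe (El σ)
El (σ ×ᵗ τ)  = El σ × El τ
El (σ ⊎ᵗ τ)  = El σ ⊎ El τ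

-- Booleans are encoded so that the machine's test for a cons branches on them directly. Options and
-- sums carry a tag in front, like the syntax of the input, so that one family of programs inspects
-- them all.
enc : ∀ σ → El σ → Tree
enc name                    = encName
enc concept                 = encConcept
enc inclusion               = encInclusion
enc bool      false         = nil
enc bool      true          = nil ∙ nil
enc (list σ)                = encList (enc σ)
enc (opt σ)   nothing       = tag 1 ∙ nil
enc (opt σ)   (just x)      = tag 0 ∙ enc σ x
enc (σ ×ᵗ τ)  (x , y)       = enc σ x ∙ enc τ y
enc (σ ⊎ᵗ τ)  (inj₁ x)      = tag 0 ∙ enc σ x
enc (σ ⊎ᵗ τ)  (inj₂ y)      = tag 1 ∙ enc τ y

-- A time bound does not bound the result, since assigning `cons var var` doubles a tree in one
-- step. Composition needs the size of the intermediate result, so a size bound is carried along.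
record PTime (σ τ : Ty) (f : El σ → El τ) : Set where
  field
    program    : Program
    time space : Poly
    halts      : ∀ x → ∃[ n ] (program ⊢ enc σ x ⇓ enc τ (f x) [ n ]) ×
                              n ≤ time ⟨ size (enc σ x) ⟩
    small      : ∀ x → size (enc τ (f x)) ≤ space ⟨ size (enc σ x) ⟩

open PTime public

≗-PTime : ∀ {σ τ f g} → (∀ x → f x ≡ g x) → PTime σ τ f → PTime σ τ g
≗-PTime {σ} {τ} eq F = record
  { program = program F ; time = time F ; space = space F
  ; halts = λ x → subst (λ y → ∃[ n ] (program F ⊢ enc σ x ⇓ enc τ y [ n ]) × n ≤ time F ⟨ size (enc σ x) ⟩)
                        (eq x) (halts F x)
  ; small = λ x → subst (λ y → size (enc τ y) ≤ space F ⟨ size (enc σ x) ⟩) (eq x) (small F x)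
  }

spaceᵉ : Expr → Poly
spaceᵉ var        = X
spaceᵉ nil        = const 1
spaceᵉ (cons e f) = const 1 ⊕ spaceᵉ e ⊕ spaceᵉ f
spaceᵉ (hd e)     = spaceᵉ e
spaceᵉ (tl e)     = spaceᵉ e

size-head : ∀ t → size (head t) ≤ size t
size-head nil     = ≤-refl
size-head (s ∙ t) = ≤-trans (m≤m+n (size s) (size t)) (n≤1+n _)

size-tail : ∀ t → size (tail t) ≤ size t
size-tail nil     = ≤-refl
size-tail (s ∙ t) = ≤-trans (m≤n+m (size t) (size s)) (n≤1+n _)

eval-small : ∀ e x → size (eval e x) ≤ spaceᵉ e ⟨ size x ⟩
eval-small var        x = ≤-refl
eval-small nil        x = ≤-refl
eval-small (cons e f) x = s≤s (+-mono-≤ (eval-small e x) (eval-small f x))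
eval-small (hd e)     x = ≤-trans (size-head (eval e x)) (eval-small e x)
eval-small (tl e)     x = ≤-trans (size-tail (eval e x)) (eval-small e x)

exprᴾ : ∀ {σ τ f} e → (∀ x → eval e (enc σ x) ≡ enc τ (f x)) → PTime σ τ f
exprᴾ e eq = record
  { program = var≔ e ; time = const 1 ; space = spaceᵉ e
  ; halts = λ x → 1 , subst (var≔ e ⊢ _ ⇓_[ 1 ]) (eq x) assign , ≤-refl
  ; small = λ x → subst (λ t → size t ≤ spaceᵉ e ⟨ _ ⟩) (eq x) (eval-small e _)
  }

infixr 9 _∘ᴾ_

_∘ᴾ_ : ∀ {σ τ υ g f} → PTime τ υ g → PTime σ τ f → PTime σ υ (g ∘ f)
_∘ᴾ_ {f = f} G F = record
  { program = program F ⨾ program G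
  ; time    = time F ⊕ time G ⟦ space F ⟧ₚ
  ; space   = space G ⟦ space F ⟧ₚ
  ; halts   = λ x → let m , F⇓ , m≤ = halts F x ; n , G⇓ , n≤ = halts G (f x) in
      m + n , seq F⇓ G⇓ , +-mono-≤ m≤ (⟦⟧ₚ-bound (time G) (space F) _ n≤ (small F x))
  ; small   = λ x → ⟦⟧ₚ-bound (space G) (space F) _ (small G (f x)) (small F x)
  }

-- The machine has a single variable. Reading `hd var` for `var` runs a program on the left
-- component of the state and preserves the right one, which acts as a second variable.
focusᵉ : Expr → Expr
focusᵉ var        = hd var
focusᵉ nil        = nil
focusᵉ (cons e f) = cons (focusᵉ e) (focusᵉ f)
focusᵉ (hd e)     = hd (focusᵉ e)
focusᵉ (tl e)     = tl (focusᵉ e)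

focus : Program → Program
focus (var≔ e)               = var≔ cons (focusᵉ e) (tl var)
focus (p ⨾ q)                = focus p ⨾ focus q
focus (if e then p else q)   = if focusᵉ e then focus p else focus q
focus (while e loop p)       = while focusᵉ e loop focus p

focusᵉ-eval : ∀ e x t → eval (focusᵉ e) (x ∙ t) ≡ eval e x
focusᵉ-eval var        x t = refl
focusᵉ-eval nil        x t = refl
focusᵉ-eval (cons e f) x t = cong₂ _∙_ (focusᵉ-eval e x t) (focusᵉ-eval f x t)
focusᵉ-eval (hd e)     x t = cong head (focusᵉ-eval e x t)
focusᵉ-eval (tl e)     x t = cong tail (focusᵉ-eval e x t)

focus-⇓ : ∀ {p x y n} t → p ⊢ x ⇓ y [ n ] → focus p ⊢ x ∙ t ⇓ y ∙ t [ n ]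
focus-⇓ t (assign {e} {x}) =
  subst (λ y → var≔ cons (focusᵉ e) (tl var) ⊢ x ∙ t ⇓ y ∙ t [ 1 ]) (focusᵉ-eval e x t) assign
focus-⇓ t (seq p⇓ q⇓) = seq (focus-⇓ t p⇓) (focus-⇓ t q⇓)
focus-⇓ t (if-true {e} {x = x} c p⇓) =
  if-true (subst IsCons (sym (focusᵉ-eval e x t)) c) (focus-⇓ t p⇓)
focus-⇓ t (if-false {e} {x = x} c q⇓) =
  if-false (trans (focusᵉ-eval e x t) c) (focus-⇓ t q⇓)
focus-⇓ t (while-true {e} {x = x} c p⇓ w⇓) =
  while-true (subst IsCons (sym (focusᵉ-eval e x t)) c) (focus-⇓ t p⇓) (focus-⇓ t w⇓)
focus-⇓ t (while-false {e} {x = x} c) = while-false (trans (focusᵉ-eval e x t) c)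

pairᴾ : ∀ {σ τ υ f g} → PTime σ τ f → PTime σ υ g → PTime σ (τ ×ᵗ υ) < f , g >
pairᴾ F G = record
  -- The states are x ∙ x, f x ∙ x, x ∙ f x, g x ∙ f x and f x ∙ g x.
  { program = var≔ cons var var ⨾ focus (program F) ⨾ swap ⨾ focus (program G) ⨾ swap
  ; time    = const 1 ⊕ (time F ⊕ (const 1 ⊕ (time G ⊕ const 1)))
  ; space   = const 1 ⊕ space F ⊕ space G
  ; halts   = λ x → let m , F⇓ , m≤ = halts F x ; n , G⇓ , n≤ = halts G x in
      1 + (m + (1 + (n + 1))) ,
      seq assign (seq (focus-⇓ _ F⇓) (seq assign (seq (focus-⇓ _ G⇓) assign))) ,
      s≤s (+-mono-≤ m≤ (s≤s (+-monoˡ-≤ 1 n≤)))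
  ; small   = λ x → s≤s (+-mono-≤ (small F x) (small G x))
  }
  where
  swap = var≔ cons (tl var) (hd var)

ifᴾ : ∀ {σ τ b f g} → PTime σ bool b → PTime σ τ f → PTime σ τ g →
      PTime σ τ (λ x → ifᵇ b x then f x else g x)
ifᴾ {σ} {τ} {b} {f} {g} B F G = record
  { program = pr
  ; time    = const 1 ⊕ (time B ⊕ (const 2 ⊕ (time F ⊕ time G)))
  ; space   = space F ⊕ space G
  ; halts   = run
  ; small   = λ x → bound x (b x)
  }
  where
  pr = var≔ cons var var ⨾ focus (program B) ⨾
       (if hd var then (var≔ tl var ⨾ program F) else (var≔ tl var ⨾ program G))
  run : ∀ x → ∃[ n ] (pr ⊢ enc σ x ⇓ enc τ (ifᵇ b x then f x else g x) [ n ]) × n ≤ _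
  run x with b x | halts B x
  ... | true | m , B⇓ , m≤ = let n , F⇓ , n≤ = halts F x in
    1 + (m + suc (1 + n)) , seq assign (seq (focus-⇓ _ B⇓) (if-true (_ , _ , refl) (seq assign F⇓))) ,
    s≤s (+-mono-≤ m≤ (s≤s (s≤s (≤-trans n≤ (m≤m+n _ _)))))
  ... | false | m , B⇓ , m≤ = let n , G⇓ , n≤ = halts G x in
    1 + (m + suc (1 + n)) , seq assign (seq (focus-⇓ _ B⇓) (if-false refl (seq assign G⇓))) ,
    s≤s (+-mono-≤ m≤ (s≤s (s≤s (≤-trans n≤ (m≤n+m _ (time F ⟨ _ ⟩))))))
  bound : ∀ x b → size (enc τ (ifᵇ b then f x else g x)) ≤ (space F ⊕ space G) ⟨ size (enc σ x) ⟩
  bound x true  = ≤-trans (small F x) (m≤m+n _ _)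
  bound x false = ≤-trans (small G x) (m≤n+m _ (space F ⟨ _ ⟩))

fstᴾ : ∀ {σ τ} → PTime (σ ×ᵗ τ) σ proj₁
fstᴾ = exprᴾ (hd var) (λ _ → refl)

sndᴾ : ∀ {σ τ} → PTime (σ ×ᵗ τ) τ proj₂
sndᴾ = exprᴾ (tl var) (λ _ → refl)

idᴾ : ∀ {σ} → PTime σ σ id
idᴾ = exprᴾ var (λ _ → refl)

nilᴾ : ∀ {σ τ} → PTime σ (list τ) (λ _ → [])
nilᴾ = exprᴾ nil (λ _ → refl)

consᴾ : ∀ {σ τ f g} → PTime σ τ f → PTime σ (list τ) g → PTime σ (list τ) (λ x → f x ∷ g x)
consᴾ {σ} {τ} {f} {g} F G =
  -- A nonempty list has the same encoding as the pair of its head and tail, so the identity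
  -- expression suffices.
  _∘ᴾ_ {f = < f , g >} (exprᴾ {τ ×ᵗ list τ} {list τ} {λ (x , xs) → x ∷ xs} var (λ _ → refl)) (pairᴾ F G)

size-pos : ∀ t → 1 ≤ size t
size-pos nil     = ≤-refl
size-pos (_ ∙ _) = s≤s z≤n

length≤size : ∀ σ (xs : List (El σ)) → length xs ≤ size (enc (list σ) xs)
length≤size σ []       = z≤n
length≤size σ (x ∷ xs) = s≤s (≤-trans (length≤size σ xs) (m≤n+m _ _))

size-++ʳ : ∀ σ (xs ys : List (El σ)) → size (enc (list σ) ys) ≤ size (enc (list σ) (xs ++ ys))
size-++ʳ σ []       ys = ≤-refl
size-++ʳ σ (x ∷ xs) ys = ≤-trans (size-++ʳ σ xs ys) (m≤n⇒m≤1+n (m≤n+m _ _))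

-- Loops over lists

-- The accumulator of a loop may grow at every round, hence the explicit bound.
module Foldl {σ α ι} {l : El σ → List (El α)} {z : El σ → El ι} {s : El α × El ι × El σ → El ι}
  (L : PTime σ (list α) l) (Z : PTime σ ι z) (S : PTime (α ×ᵗ ι ×ᵗ σ) ι s) (b : Poly)
  (bound : ∀ x ps qs → l x ≡ ps ++ qs →
           size (enc ι (foldl (λ i a → s (a , i , x)) (z x) ps)) ≤ b ⟨ size (enc σ x) ⟩)
  where

  body : PTime ((α ×ᵗ list α) ×ᵗ (ι ×ᵗ σ)) (list α ×ᵗ (ι ×ᵗ σ)) _
  body = pairᴾ (sndᴾ ∘ᴾ fstᴾ) (pairᴾ (S ∘ᴾ pairᴾ (fstᴾ ∘ᴾ fstᴾ) sndᴾ) (sndᴾ ∘ᴾ sndᴾ))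

  loop : Program
  loop = while hd var loop program body

  state : Poly
  state = const 1 ⊕ space L ⊕ (const 1 ⊕ b ⊕ X)

  round : Poly
  round = time body ⟦ state ⟧ₚ

  -- Every accumulator that can still arise comes from a prefix of the remaining list and is bounded
  -- by assumption, so all rounds are charged the same amount `round ⟨ n ⟩`, where `n` is the size
  -- of the original input.
  loop-⇓ : ∀ x n as i → n ≡ size (enc σ x) → size (enc (list α) as) ≤ space L ⟨ n ⟩ →
    (∀ ps qs → as ≡ ps ++ qs → size (enc ι (foldl (λ i a → s (a , i , x)) i ps)) ≤ b ⟨ n ⟩) →
    ∃[ k ] (loop ⊢ enc (list α ×ᵗ (ι ×ᵗ σ)) (as , i , x) ⇓
                   enc (list α ×ᵗ (ι ×ᵗ σ)) ([] , foldl (λ i a → s (a , i , x)) i as , x) [ k ]) ×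
           k ≤ length as * suc (round ⟨ n ⟩) + 1
  loop-⇓ x n []       i _  _   _     = 1 , while-false refl , ≤-refl
  loop-⇓ x n (a ∷ as) i eq sz≤ acc≤ =
    let j , B⇓ , j≤ = halts body ((a , as) , i , x)
        k , W⇓ , k≤ = loop-⇓ x n as (s (a , i , x)) eq
                        (≤-trans (size-++ʳ α (a ∷ []) as) sz≤)
                        (λ ps qs e → acc≤ (a ∷ ps) qs (cong (a ∷_) e))
        j≤′ = ⟦⟧ₚ-bound (time body) state n j≤
                (+-mono-≤ (s≤s sz≤) (s≤s (+-mono-≤ (acc≤ [] (a ∷ as) refl) (≤-reflexive (sym eq)))))
    in suc (j + k) , while-true (_ , _ , refl) B⇓ W⇓ ,
       s≤s (≤-trans (+-mono-≤ j≤′ k≤) (≤-reflexive (sym (+-assoc (round ⟨ n ⟩) _ 1))))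

  foldlᴾ : PTime σ ι (λ x → foldl (λ i a → s (a , i , x)) (z x) (l x))
  foldlᴾ = record
    { program = program start ⨾ loop ⨾ var≔ hd (tl var)
    ; time    = time start ⊕ ((space L ⊗ (const 1 ⊕ round) ⊕ const 1) ⊕ const 1)
    ; space   = b
    ; halts   = λ x →
        let n = size (enc σ x)
            j , S⇓ , j≤ = halts start x
            k , W⇓ , k≤ = loop-⇓ x n (l x) (z x) refl (small L x) (bound x)
        in j + (k + 1) , seq S⇓ (seq W⇓ assign) ,
           +-mono-≤ j≤ (+-monoˡ-≤ 1 (≤-trans k≤ (+-monoˡ-≤ 1
             (*-monoˡ-≤ (suc (round ⟨ n ⟩)) (≤-trans (length≤size α (l x)) (small L x))))))
    ; small   = λ x → bound x (l x) [] (sym (++-identityʳ (l x)))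
    }
    where
    start = pairᴾ L (pairᴾ Z idᴾ)

foldl-cons-small : ∀ σ (ps acc : List (El σ)) →
  size (enc (list σ) (foldl (flip _∷_) acc ps)) ≤ size (enc (list σ) acc) + size (enc (list σ) ps)
foldl-cons-small σ []       acc = m≤m+n _ _
foldl-cons-small σ (p ∷ ps) acc = ≤-trans (foldl-cons-small σ ps (p ∷ acc)) (begin
  suc (a + b) + c   ≡⟨ cong (λ k → suc (k + c)) (+-comm a b) ⟩
  suc (b + a) + c   ≡⟨ cong suc (+-assoc b a c) ⟩
  suc (b + (a + c)) ≡⟨ +-suc b (a + c) ⟨
  b + suc (a + c)   ∎)
  where
  open ≤-Reasoning
  a = size (enc σ p)
  b = size (enc (list σ) acc)
  c = size (enc (list σ) ps)

size-++ˡ : ∀ σ (xs ys : List (El σ)) → size (enc (list σ) xs) ≤ size (enc (list σ) (xs ++ ys))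
size-++ˡ σ []       ys = size-pos (enc (list σ) ys)
size-++ˡ σ (x ∷ xs) ys = s≤s (+-monoʳ-≤ (size (enc σ x)) (size-++ˡ σ xs ys))

reverseᴾ : ∀ {σ} → PTime (list σ) (list σ) reverse
reverseᴾ {σ} = Foldl.foldlᴾ {s = λ (a , i , _) → a ∷ i} idᴾ nilᴾ (consᴾ fstᴾ (fstᴾ ∘ᴾ sndᴾ)) (const 1 ⊕ X)
  (λ { _ ps qs refl → ≤-trans (foldl-cons-small σ ps []) (s≤s (size-++ˡ σ ps qs)) })

-- A right fold is a left fold over the reversed list; prefixes of the latter are reversed suffixes
-- of the original, hence the bound over `qs`.
foldrᴾ : ∀ {σ α ι l z} (s : El α × El ι × El σ → El ι) →
  PTime σ (list α) l → PTime σ ι z → PTime (α ×ᵗ ι ×ᵗ σ) ι s → (b : Poly) →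
  (∀ x ps qs → l x ≡ ps ++ qs →
     size (enc ι (foldr (λ a i → s (a , i , x)) (z x) qs)) ≤ b ⟨ size (enc σ x) ⟩) →
  PTime σ ι (λ x → foldr (λ a i → s (a , i , x)) (z x) (l x))
foldrᴾ {σ} {α} {ι} {l} {z} s L Z S b bound =
  ≗-PTime (λ x → reverse-foldl _ (z x) (l x)) (Foldl.foldlᴾ {s = s} (reverseᴾ ∘ᴾ L) Z S b bound′)
  where
  bound′ : ∀ x ps qs → reverse (l x) ≡ ps ++ qs →
    size (enc ι (foldl (λ i a → s (a , i , x)) (z x) ps)) ≤ b ⟨ size (enc σ x) ⟩
  bound′ x ps qs eq =
    subst (λ i → size (enc ι i) ≤ b ⟨ size (enc σ x) ⟩)
      (trans (sym (reverse-foldl _ (z x) (reverse ps))) (cong (foldl _ (z x)) (reverse-involutive ps)))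
      (bound x (reverse qs) (reverse ps)
        (trans (sym (reverse-involutive (l x))) (trans (cong reverse eq) (reverse-++ ps qs))))

-- Decidable predicates and bounded quantifiers

record Decider (σ : Ty) (P : El σ → Set) : Set where
  field
    dec   : ∀ x → Dec (P x)
    ptime : PTime σ bool (does ∘ dec)

open Decider public

infix 9 _[_]ᴰ

_[_]ᴰ : ∀ {σ τ P f} → Decider τ P → PTime σ τ f → Decider σ (P ∘ f)
_[_]ᴰ {f = f} D F = record { dec = dec D ∘ f ; ptime = ptime D ∘ᴾ F }

mapᴰ : ∀ {σ P Q} → (∀ {x} → P x → Q x) → (∀ {x} → Q x → P x) → Decider σ P → Decider σ Q
mapᴰ to from D = record { dec = λ x → map′ to from (dec D x) ; ptime = ptime D }

falseᴾ : ∀ {σ} → PTime σ bool (λ _ → false)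
falseᴾ = exprᴾ nil (λ _ → refl)

trueᴾ : ∀ {σ} → PTime σ bool (λ _ → true)
trueᴾ = exprᴾ (cons nil nil) (λ _ → refl)

infixr 3 _×ᴰ_
infixr 2 _⊎ᴰ_

¬ᴰ_ : ∀ {σ P} → Decider σ P → Decider σ (λ x → ¬ P x)
¬ᴰ D = record
  { dec   = λ x → ¬? (dec D x)
  ; ptime = ≗-PTime (λ x → if-not (does (dec D x))) (ifᴾ (ptime D) falseᴾ trueᴾ)
  }
  where
  if-not : ∀ b → (ifᵇ b then false else true) ≡ not b
  if-not true  = refl
  if-not false = refl

_×ᴰ_ : ∀ {σ P Q} → Decider σ P → Decider σ Q → Decider σ (λ x → P x × Q x)
D ×ᴰ E = record
  { dec   = λ x → dec D x ×-dec dec E x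
  ; ptime = ≗-PTime (λ x → if-∧ (does (dec D x)) _) (ifᴾ (ptime D) (ptime E) falseᴾ)
  }
  where
  if-∧ : ∀ a b → (ifᵇ a then b else false) ≡ a ∧ b
  if-∧ true  b = refl
  if-∧ false b = refl

_⊎ᴰ_ : ∀ {σ P Q} → Decider σ P → Decider σ Q → Decider σ (λ x → P x ⊎ Q x)
D ⊎ᴰ E = record
  { dec   = λ x → dec D x ⊎-dec dec E x
  ; ptime = ≗-PTime (λ x → if-∨ (does (dec D x)) _) (ifᴾ (ptime D) trueᴾ (ptime E))
  }
  where
  if-∨ : ∀ a b → (ifᵇ a then true else b) ≡ a ∨ b
  if-∨ true  b = refl
  if-∨ false b = refl

size-bool : ∀ b → size (enc bool b) ≤ 3
size-bool false = s≤s z≤n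
size-bool true  = ≤-refl

-- With this quantifier and the connectives above, a rule of the algorithm is a formula: it is
-- compiled to a program by a combinator of the same shape, and the correctness proof takes the
-- formula itself apart.
∃ᴰ : ∀ {σ α l P} → PTime σ (list α) l → Decider (α ×ᵗ σ) P →
     Decider σ (λ x → ∃[ a ] a ∈ l x × P (a , x))
∃ᴰ {σ} {α} {l} {P} L D = record
  { dec   = λ x → map′ find (λ (_ , a∈ , p) → lose a∈ p) (any? (λ a → dec D (a , x)) (l x))
  ; ptime = ≗-PTime (λ x → any-foldr x (l x))
      (foldrᴾ {ι = bool} (λ (a , i , x) → ifᵇ does (dec D (a , x)) then true else i) L falseᴾ
        (ifᴾ (ptime D ∘ᴾ pairᴾ fstᴾ (sndᴾ ∘ᴾ sndᴾ)) trueᴾ (fstᴾ ∘ᴾ sndᴾ))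
        (const 3) (λ x _ qs _ → size-bool (foldr (λ a i → ifᵇ does (dec D (a , x)) then true else i) false qs)))
  }
  where
  any-foldr : ∀ x as → foldr (λ a i → ifᵇ does (dec D (a , x)) then true else i) false as ≡
                       does (any? (λ a → dec D (a , x)) as)
  any-foldr x [] = refl
  any-foldr x (a ∷ as) with does (dec D (a , x))
  ... | true  = refl
  ... | false = any-foldr x as

filter-small : ∀ α {P : El α → Set} (P? : ∀ a → Dec (P a)) as →
  size (enc (list α) (filter P? as)) ≤ size (enc (list α) as)
filter-small α P? []       = ≤-refl
filter-small α P? (a ∷ as) with does (P? a)
... | true  = s≤s (+-monoʳ-≤ (size (enc α a)) (filter-small α P? as))
... | false = ≤-trans (filter-small α P? as) (m≤n⇒m≤1+n (m≤n+m _ _))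

filterᴾ : ∀ {σ α l P} → PTime σ (list α) l → (D : Decider (α ×ᵗ σ) P) →
          PTime σ (list α) (λ x → filter (λ a → dec D (a , x)) (l x))
filterᴾ {σ} {α} {l} {P} L D = ≗-PTime (λ x → filter-foldr x (l x))
  (foldrᴾ (λ (a , i , x) → ifᵇ does (dec D (a , x)) then a ∷ i else i) L nilᴾ
    (ifᴾ (ptime D ∘ᴾ pairᴾ fstᴾ (sndᴾ ∘ᴾ sndᴾ)) (consᴾ fstᴾ (fstᴾ ∘ᴾ sndᴾ)) (fstᴾ ∘ᴾ sndᴾ))
    (space L)
    (λ x ps qs eq → begin
      size (enc (list α) (foldr _ [] qs))
        ≡⟨ cong (size ∘ enc (list α)) (filter-foldr x qs) ⟩
      size (enc (list α) (filter (λ a → dec D (a , x)) qs))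
        ≤⟨ filter-small α (λ a → dec D (a , x)) qs ⟩
      size (enc (list α) qs)          ≤⟨ size-++ʳ α ps qs ⟩
      size (enc (list α) (ps ++ qs))  ≡⟨ cong (size ∘ enc (list α)) eq ⟨
      size (enc (list α) (l x))       ≤⟨ small L x ⟩
      space L ⟨ size (enc σ x) ⟩      ∎))
  where
  open ≤-Reasoning
  filter-foldr : ∀ x as → foldr (λ a i → ifᵇ does (dec D (a , x)) then a ∷ i else i) [] as ≡
                          filter (λ a → dec D (a , x)) as
  filter-foldr x [] = refl
  filter-foldr x (a ∷ as) with does (dec D (a , x))
  ... | true  = cong (a ∷_) (filter-foldr x as)
  ... | false = filter-foldr x as

size-++ : ∀ σ (xs ys : List (El σ)) →
  size (enc (list σ) (xs ++ ys)) ≤ size (enc (list σ) xs) + size (enc (list σ) ys)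
size-++ σ []       ys = n≤1+n _
size-++ σ (x ∷ xs) ys = s≤s (begin
  size (enc σ x) + size (enc (list σ) (xs ++ ys))
    ≤⟨ +-monoʳ-≤ (size (enc σ x)) (size-++ σ xs ys) ⟩
  size (enc σ x) + (size (enc (list σ) xs) + size (enc (list σ) ys))
    ≡⟨ +-assoc (size (enc σ x)) _ _ ⟨
  size (enc σ x) + size (enc (list σ) xs) + size (enc (list σ) ys) ∎)
  where open ≤-Reasoning

++ᴾ : ∀ {σ τ f g} → PTime σ (list τ) f → PTime σ (list τ) g → PTime σ (list τ) (λ x → f x ++ g x)
++ᴾ {σ} {τ} {f} {g} F G = ≗-PTime (λ x → foldr-++ (f x) (g x))
  (foldrᴾ (λ (a , i , x) → a ∷ i) F G (consᴾ fstᴾ (fstᴾ ∘ᴾ sndᴾ)) (space F ⊕ space G)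
    (λ x ps qs eq → begin
      size (enc (list τ) (foldr _∷_ (g x) qs))
        ≡⟨ cong (size ∘ enc (list τ)) (foldr-++ qs (g x)) ⟩
      size (enc (list τ) (qs ++ g x))
        ≤⟨ size-++ τ qs (g x) ⟩
      size (enc (list τ) qs) + size (enc (list τ) (g x))
        ≤⟨ +-mono-≤ (size-++ʳ τ ps qs) (small G x) ⟩
      size (enc (list τ) (ps ++ qs)) + space G ⟨ _ ⟩
        ≡⟨ cong (λ l → size (enc (list τ) l) + space G ⟨ _ ⟩) eq ⟨
      size (enc (list τ) (f x)) + space G ⟨ _ ⟩
        ≤⟨ +-monoˡ-≤ _ (small F x) ⟩
      space F ⟨ _ ⟩ + space G ⟨ _ ⟩ ∎))
  where
  open ≤-Reasoning
  foldr-++ : ∀ (xs ys : List (El τ)) → foldr _∷_ ys xs ≡ xs ++ ys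
  foldr-++ []       ys = refl
  foldr-++ (x ∷ xs) ys = cong (x ∷_) (foldr-++ xs ys)

concatMapᴾ : ∀ {σ α β l f} → PTime σ (list α) l → PTime (α ×ᵗ σ) (list β) f →
             PTime σ (list β) (λ x → concatMap (λ a → f (a , x)) (l x))
concatMapᴾ {σ} {α} {β} {l} {f} L F = ≗-PTime (λ x → foldr-concatMap x (l x))
  (foldrᴾ (λ (a , i , x) → f (a , x) ++ i) L nilᴾ
    (++ᴾ (F ∘ᴾ pairᴾ fstᴾ (sndᴾ ∘ᴾ sndᴾ)) (fstᴾ ∘ᴾ sndᴾ))
    (space L ⊗ item ⊕ const 1)
    (λ x ps qs eq →
      let qs≤ = ≤-trans (size-++ʳ α ps qs) (subst (λ k → size (enc (list α) k) ≤ space L ⟨ _ ⟩) eq (small L x))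
      in ≤-trans (total x qs qs≤)
           (+-monoˡ-≤ 1 (*-monoˡ-≤ (item ⟨ size (enc σ x) ⟩) (≤-trans (length≤size α qs) qs≤)))))
  where
  -- An argument of `f` is a pair of an entry and the input, so its size is at most one more than
  -- those of the list and the input together.
  item : Poly
  item = space F ⟦ const 1 ⊕ space L ⊕ X ⟧ₚ
  foldr-concatMap : ∀ x as → foldr (λ a i → f (a , x) ++ i) [] as ≡ concatMap (λ a → f (a , x)) as
  foldr-concatMap x []       = refl
  foldr-concatMap x (a ∷ as) = cong (f (a , x) ++_) (foldr-concatMap x as)
  total : ∀ x as → size (enc (list α) as) ≤ space L ⟨ size (enc σ x) ⟩ →
    size (enc (list β) (foldr (λ a i → f (a , x) ++ i) [] as)) ≤
      length as * item ⟨ size (enc σ x) ⟩ + 1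
  total x []       _   = ≤-refl
  total x (a ∷ as) sz≤ = ≤-trans (size-++ β (f (a , x)) (foldr (λ a i → f (a , x) ++ i) [] as)) (≤-trans
    (+-mono-≤
      (⟦⟧ₚ-bound (space F) (const 1 ⊕ space L ⊕ X) _ (small F (a , x))
        (s≤s (+-monoˡ-≤ _ (≤-trans (m≤m+n (size (enc α a)) _) (≤-trans (n≤1+n _) sz≤)))))
      (total x as (≤-trans (size-++ʳ α (a ∷ []) as) sz≤)))
    (≤-reflexive (sym (+-assoc (item ⟨ size (enc σ x) ⟩) _ 1))))

singletonᴾ : ∀ {σ τ f} → PTime σ τ f → PTime σ (list τ) (λ x → f x ∷ [])
singletonᴾ F = consᴾ F nilᴾ

-- Inflationary fixpoints

module _ {A : Set} {P Q : A → Set} (P? : ∀ a → Dec (P a)) (Q? : ∀ a → Dec (Q a)) where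

  length-filter-mono : ∀ as → (∀ {a} → a ∈ as → P a → Q a) →
    length (filter P? as) ≤ length (filter Q? as)
  length-filter-mono []       P⊆Q = z≤n
  length-filter-mono (a ∷ as) P⊆Q with P? a | Q? a | length-filter-mono as (P⊆Q ∘ there)
  ... | yes p | yes q | le = s≤s le
  ... | yes p | no ¬q | le = contradiction (P⊆Q (here refl) p) ¬q
  ... | no ¬p | yes q | le = m≤n⇒m≤1+n le
  ... | no ¬p | no ¬q | le = le

  filter-grows : ∀ as → (∀ {a} → a ∈ as → P a → Q a) →
    filter Q? as ≡ filter P? as ⊎ suc (length (filter P? as)) ≤ length (filter Q? as)
  filter-grows []       P⊆Q = inj₁ refl
  filter-grows (a ∷ as) P⊆Q with P? a | Q? a | filter-grows as (P⊆Q ∘ there)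
  ... | yes p | yes q | inj₁ eq = inj₁ (cong (a ∷_) eq)
  ... | yes p | yes q | inj₂ lt = inj₂ (s≤s lt)
  ... | yes p | no ¬q | _       = contradiction (P⊆Q (here refl) p) ¬q
  ... | no ¬p | yes q | _       = inj₂ (s≤s (length-filter-mono as (P⊆Q ∘ there)))
  ... | no ¬p | no ¬q | r       = r

module Inflationary {A : Set} {P : A → List A → Set}
  (P? : ∀ a S → Dec (P a S)) (_∈?_ : ∀ (a : A) S → Dec (a ∈ S)) (candidates : List A) where

  new? : ∀ S a → Dec (a ∈ S ⊎ P a S)
  new? S a = (a ∈? S) ⊎-dec P? a S

  grow : List A → List A
  grow S = filter (new? S) candidates

  stage : ℕ → List A
  stage zero    = []
  stage (suc k) = grow (stage k)

  limit : List A
  limit = stage (length candidates)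

  -- Old members are kept, so the conditions by which successive stages filter the one list of
  -- candidates only become weaker. Two successive stages are thus equal or the later one is longer,
  -- and once equal they stay equal.
  stable-or-long : ∀ k → stage (suc k) ≡ stage k ⊎ suc k ≤ length (stage (suc k))
  stable-or-long zero with stage 1
  ... | []    = inj₁ refl
  ... | _ ∷ _ = inj₂ (s≤s z≤n)
  stable-or-long (suc k) with stable-or-long k
  ... | inj₁ eq = inj₁ (cong grow eq)
  ... | inj₂ le with filter-grows (new? (stage k)) (new? (stage (suc k))) candidates
                       (λ a∈ n → inj₁ (∈-filter⁺ (new? (stage k)) a∈ n))
  ...   | inj₁ eq = inj₁ eq
  ...   | inj₂ lt = inj₂ (≤-trans (s≤s le) lt)

  limit-stable : grow limit ≡ limit
  limit-stable with stable-or-long (length candidates)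
  ... | inj₁ eq = eq
  ... | inj₂ le = contradiction le (≤⇒≯ (length-filter (new? limit) candidates))

  limit-closed : ∀ {a} → a ∈ candidates → P a limit → a ∈ limit
  limit-closed a∈ p = subst (_ ∈_) limit-stable (∈-filter⁺ (new? limit) a∈ (inj₂ p))

  limit-least : ∀ {q} (Q : A → Set q) →
    (∀ {a S} → (∀ {b} → b ∈ S → Q b) → P a S → Q a) → ∀ {a} → a ∈ limit → Q a
  limit-least Q step = go (length candidates)
    where
    go : ∀ k {a} → a ∈ stage k → Q a
    go (suc k) a∈ with proj₂ (∈-filter⁻ (new? (stage k)) {xs = candidates} a∈)
    ... | inj₁ a∈′ = go k a∈′
    ... | inj₂ p   = step (go k) p

  -- A fold that ignores the entries of its list merely counts rounds, so the list of candidates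
  -- itself can drive the loop.
  stage-foldr : ∀ {B : Set} (bs : List B) → foldr (λ _ → grow) [] bs ≡ stage (length bs)
  stage-foldr []       = refl
  stage-foldr (_ ∷ bs) = cong grow (stage-foldr bs)

-- Equality of encoded data

_≟ᵗ_ : (s t : Tree) → Dec (s ≡ t)
nil     ≟ᵗ nil     = yes refl
nil     ≟ᵗ (_ ∙ _) = no λ ()
(_ ∙ _) ≟ᵗ nil     = no λ ()
(s ∙ t) ≟ᵗ (u ∙ v) = map′ (λ (p , q) → cong₂ _∙_ p q) (λ { refl → refl , refl }) ((s ≟ᵗ u) ×-dec (t ≟ᵗ v))

-- The state is a stack of pairs still to be compared, and the verdict so far.
compareᵖ : Program
compareᵖ = while hd var loop
  if left then (if right
    then (var≔ cons (cons (cons (hd left) (hd right)) (cons (cons (tl left) (tl right)) (tl (hd var)))) (tl var))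
    else (var≔ cons nil nil))
  else (if right then (var≔ cons nil nil) else (var≔ cons (tl (hd var)) (tl var)))
  where
  left  = hd (hd (hd var))
  right = tl (hd (hd var))

-- The rest of the run is a hypothesis: comparing equal trees pops them and leaves the verdict
-- alone. Each node costs one loop test, two conditionals and one assignment.
compare-≡ : ∀ t {stack v z n} → compareᵖ ⊢ stack ∙ v ⇓ z [ n ] →
  ∃[ k ] (compareᵖ ⊢ ((t ∙ t) ∙ stack) ∙ v ⇓ z [ k ]) × k ≡ 4 * size t + n
compare-≡ nil W = _ , while-true (_ , _ , refl) (if-false refl (if-false refl assign)) W , refl
compare-≡ (s ∙ t) {n = n} W with compare-≡ t W
... | k , W′ , k≡ with compare-≡ s W′
...   | j , W″ , j≡ =
  _ , while-true (_ , _ , refl) (if-true (_ , _ , refl) (if-true (_ , _ , refl) assign)) W″ , (begin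
    4 + j                              ≡⟨ cong (4 +_) (trans j≡ (cong (4 * size s +_) k≡)) ⟩
    4 + (4 * size s + (4 * size t + n)) ≡⟨ cong (4 +_) (+-assoc (4 * size s) _ n) ⟨
    4 + (4 * size s + 4 * size t + n)   ≡⟨ cong (λ m → 4 + (m + n)) (*-distribˡ-+ 4 (size s) (size t)) ⟨
    4 + (4 * (size s + size t) + n)     ≡⟨ cong (_+ n) (*-suc 4 (size s + size t)) ⟨
    4 * size (s ∙ t) + n                ∎)
  where open ≡-Reasoning

-- The first mismatch empties the stack, so only nodes of `s` reached before it are paid for, at
-- four steps each, and one last loop test follows.
compare-≢ : ∀ s t stack v → ¬ s ≡ t →
  ∃[ k ] (compareᵖ ⊢ ((s ∙ t) ∙ stack) ∙ v ⇓ nil ∙ nil [ k ]) × k ≤ 4 * size s + 1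
compare-≢ nil     nil     stack v s≢t = contradiction refl s≢t
compare-≢ nil     (u ∙ w) stack v s≢t =
  5 , while-true (_ , _ , refl) (if-false refl (if-true (_ , _ , refl) assign)) (while-false refl) , ≤-refl
compare-≢ (s ∙ t) nil     stack v s≢t =
  5 , while-true (_ , _ , refl) (if-true (_ , _ , refl) (if-false refl assign)) (while-false refl) ,
  +-monoˡ-≤ 1 (*-monoʳ-≤ 4 (size-pos (s ∙ t)))
compare-≢ (s ∙ t) (u ∙ w) stack v s≢t with s ≟ᵗ u
... | no s≢u with compare-≢ s u ((t ∙ w) ∙ stack) v s≢u
...   | k , W , k≤ = 4 + k , while-true (_ , _ , refl) (if-true (_ , _ , refl) (if-true (_ , _ , refl) assign)) W , (begin
  4 + k                    ≤⟨ +-monoʳ-≤ 4 k≤ ⟩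
  4 + (4 * size s + 1)     ≡⟨ cong (_+ 1) (*-suc 4 (size s)) ⟨
  4 * suc (size s) + 1     ≤⟨ +-monoˡ-≤ 1 (*-monoʳ-≤ 4 (s≤s (m≤m+n (size s) (size t)))) ⟩
  4 * size (s ∙ t) + 1     ∎)
  where open ≤-Reasoning
compare-≢ (s ∙ t) (u ∙ w) stack v s≢t | yes refl with compare-≢ t w stack v (s≢t ∘ cong (s ∙_))
... | k , W , k≤ with compare-≡ s W
...   | j , W′ , j≡ = 4 + j , while-true (_ , _ , refl) (if-true (_ , _ , refl) (if-true (_ , _ , refl) assign)) W′ , (begin
  4 + j                                 ≡⟨ cong (4 +_) j≡ ⟩
  4 + (4 * size s + k)                  ≤⟨ +-monoʳ-≤ 4 (+-monoʳ-≤ (4 * size s) k≤) ⟩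
  4 + (4 * size s + (4 * size t + 1))   ≡⟨ cong (4 +_) (+-assoc (4 * size s) _ 1) ⟨
  4 + (4 * size s + 4 * size t + 1)     ≡⟨ cong (λ m → 4 + (m + 1)) (*-distribˡ-+ 4 (size s) (size t)) ⟨
  4 + (4 * (size s + size t) + 1)       ≡⟨ cong (_+ 1) (*-suc 4 (size s + size t)) ⟨
  4 * size (s ∙ t) + 1                  ∎)
  where open ≤-Reasoning

-- The decoders are left inverses of the encodings, with arbitrary values on malformed trees. They
-- yield injectivity, which lets the program decide equality of data by comparing trees.
decName : Tree → ℕᵇ
decName nil             = zero
decName (nil     ∙ t)   = 2[1+ decName t ]
decName ((_ ∙ _) ∙ t)   = 1+[2 decName t ]

decConcept : Tree → Concept
decConcept (nil ∙ t)                           = atom (decName t)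
decConcept ((_ ∙ (_ ∙ nil)) ∙ (s ∙ t))         = decConcept s ⊓ decConcept t
decConcept ((_ ∙ (_ ∙ (_ ∙ _))) ∙ (s ∙ t))     = ∃⟨ decName s ⟩ decConcept t
decConcept _                                   = ⊤

decInclusion : Tree → Inclusion
decInclusion (nil ∙ (s ∙ t))                           = decConcept s ⊑ decConcept t
decInclusion ((_ ∙ nil) ∙ (s ∙ t))                     = ran⟨ decName s ⟩⊑ decConcept t
decInclusion ((_ ∙ (_ ∙ nil)) ∙ (s ∙ (t ∙ u)))         = ran⟨ decName s ⟩⊓ decConcept t ⊑ decConcept u
decInclusion ((_ ∙ (_ ∙ (_ ∙ nil))) ∙ (s ∙ t))         = decConcept s ≡ᶜ decConcept t
decInclusion ((_ ∙ (_ ∙ (_ ∙ (_ ∙ _)))) ∙ (s ∙ t))     = decName s ⊑ʳ decName t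
decInclusion _                                         = ⊤ ⊑ ⊤

decName-enc : ∀ n → decName (encName n) ≡ n
decName-enc zero     = refl
decName-enc 2[1+ n ] = cong 2[1+_] (decName-enc n)
decName-enc 1+[2 n ] = cong 1+[2_] (decName-enc n)

decConcept-enc : ∀ C → decConcept (encConcept C) ≡ C
decConcept-enc (atom A)   = cong atom (decName-enc A)
decConcept-enc ⊤          = refl
decConcept-enc (C ⊓ D)    = cong₂ _⊓_ (decConcept-enc C) (decConcept-enc D)
decConcept-enc (∃⟨ r ⟩ C) = cong₂ ∃⟨_⟩_ (decName-enc r) (decConcept-enc C)

decInclusion-enc : ∀ α → decInclusion (encInclusion α) ≡ α
decInclusion-enc (C ⊑ D)           = cong₂ _⊑_ (decConcept-enc C) (decConcept-enc D)
decInclusion-enc (ran⟨ r ⟩⊑ D)     = cong₂ ran⟨_⟩⊑_ (decName-enc r) (decConcept-enc D)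
decInclusion-enc (ran⟨ r ⟩⊓ C ⊑ D)
  rewrite decName-enc r | decConcept-enc C | decConcept-enc D = refl
decInclusion-enc (C ≡ᶜ D)          = cong₂ _≡ᶜ_ (decConcept-enc C) (decConcept-enc D)
decInclusion-enc (r ⊑ʳ s)          = cong₂ _⊑ʳ_ (decName-enc r) (decName-enc s)

retraction⇒injective : ∀ {A : Set} {e : A → Tree} (d : Tree → A) → (∀ x → d (e x) ≡ x) →
                       ∀ x y → e x ≡ e y → x ≡ y
retraction⇒injective d d-e x y eq = trans (sym (d-e x)) (trans (cong d eq) (d-e y))

enc-injective : ∀ σ (x y : El σ) → enc σ x ≡ enc σ y → x ≡ y
enc-injective name          = retraction⇒injective decName decName-enc
enc-injective concept       = retraction⇒injective decConcept decConcept-enc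
enc-injective inclusion     = retraction⇒injective decInclusion decInclusion-enc
enc-injective bool false false _ = refl
enc-injective bool true  true  _ = refl
enc-injective bool false true  ()
enc-injective bool true  false ()
enc-injective (list σ) []       []       _  = refl
enc-injective (list σ) (x ∷ xs) (y ∷ ys) eq =
  cong₂ _∷_ (enc-injective σ x y (cong head eq)) (enc-injective (list σ) xs ys (cong tail eq))
enc-injective (list σ) []       (y ∷ ys) ()
enc-injective (list σ) (x ∷ xs) []       ()
enc-injective (opt σ) nothing  nothing  _  = refl
enc-injective (opt σ) (just x) (just y) eq = cong just (enc-injective σ x y (cong tail eq))
enc-injective (opt σ) nothing  (just y) ()
enc-injective (opt σ) (just x) nothing  ()
enc-injective (σ ×ᵗ τ) (x , y) (u , v) eq =
  cong₂ _,_ (enc-injective σ x u (cong head eq)) (enc-injective τ y v (cong tail eq))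
enc-injective (σ ⊎ᵗ τ) (inj₁ x) (inj₁ y) eq = cong inj₁ (enc-injective σ x y (cong tail eq))
enc-injective (σ ⊎ᵗ τ) (inj₂ x) (inj₂ y) eq = cong inj₂ (enc-injective τ x y (cong tail eq))
enc-injective (σ ⊎ᵗ τ) (inj₁ x) (inj₂ y) ()
enc-injective (σ ⊎ᵗ τ) (inj₂ x) (inj₁ y) ()

equal? : ∀ σ (x y : El σ) → Dec (x ≡ y)
equal? σ x y = map′ (enc-injective σ x y) (cong (enc σ)) (enc σ x ≟ᵗ enc σ y)

≡ᴰ : ∀ {σ τ f g} → PTime σ τ f → PTime σ τ g → Decider σ (λ x → f x ≡ g x)
≡ᴰ {τ = τ} {f} {g} F G = eq [ pairᴾ F G ]ᴰ
  where
  program′ : Program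
  -- The stack starts with the one pair to be compared and the verdict with the encoding of `true`.
  program′ = var≔ cons (cons var nil) (cons nil nil) ⨾ compareᵖ ⨾ var≔ tl var
  verdict : ∀ s t → ∃[ n ] (program′ ⊢ s ∙ t ⇓ enc bool (does (s ≟ᵗ t)) [ n ]) ×
                           n ≤ 4 * size s + 3
  verdict s t with s ≟ᵗ t
  ... | yes refl with compare-≡ s (while-false refl)
  ...   | k , W , k≡ = 1 + (k + 1) , seq assign (seq W assign) , ≤-reflexive
            (trans (cong suc (+-comm k 1)) (trans (cong (2 +_) k≡)
              (trans (sym (+-assoc 2 (4 * size s) 1)) (trans (cong (_+ 1) (+-comm 2 (4 * size s)))
                (+-assoc (4 * size s) 2 1)))))
  verdict s t | no s≢t with compare-≢ s t nil (nil ∙ nil) s≢t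
  ...   | k , W , k≤ = 1 + (k + 1) , seq assign (seq W assign) ,
            ≤-trans (s≤s (+-monoˡ-≤ 1 k≤)) (≤-reflexive
              (trans (cong suc (+-assoc (4 * size s) 1 1)) (sym (+-suc (4 * size s) 2))))
  eq : Decider (τ ×ᵗ τ) (λ (x , y) → x ≡ y)
  eq = record
    { dec   = λ (x , y) → equal? τ x y
    ; ptime = record
      { program = program′
      ; time    = const 4 ⊗ X ⊕ const 3
      ; space   = const 3
      ; halts   = λ (x , y) → let n , P⇓ , n≤ = verdict (enc τ x) (enc τ y) in
          n , P⇓ , ≤-trans n≤ (+-monoˡ-≤ 3 (*-monoʳ-≤ 4
            (≤-trans (m≤m+n (size (enc τ x)) _) (n≤1+n _))))
      ; small   = λ (x , y) → size-bool (does (equal? τ x y))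
      }
    }

∈ᴰ : ∀ {σ τ f l} → PTime σ τ f → PTime σ (list τ) l → Decider σ (λ x → f x ∈ l x)
∈ᴰ F L = mapᴰ (λ { (_ , a∈ , refl) → a∈ }) (λ a∈ → _ , a∈ , refl)
              (∃ᴰ L (≡ᴰ (F ∘ᴾ sndᴾ) fstᴾ))

module Limit {σ α l} {P : El (α ×ᵗ (list α ×ᵗ σ)) → Set}
  (L : PTime σ (list α) l) (D : Decider (α ×ᵗ (list α ×ᵗ σ)) P) where

  member : Decider (α ×ᵗ list α) (λ (a , S) → a ∈ S)
  member = ∈ᴰ fstᴾ sndᴾ

  module At (x : El σ) =
    Inflationary {P = λ a S → P (a , S , x)} (λ a S → dec D (a , S , x)) (λ a S → dec member (a , S)) (l x)

  growᴰ : Decider (α ×ᵗ (list α ×ᵗ σ)) (λ (a , S , x) → a ∈ S ⊎ P (a , S , x))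
  growᴰ = member [ pairᴾ fstᴾ (fstᴾ ∘ᴾ sndᴾ) ]ᴰ ⊎ᴰ D

  limitᴾ : PTime σ (list α) (λ x → At.limit x)
  limitᴾ = ≗-PTime (λ x → At.stage-foldr x (l x))
    (foldrᴾ (λ (_ , S , x) → At.grow x S) L nilᴾ
      (filterᴾ (L ∘ᴾ sndᴾ) growᴰ ∘ᴾ sndᴾ) (space L ⊕ const 1)
      bound)
    where
    bound : ∀ x ps qs → l x ≡ ps ++ qs →
      size (enc (list α) (foldr (λ _ → At.grow x) [] qs)) ≤ (space L ⊕ const 1) ⟨ size (enc σ x) ⟩
    bound x ps []       _ = m≤n+m 1 _
    bound x ps (q ∷ qs) _ =
      ≤-trans (filter-small α (At.new? x (foldr (λ _ → At.grow x) [] qs)) (l x)) (≤-trans (small L x) (m≤m+n _ 1))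

-- Access to constructors

data View (k : ℕ) : Tree → Tree → Set where
  match : ∀ {u} → View k (tag k ∙ u) (u ∙ nil)
  other : ∀ j {u} → ¬ j ≡ k → View k (tag j ∙ u) nil

viewᵖ : ℕ → Expr → Program
viewᵖ zero    e = if e then (var≔ nil) else (var≔ cons (tl var) nil)
viewᵖ (suc k) e = if e then viewᵖ k (tl e) else (var≔ nil)

viewᵖ-match : ∀ k e x → eval e x ≡ tag k → ∃[ n ] (viewᵖ k e ⊢ x ⇓ tail x ∙ nil [ n ]) × n ≤ 2 + k
viewᵖ-match zero    e x eq = 2 , if-false eq assign , ≤-refl
viewᵖ-match (suc k) e x eq = let n , V⇓ , n≤ = viewᵖ-match k (tl e) x (cong tail eq) in
  suc n , if-true (_ , _ , eq) V⇓ , s≤s n≤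

viewᵖ-other : ∀ k j e x → ¬ j ≡ k → eval e x ≡ tag j → ∃[ n ] (viewᵖ k e ⊢ x ⇓ nil [ n ]) × n ≤ 2 + k
viewᵖ-other zero    zero    e x j≢k eq = contradiction refl j≢k
viewᵖ-other zero    (suc j) e x j≢k eq = 2 , if-true (_ , _ , eq) assign , ≤-refl
viewᵖ-other (suc k) zero    e x j≢k eq = 2 , if-false eq assign , s≤s (s≤s z≤n)
viewᵖ-other (suc k) (suc j) e x j≢k eq =
  let n , V⇓ , n≤ = viewᵖ-other k j (tl e) x (j≢k ∘ cong suc) (cong tail eq) in
  suc n , if-true (_ , _ , eq) V⇓ , s≤s n≤

viewᴾ : ∀ {σ τ f} k → (∀ x → View k (enc σ x) (enc (list τ) (f x))) → PTime σ (list τ) f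
viewᴾ k view = record
  { program = viewᵖ k (hd var)
  ; time    = const (2 + k)
  ; space   = X ⊕ const 1
  ; halts   = λ x → run (view x)
  ; small   = λ x → bound (view x)
  }
  where
  run : ∀ {t r} → View k t r → ∃[ n ] (viewᵖ k (hd var) ⊢ t ⇓ r [ n ]) × n ≤ 2 + k
  run match         = viewᵖ-match k (hd var) _ refl
  run (other j j≢k) = viewᵖ-other k j (hd var) _ j≢k refl
  bound : ∀ {t r} → View k t r → size r ≤ size t + 1
  bound (match {u}) = begin
    suc (size u + 1)                ≤⟨ s≤s (+-monoˡ-≤ 1 (m≤n+m (size u) (size (tag k)))) ⟩
    suc (size (tag k) + size u) + 1 ∎
    where open ≤-Reasoning
  bound (other j _) = s≤s z≤n

-- Matching on a constructor returns a list with at most one entry, so that inside a rule pattern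
-- matching becomes a quantifier bounded by that list.
asAtom : Concept → List NC
asAtom (atom A) = A ∷ []
asAtom _        = []

asAnd : Concept → List (Concept × Concept)
asAnd (C ⊓ D) = (C , D) ∷ []
asAnd _       = []

asEx : Concept → List (NR × Concept)
asEx (∃⟨ r ⟩ C) = (r , C) ∷ []
asEx _          = []

asSub : Inclusion → List (Concept × Concept)
asSub (C ⊑ D) = (C , D) ∷ []
asSub _       = []

asRan : Inclusion → List (NR × Concept)
asRan (ran⟨ r ⟩⊑ D) = (r , D) ∷ []
asRan _             = []

asEqn : Inclusion → List (Concept × Concept)
asEqn (C ≡ᶜ D) = (C , D) ∷ []
asEqn _        = []

asRole : Inclusion → List (NR × NR)
asRole (r ⊑ʳ s) = (r , s) ∷ []
asRole _        = []

asJust : ∀ {A : Set} → Maybe A → List A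
asJust (just x) = x ∷ []
asJust nothing  = []

asInj₁ : ∀ {A B : Set} → A ⊎ B → List A
asInj₁ (inj₁ x) = x ∷ []
asInj₁ (inj₂ _) = []

asInj₂ : ∀ {A B : Set} → A ⊎ B → List B
asInj₂ (inj₁ _) = []
asInj₂ (inj₂ y) = y ∷ []

asAtomᴾ : PTime concept (list name) asAtom
asAtomᴾ = viewᴾ 0 λ where
  (atom A)   → match
  ⊤          → other 1 λ ()
  (C ⊓ D)    → other 2 λ ()
  (∃⟨ r ⟩ C) → other 3 λ ()

asAndᴾ : PTime concept (list (concept ×ᵗ concept)) asAnd
asAndᴾ = viewᴾ 2 λ where
  (atom A)   → other 0 λ ()
  ⊤          → other 1 λ ()
  (C ⊓ D)    → match
  (∃⟨ r ⟩ C) → other 3 λ ()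

asExᴾ : PTime concept (list (name ×ᵗ concept)) asEx
asExᴾ = viewᴾ 3 λ where
  (atom A)   → other 0 λ ()
  ⊤          → other 1 λ ()
  (C ⊓ D)    → other 2 λ ()
  (∃⟨ r ⟩ C) → match

asSubᴾ : PTime inclusion (list (concept ×ᵗ concept)) asSub
asSubᴾ = viewᴾ 0 λ where
  (C ⊑ D)           → match
  (ran⟨ r ⟩⊑ D)     → other 1 λ ()
  (ran⟨ r ⟩⊓ C ⊑ D) → other 2 λ ()
  (C ≡ᶜ D)          → other 3 λ ()
  (r ⊑ʳ s)          → other 4 λ ()

asRanᴾ : PTime inclusion (list (name ×ᵗ concept)) asRan
asRanᴾ = viewᴾ 1 λ where
  (C ⊑ D)           → other 0 λ ()
  (ran⟨ r ⟩⊑ D)     → match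
  (ran⟨ r ⟩⊓ C ⊑ D) → other 2 λ ()
  (C ≡ᶜ D)          → other 3 λ ()
  (r ⊑ʳ s)          → other 4 λ ()

asEqnᴾ : PTime inclusion (list (concept ×ᵗ concept)) asEqn
asEqnᴾ = viewᴾ 3 λ where
  (C ⊑ D)           → other 0 λ ()
  (ran⟨ r ⟩⊑ D)     → other 1 λ ()
  (ran⟨ r ⟩⊓ C ⊑ D) → other 2 λ ()
  (C ≡ᶜ D)          → match
  (r ⊑ʳ s)          → other 4 λ ()

asRoleᴾ : PTime inclusion (list (name ×ᵗ name)) asRole
asRoleᴾ = viewᴾ 4 λ where
  (C ⊑ D)           → other 0 λ ()
  (ran⟨ r ⟩⊑ D)     → other 1 λ ()
  (ran⟨ r ⟩⊓ C ⊑ D) → other 2 λ ()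
  (C ≡ᶜ D)          → other 3 λ ()
  (r ⊑ʳ s)          → match

asJustᴾ : ∀ {σ} → PTime (opt σ) (list σ) asJust
asJustᴾ = viewᴾ 0 λ where
  (just x) → match
  nothing  → other 1 λ ()

asInj₁ᴾ : ∀ {σ τ} → PTime (σ ⊎ᵗ τ) (list σ) asInj₁
asInj₁ᴾ = viewᴾ 0 λ where
  (inj₁ x) → match
  (inj₂ y) → other 1 λ ()

asInj₂ᴾ : ∀ {σ τ} → PTime (σ ⊎ᵗ τ) (list τ) asInj₂
asInj₂ᴾ = viewᴾ 1 λ where
  (inj₁ x) → other 0 λ ()
  (inj₂ y) → match

tagᵉ : ℕ → Expr
tagᵉ zero    = nil
tagᵉ (suc n) = cons nil (tagᵉ n)

atomᴾ : PTime name concept atom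
atomᴾ = exprᴾ (cons (tagᵉ 0) var) (λ _ → refl)

⊤ᴾ : ∀ {σ} → PTime σ concept (λ _ → ⊤)
⊤ᴾ = exprᴾ (cons (tagᵉ 1) nil) (λ _ → refl)

exᴾ : PTime (name ×ᵗ concept) concept (λ (r , C) → ∃⟨ r ⟩ C)
exᴾ = exprᴾ (cons (tagᵉ 3) var) (λ _ → refl)

justᴾ : ∀ {σ} → PTime σ (opt σ) just
justᴾ = exprᴾ (cons (tagᵉ 0) var) (λ _ → refl)

nothingᴾ : ∀ {σ τ} → PTime σ (opt τ) (λ _ → nothing)
nothingᴾ = exprᴾ (cons (tagᵉ 1) nil) (λ _ → refl)

inj₁ᴾ : ∀ {σ τ} → PTime σ (σ ⊎ᵗ τ) inj₁
inj₁ᴾ = exprᴾ (cons (tagᵉ 0) var) (λ _ → refl)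

inj₂ᴾ : ∀ {σ τ} → PTime τ (σ ⊎ᵗ τ) inj₂
inj₂ᴾ = exprᴾ (cons (tagᵉ 1) var) (λ _ → refl)

-- Subconcepts

data _≼_ (C : Concept) : Concept → Set where
  self  : C ≼ C
  left  : ∀ {D E} → C ≼ D → C ≼ (D ⊓ E)
  right : ∀ {D E} → C ≼ E → C ≼ (D ⊓ E)
  under : ∀ {r D} → C ≼ D → C ≼ (∃⟨ r ⟩ D)

≼-trans : ∀ {C D E} → C ≼ D → D ≼ E → C ≼ E
≼-trans p self      = p
≼-trans p (left q)  = left (≼-trans p q)
≼-trans p (right q) = right (≼-trans p q)
≼-trans p (under q) = under (≼-trans p q)

-- The accumulator is filled in the order in which the stack loop `subsᵖ` meets the concepts, so
-- that it describes the states of that loop exactly.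
subsOnto : Concept → List Concept → List Concept
subsOnto (atom A)   S = atom A ∷ S
subsOnto ⊤          S = ⊤ ∷ S
subsOnto (C ⊓ D)    S = subsOnto D (subsOnto C (C ⊓ D ∷ S))
subsOnto (∃⟨ r ⟩ C) S = subsOnto C (∃⟨ r ⟩ C ∷ S)

subs : Concept → List Concept
subs C = subsOnto C []

subsOnto-old : ∀ C {D S} → D ∈ S → D ∈ subsOnto C S
subsOnto-old (atom A)   D∈ = there D∈
subsOnto-old ⊤          D∈ = there D∈
subsOnto-old (C ⊓ E)    D∈ = subsOnto-old E (subsOnto-old C (there D∈))
subsOnto-old (∃⟨ r ⟩ C) D∈ = subsOnto-old C (there D∈)

subsOnto⁺ : ∀ {C D} → D ≼ C → ∀ S → D ∈ subsOnto C S
subsOnto⁺ {atom A}   self      S = here refl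
subsOnto⁺ {⊤}        self      S = here refl
subsOnto⁺ {C ⊓ E}    self      S = subsOnto-old E (subsOnto-old C (here refl))
subsOnto⁺ {∃⟨ r ⟩ C} self      S = subsOnto-old C (here refl)
subsOnto⁺ {C ⊓ E}    (left p)  S = subsOnto-old E (subsOnto⁺ p _)
subsOnto⁺ {C ⊓ E}    (right p) S = subsOnto⁺ p _
subsOnto⁺ {∃⟨ r ⟩ C} (under p) S = subsOnto⁺ p _

subsOnto⁻ : ∀ C {D S} → D ∈ subsOnto C S → D ≼ C ⊎ D ∈ S
subsOnto⁻ (atom A) (here refl) = inj₁ self
subsOnto⁻ (atom A) (there D∈)  = inj₂ D∈
subsOnto⁻ ⊤        (here refl) = inj₁ self
subsOnto⁻ ⊤        (there D∈)  = inj₂ D∈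
subsOnto⁻ (C ⊓ E) D∈ with subsOnto⁻ E D∈
... | inj₁ p = inj₁ (right p)
... | inj₂ D∈′ with subsOnto⁻ C D∈′
...   | inj₁ p           = inj₁ (left p)
...   | inj₂ (here refl) = inj₁ self
...   | inj₂ (there D∈″) = inj₂ D∈″
subsOnto⁻ (∃⟨ r ⟩ C) D∈ with subsOnto⁻ C D∈
... | inj₁ p           = inj₁ (under p)
... | inj₂ (here refl) = inj₁ self
... | inj₂ (there D∈′) = inj₂ D∈′

-- The state is a stack of concepts still to be decomposed, and the concepts met so far.
subsᵖ : Program
subsᵖ = while hd var loop
  if kind then (if tl kind then (if tl (tl kind)
    then (var≔ cons (cons (tl payload) rest) met)
    else (var≔ cons (cons (hd payload) (cons (tl payload) rest)) met))
    else (var≔ cons rest met))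
  else (var≔ cons rest met)
  where
  rest    = tl (hd var)
  kind    = hd (hd (hd var))
  payload = tl (hd (hd var))
  met     = cons (hd (hd var)) (tl var)

-- The rest of the run is again a hypothesis. A round consists of the loop test, at most three tests
-- of the tag and one assignment, hence the factor 5.
subsᵖ-⇓ : ∀ C {todo S z n} →
  subsᵖ ⊢ enc (list concept ×ᵗ list concept) (todo , subsOnto C S) ⇓ z [ n ] →
  ∃[ k ] (subsᵖ ⊢ enc (list concept ×ᵗ list concept) (C ∷ todo , S) ⇓ z [ k ]) ×
         k ≤ 5 * size (encConcept C) + n
subsᵖ-⇓ (atom A) {n = n} W = _ , while-true (_ , _ , refl) (if-false refl assign) W ,
  +-monoˡ-≤ n {3} (≤-trans (s≤s (s≤s (s≤s z≤n))) (*-monoʳ-≤ 5 (size-pos (encConcept (atom A)))))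
subsᵖ-⇓ ⊤ {n = n} W =
  _ , while-true (_ , _ , refl) (if-true (_ , _ , refl) (if-false refl assign)) W ,
  +-monoˡ-≤ n {4} (s≤s (s≤s (s≤s (s≤s z≤n))))
subsᵖ-⇓ (C ⊓ D) {todo} {n = n} W with subsᵖ-⇓ D {todo} W
... | k , W′ , k≤ with subsᵖ-⇓ C {D ∷ todo} W′
...   | j , W″ , j≤ =
  _ , while-true (_ , _ , refl) (if-true (_ , _ , refl) (if-true (_ , _ , refl) (if-false refl assign))) W″ , (begin
    5 + j                            ≤⟨ +-monoʳ-≤ 5 (≤-trans j≤ (+-monoʳ-≤ (5 * c) k≤)) ⟩
    5 + (5 * c + (5 * d + n))        ≡⟨ cong (5 +_) (+-assoc (5 * c) (5 * d) n) ⟨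
    5 + (5 * c + 5 * d + n)          ≡⟨ cong (λ m → 5 + (m + n)) (*-distribˡ-+ 5 c d) ⟨
    5 + 5 * (c + d) + n              ≡⟨ cong (_+ n) (*-suc 5 (c + d)) ⟨
    5 * suc (c + d) + n              ≤⟨ +-monoˡ-≤ n (*-monoʳ-≤ 5 (m≤n+m (suc (c + d)) 6)) ⟩
    5 * size (encConcept (C ⊓ D)) + n ∎)
  where
  open ≤-Reasoning
  c = size (encConcept C)
  d = size (encConcept D)
subsᵖ-⇓ (∃⟨ r ⟩ C) {todo} {n = n} W with subsᵖ-⇓ C {todo} W
... | k , W′ , k≤ =
  _ , while-true (_ , _ , refl) (if-true (_ , _ , refl) (if-true (_ , _ , refl) (if-true (_ , _ , refl) assign))) W′ , (begin
    5 + k                            ≤⟨ +-monoʳ-≤ 5 k≤ ⟩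
    5 + 5 * c + n                    ≡⟨ cong (_+ n) (*-suc 5 c) ⟨
    5 * suc c + n                    ≤⟨ +-monoˡ-≤ n (*-monoʳ-≤ 5 (s≤s (≤-trans (m≤n+m c (size (encName r))) (m≤n+m _ 8)))) ⟩
    5 * size (encConcept (∃⟨ r ⟩ C)) + n ∎)
  where
  open ≤-Reasoning
  c = size (encConcept C)

-- Each syntax node contributes one entry: a list cell and a subconcept of size at most `m`. The
-- bound `m` stays fixed during the induction, while the number of nodes is bounded by the size of
-- the concept at hand.
subsOnto-small : ∀ C m S → size (encConcept C) ≤ m →
  size (enc (list concept) (subsOnto C S)) ≤ size (encConcept C) * suc m + size (enc (list concept) S)
subsOnto-small C m S C≤m = go C S C≤m
  where
  open ≤-Reasoning
  leaf : ∀ C S → size (encConcept C) ≤ m →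
    size (enc (list concept) (C ∷ S)) ≤ size (encConcept C) * suc m + size (enc (list concept) S)
  leaf C S C≤m = begin
    suc (size (encConcept C)) + s           ≤⟨ +-monoˡ-≤ s (s≤s C≤m) ⟩
    suc m + s                               ≡⟨ cong (_+ s) (*-identityˡ (suc m)) ⟨
    1 * suc m + s                           ≤⟨ +-monoˡ-≤ s (*-monoˡ-≤ (suc m) (size-pos (encConcept C))) ⟩
    size (encConcept C) * suc m + s         ∎
    where s = size (enc (list concept) S)
  go : ∀ C S → size (encConcept C) ≤ m →
    size (enc (list concept) (subsOnto C S)) ≤ size (encConcept C) * suc m + size (enc (list concept) S)
  go (atom A)   S C≤m = leaf (atom A) S C≤m
  go ⊤          S C≤m = leaf ⊤ S C≤m
  go (C ⊓ D)    S le = begin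
    size (enc (list concept) (subsOnto D (subsOnto C (C ⊓ D ∷ S))))
      ≤⟨ go D _ (≤-trans d≤ le) ⟩
    d * suc m + size (enc (list concept) (subsOnto C (C ⊓ D ∷ S)))
      ≤⟨ +-monoʳ-≤ (d * suc m) (go C _ (≤-trans c≤ le)) ⟩
    d * suc m + (c * suc m + (suc (size (encConcept (C ⊓ D))) + s))
      ≤⟨ +-monoʳ-≤ (d * suc m) (+-monoʳ-≤ (c * suc m) (+-monoˡ-≤ s (s≤s le))) ⟩
    d * suc m + (c * suc m + (suc m + s))
      ≡⟨ +-assoc (d * suc m) (c * suc m) _ ⟨
    d * suc m + c * suc m + (suc m + s)
      ≡⟨ cong (_+ (suc m + s)) (*-distribʳ-+ (suc m) d c) ⟨
    (d + c) * suc m + (suc m + s)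
      ≡⟨ +-assoc ((d + c) * suc m) (suc m) s ⟨
    (d + c) * suc m + suc m + s
      ≡⟨ cong (_+ s) (+-comm ((d + c) * suc m) (suc m)) ⟩
    suc (d + c) * suc m + s
      ≡⟨ cong (λ k → suc k * suc m + s) (+-comm d c) ⟩
    suc (c + d) * suc m + s
      ≤⟨ +-monoˡ-≤ s (*-monoˡ-≤ (suc m) (m≤n+m (suc (c + d)) 6)) ⟩
    size (encConcept (C ⊓ D)) * suc m + s ∎
    where
    s = size (enc (list concept) S)
    c = size (encConcept C)
    d = size (encConcept D)
    c≤ : c ≤ size (encConcept (C ⊓ D))
    c≤ = ≤-trans (m≤m+n c d) (m≤n+m (c + d) 7)
    d≤ : d ≤ size (encConcept (C ⊓ D))
    d≤ = ≤-trans (m≤n+m d c) (m≤n+m (c + d) 7)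
  go (∃⟨ r ⟩ C) S le = begin
    size (enc (list concept) (subsOnto C (∃⟨ r ⟩ C ∷ S)))
      ≤⟨ go C _ (≤-trans c≤ le) ⟩
    c * suc m + (suc (size (encConcept (∃⟨ r ⟩ C))) + s)
      ≤⟨ +-monoʳ-≤ (c * suc m) (+-monoˡ-≤ s (s≤s le)) ⟩
    c * suc m + (suc m + s)
      ≡⟨ +-assoc (c * suc m) (suc m) s ⟨
    c * suc m + suc m + s
      ≡⟨ cong (_+ s) (+-comm (c * suc m) (suc m)) ⟩
    suc c * suc m + s
      ≤⟨ +-monoˡ-≤ s (*-monoˡ-≤ (suc m) (s≤s (≤-trans (m≤n+m c (size (encName r))) (m≤n+m _ 8)))) ⟩
    size (encConcept (∃⟨ r ⟩ C)) * suc m + s ∎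
    where
    s = size (enc (list concept) S)
    c = size (encConcept C)
    c≤ : c ≤ size (encConcept (∃⟨ r ⟩ C))
    c≤ = ≤-trans (m≤n+m c (size (encName r))) (m≤n+m _ 9)

subsᴾ : PTime concept (list concept) subs
subsᴾ = record
  { program = var≔ cons (cons var nil) nil ⨾ subsᵖ ⨾ var≔ tl var
  ; time    = const 1 ⊕ (const 5 ⊗ X ⊕ const 1 ⊕ const 1)
  ; space   = X ⊗ (const 1 ⊕ X) ⊕ const 1
  ; halts   = λ C → let k , W , k≤ = subsᵖ-⇓ C {[]} {[]} (while-false refl) in
      1 + (k + 1) , seq assign (seq W assign) , s≤s (+-monoˡ-≤ 1 k≤)
  ; small   = λ C → subsOnto-small C (size (encConcept C)) [] ≤-refl
  }

-- Entailment in terminologies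

-- A context (m , K) stands for an element of K with an incoming m-edge, if m is a role.
Ctx : Set
Ctx = Maybe NR × Concept

infix 4 _⊢_⊑*_ _⊢_⊩_

data _⊢_⊑*_ (T : TBox) (r : NR) : NR → Set where
  done : T ⊢ r ⊑* r
  step : ∀ {s t} → T ⊢ r ⊑* s → (s ⊑ʳ t) ∈ T → T ⊢ r ⊑* t

⊑*-trans : ∀ {T r s t} → T ⊢ r ⊑* s → T ⊢ s ⊑* t → T ⊢ r ⊑* t
⊑*-trans p done        = p
⊑*-trans p (step q ax) = step (⊑*-trans p q) ax

-- The rules derive what holds at every element of a context. Rule `ex` passes to the context of the
-- successor, which knows its filler and its incoming role; that role is where range axioms apply in
-- `rng`.
data _⊢_⊩_ (T : TBox) : Ctx → Concept → Set where
  init   : ∀ {m K} → T ⊢ m , K ⊩ K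
  top    : ∀ {e} → T ⊢ e ⊩ ⊤
  pair   : ∀ {e C D} → T ⊢ e ⊩ C → T ⊢ e ⊩ D → T ⊢ e ⊩ C ⊓ D
  fst    : ∀ {e C D} → T ⊢ e ⊩ C ⊓ D → T ⊢ e ⊩ C
  snd    : ∀ {e C D} → T ⊢ e ⊩ C ⊓ D → T ⊢ e ⊩ D
  ex     : ∀ {e r s K L} → T ⊢ e ⊩ ∃⟨ r ⟩ K → T ⊢ r ⊑* s → T ⊢ just r , K ⊩ L → T ⊢ e ⊩ ∃⟨ s ⟩ L
  sub    : ∀ {e C D} → (C ⊑ D) ∈ T → T ⊢ e ⊩ C → T ⊢ e ⊩ D
  unfold : ∀ {e C D} → (C ≡ᶜ D) ∈ T → T ⊢ e ⊩ C → T ⊢ e ⊩ D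
  fold   : ∀ {e C D} → (C ≡ᶜ D) ∈ T → T ⊢ e ⊩ D → T ⊢ e ⊩ C
  rng    : ∀ {r s K D} → (ran⟨ s ⟩⊑ D) ∈ T → T ⊢ r ⊑* s → T ⊢ just r , K ⊩ D

infix 4 _⊢_⊒_

data _⊢_⊒_ (T : TBox) : Maybe NR → Maybe NR → Set where
  any   : ∀ {m} → T ⊢ m ⊒ nothing
  below : ∀ {r s} → T ⊢ r ⊑* s → T ⊢ just r ⊒ just s

-- A derivation uses its context only in `init`, where the given derivation is inserted, and in
-- `rng`, where the role chain is prolonged. The side derivation in `ex` lives in a context of its
-- own and is kept.
cut : ∀ {T m m′ K K′ L} → T ⊢ m ⊒ m′ → T ⊢ m , K ⊩ K′ → T ⊢ m′ , K′ ⊩ L → T ⊢ m , K ⊩ L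
cut m⊒ d init          = d
cut m⊒ d top           = top
cut m⊒ d (pair p q)    = pair (cut m⊒ d p) (cut m⊒ d q)
cut m⊒ d (fst p)       = fst (cut m⊒ d p)
cut m⊒ d (snd p)       = snd (cut m⊒ d p)
cut m⊒ d (ex p r⊑s q)  = ex (cut m⊒ d p) r⊑s q
cut m⊒ d (sub ax p)    = sub ax (cut m⊒ d p)
cut m⊒ d (unfold ax p) = unfold ax (cut m⊒ d p)
cut m⊒ d (fold ax p)   = fold ax (cut m⊒ d p)
cut (below r⊑s) d (rng ax s⊑t) = rng ax (⊑*-trans r⊑s s⊑t)

⊒-refl : ∀ {T} m → T ⊢ m ⊒ m
⊒-refl nothing  = any
⊒-refl (just r) = below done

query : Maybe NR → Concept → Concept → Inclusion
query nothing  C D = C ⊑ D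
query (just r) C D = ran⟨ r ⟩⊓ C ⊑ D

module Sound {T : TBox} (I : Interpretation) (I⊨T : All (I satisfies_) T) where
  open Interpretation I renaming (role to roleᴵ)

  ⊑*-sound : ∀ {r s d e} → T ⊢ r ⊑* s → roleᴵ r d e → roleᴵ s d e
  ⊑*-sound done         = id
  ⊑*-sound (step p ax)  = All.lookup I⊨T ax ∘ ⊑*-sound p

  Incoming : Maybe NR → Δ → Set
  Incoming nothing  d = Unit
  Incoming (just r) d = ran r d

  ⊩-sound : ∀ {m K L d} → T ⊢ m , K ⊩ L → Incoming m d → ⟦ K ⟧ d → ⟦ L ⟧ d
  ⊩-sound init          i k = k
  ⊩-sound top           i k = _
  ⊩-sound (pair p q)    i k = ⊩-sound p i k , ⊩-sound q i k
  ⊩-sound (fst p)       i k = proj₁ (⊩-sound p i k)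
  ⊩-sound (snd p)       i k = proj₂ (⊩-sound p i k)
  ⊩-sound (ex p r⊑s q)  i k = let e , e∈ , de = ⊩-sound p i k in
                              e , ⊩-sound q (_ , de) e∈ , ⊑*-sound r⊑s de
  ⊩-sound (sub ax p)    i k = All.lookup I⊨T ax (⊩-sound p i k)
  ⊩-sound (unfold ax p) i k = proj₁ (All.lookup I⊨T ax) (⊩-sound p i k)
  ⊩-sound (fold ax p)   i k = proj₂ (All.lookup I⊨T ax) (⊩-sound p i k)
  ⊩-sound (rng ax r⊑s) (e , ed) k = All.lookup I⊨T ax (e , ⊑*-sound r⊑s ed)

sound : ∀ {T} m {K L} → T ⊢ m , K ⊩ L → T ⊨ query m K L
sound nothing  p I I⊨T k       = Sound.⊩-sound I I⊨T p tt k
sound (just r) p I I⊨T (i , k) = Sound.⊩-sound I I⊨T p i k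

-- Canonical models over a graph

record Graph : Set₁ where
  field
    Node  : Set
    label : Node → NC → Set
    edge  : NR → Node → Node → Set

  infix 4 _∋_

  _∋_ : Node → Concept → Set
  x ∋ atom B   = label x B
  x ∋ ⊤        = Unit
  x ∋ C ⊓ D    = x ∋ C × x ∋ D
  x ∋ ∃⟨ r ⟩ C = ∃[ y ] edge r x y × y ∋ C

module _ (T : TBox) (G : Graph) (U : Concept → Set) where
  open Graph G

  Element : Set
  Element = Maybe NR × (Concept ⊎ Node)

  data Edge (Holds : Element → Concept → Set) : NR → Element → Concept ⊎ Node → Set where
    known   : ∀ {r m x y} → edge r x y → Edge Holds r (m , inj₂ x) (inj₂ y)
    witness : ∀ {r e K} → U (∃⟨ r ⟩ K) → Holds e (∃⟨ r ⟩ K) → Edge Holds r e (inj₁ K)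

  -- The closure conditions under which an abstract truth relation yields a model. They are used
  -- with `Holds` as derivability, as failure to entail the name of a node, and as membership in the
  -- computed facts; in the last case `U` is the finite set of relevant concepts.
  record Saturated (Holds : Element → Concept → Set) : Set where
    field
      U-fst   : ∀ {C D} → U (C ⊓ D) → U C
      U-snd   : ∀ {C D} → U (C ⊓ D) → U D
      U-under : ∀ {r C} → U (∃⟨ r ⟩ C) → U C
      U-⊑     : ∀ {C D} → (C ⊑ D) ∈ T → U C × U D
      U-≡     : ∀ {C D} → (C ≡ᶜ D) ∈ T → U C × U D
      U-ran   : ∀ {s D} → (ran⟨ s ⟩⊑ D) ∈ T → U D
      h-init  : ∀ {m K} → U K → Holds (m , inj₁ K) K
      h-label : ∀ {m x B} → label x B → Holds (m , inj₂ x) (atom B)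
      h-top   : ∀ {e} → U ⊤ → Holds e ⊤
      h-pair  : ∀ {e C D} → U (C ⊓ D) → Holds e C → Holds e D → Holds e (C ⊓ D)
      h-fst   : ∀ {e C D} → U (C ⊓ D) → Holds e (C ⊓ D) → Holds e C
      h-snd   : ∀ {e C D} → U (C ⊓ D) → Holds e (C ⊓ D) → Holds e D
      h-ex    : ∀ {e r s q L} → U (∃⟨ s ⟩ L) → Edge Holds r e q → T ⊢ r ⊑* s →
                Holds (just r , q) L → Holds e (∃⟨ s ⟩ L)
      h-⊑     : ∀ {e C D} → (C ⊑ D) ∈ T → Holds e C → Holds e D
      h-≡ˡ    : ∀ {e C D} → (C ≡ᶜ D) ∈ T → Holds e C → Holds e D
      h-≡ʳ    : ∀ {e C D} → (C ≡ᶜ D) ∈ T → Holds e D → Holds e C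
      h-ran   : ∀ {r s q D} → (ran⟨ s ⟩⊑ D) ∈ T → T ⊢ r ⊑* s → Holds (just r , q) D

NoRanges⊓ : TBox → Set
NoRanges⊓ T = ∀ {r C D} → (ran⟨ r ⟩⊓ C ⊑ D) ∉ T

module Canonical {T G U Holds} (sat : Saturated T G U Holds) (noRan⊓ : NoRanges⊓ T) where
  open Graph G
  open Saturated sat

  -- The extra point nothing, which satisfies every concept, provides the incoming
  -- edges of the elements (just r , q).
  model : Interpretation
  model = record
    { Δ       = Maybe (Element T G U)
    ; element = nothing
    ; conc    = conc
    ; role    = roleᴹ
    }
    where
    conc : NC → Maybe (Element T G U) → Set
    conc A nothing  = Unit
    conc A (just e) = Holds e (atom A)
    roleᴹ : NR → Maybe (Element T G U) → Maybe (Element T G U) → Set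
    roleᴹ s nothing  nothing         = Unit
    roleᴹ s nothing  (just (m , q))  = ∃[ r ] m ≡ just r × T ⊢ r ⊑* s
    roleᴹ s (just e) nothing         = ⊥
    roleᴹ s (just e) (just (m , q))  = ∃[ r ] m ≡ just r × T ⊢ r ⊑* s × Edge T G U Holds r e q

  open Interpretation model

  point : ∀ C → ⟦ C ⟧ nothing
  point (atom A)   = tt
  point ⊤          = tt
  point (C ⊓ D)    = point C , point D
  point (∃⟨ r ⟩ C) = nothing , point C , tt

  -- The truth lemma, limited to `U` because only there are existentials given witnesses. No edge
  -- leads from an element to the extra point, which therefore makes no existential true at an
  -- element.
  ⟦⟧⇒Holds : ∀ L {e} → U L → ⟦ L ⟧ (just e) → Holds e L
  Holds⇒⟦⟧ : ∀ L {e} → U L → Holds e L → ⟦ L ⟧ (just e)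

  ⟦⟧⇒Holds (atom A)   u h         = h
  ⟦⟧⇒Holds ⊤          u h         = h-top u
  ⟦⟧⇒Holds (C ⊓ D)    u (hC , hD) = h-pair u (⟦⟧⇒Holds C (U-fst u) hC) (⟦⟧⇒Holds D (U-snd u) hD)
  ⟦⟧⇒Holds (∃⟨ s ⟩ L) u (just (_ , q) , h , r , refl , r⊑s , ed) =
    h-ex u ed r⊑s (⟦⟧⇒Holds L (U-under u) h)

  Holds⇒⟦⟧ (atom A)   u h = h
  Holds⇒⟦⟧ ⊤          u h = tt
  Holds⇒⟦⟧ (C ⊓ D)    u h = Holds⇒⟦⟧ C (U-fst u) (h-fst u h) , Holds⇒⟦⟧ D (U-snd u) (h-snd u h)
  Holds⇒⟦⟧ (∃⟨ s ⟩ L) u h =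
    just (just s , inj₁ L) , Holds⇒⟦⟧ L (U-under u) (h-init (U-under u)) ,
    s , refl , done , witness u h

  model⊨T : All (model satisfies_) T
  model⊨T = All.tabulate (λ {α} → satisfied α)
    where
    satisfied : ∀ α → α ∈ T → model satisfies α
    satisfied (C ⊑ D) ax {nothing} h = point D
    satisfied (C ⊑ D) ax {just e}  h = let uC , uD = U-⊑ ax in
      Holds⇒⟦⟧ D uD (h-⊑ ax (⟦⟧⇒Holds C uC h))
    satisfied (ran⟨ s ⟩⊑ D) ax {nothing} h = point D
    satisfied (ran⟨ s ⟩⊑ D) ax {just (m , q)} (nothing , r , refl , r⊑s) =
      Holds⇒⟦⟧ D (U-ran ax) (h-ran ax r⊑s)
    satisfied (ran⟨ s ⟩⊑ D) ax {just (m , q)} (just _ , r , refl , r⊑s , _) =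
      Holds⇒⟦⟧ D (U-ran ax) (h-ran ax r⊑s)
    satisfied (ran⟨ s ⟩⊓ C ⊑ D) ax = contradiction ax noRan⊓
    satisfied (C ≡ᶜ D) ax = (λ {d} → to {d}) , (λ {d} → from {d})
      where
      to : ∀ {d} → ⟦ C ⟧ d → ⟦ D ⟧ d
      to {nothing} h = point D
      to {just e}  h = let uC , uD = U-≡ ax in Holds⇒⟦⟧ D uD (h-≡ˡ ax (⟦⟧⇒Holds C uC h))
      from : ∀ {d} → ⟦ D ⟧ d → ⟦ C ⟧ d
      from {nothing} h = point C
      from {just e}  h = let uC , uD = U-≡ ax in Holds⇒⟦⟧ C uC (h-≡ʳ ax (⟦⟧⇒Holds D uD h))
    satisfied (r ⊑ʳ s) ax {nothing} {nothing}      h                      = tt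
    satisfied (r ⊑ʳ s) ax {nothing} {just (m , q)} (t , eq , t⊑r)         = t , eq , step t⊑r ax
    satisfied (r ⊑ʳ s) ax {just e}  {just (m , q)} (t , eq , t⊑r , ed)    = t , eq , step t⊑r ax , ed

  consequence : ∀ {m q C L} → T ⊨ query m C L → U L → ⟦ C ⟧ (just (m , q)) → Holds (m , q) L
  consequence {nothing} {L = L} T⊨ u c = ⟦⟧⇒Holds L u (T⊨ model model⊨T c)
  consequence {just r}  {L = L} T⊨ u c =
    ⟦⟧⇒Holds L u (T⊨ model model⊨T ((nothing , r , refl , done) , c))

  consequence-self : ∀ {m K L} → T ⊨ query m K L → U K → U L → Holds (m , inj₁ K) L
  consequence-self {K = K} T⊨ uK uL = consequence T⊨ uL (Holds⇒⟦⟧ K uK (h-init uK))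

  -- The concept may lie outside `U`, so its truth in the model is read off the graph and not
  -- obtained from `Holds`.
  embed : ∀ {x m} C → x ∋ C → ⟦ C ⟧ (just (m , inj₂ x))
  embed (atom B)   h              = h-label h
  embed ⊤          h              = tt
  embed (C ⊓ D)    (hC , hD)      = embed C hC , embed D hD
  embed (∃⟨ r ⟩ C) (y , xy , h)   = just (just r , inj₂ y) , embed C h , r , refl , done , known xy

emptyGraph : Graph
emptyGraph = record { Node = ⊥ ; label = λ () ; edge = λ _ () }

-- Over the graph without nodes and with all concepts in the universe, `Holds` can be derivability
-- itself, and the closure conditions become the rules of the calculus.
complete : ∀ {T} → NoRanges⊓ T → ∀ m {K L} → T ⊨ query m K L → T ⊢ m , K ⊩ L
complete {T} noRan⊓ m T⊨ = Canonical.consequence-self sat noRan⊓ T⊨ tt tt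
  where
  Holds : Element T emptyGraph (λ _ → Unit) → Concept → Set
  Holds (m , inj₁ K) L = T ⊢ m , K ⊩ L
  sat : Saturated T emptyGraph (λ _ → Unit) Holds
  sat = record
    { U-fst = _ ; U-snd = _ ; U-under = _ ; U-⊑ = _ ; U-≡ = _ ; U-ran = _
    ; h-init  = λ _ → init
    ; h-label = λ { {x = ()} }
    ; h-top   = λ { {_ , inj₁ _} _ → top }
    ; h-pair  = λ { {_ , inj₁ _} _ p q → pair p q }
    ; h-fst   = λ { {_ , inj₁ _} _ → fst }
    ; h-snd   = λ { {_ , inj₁ _} _ → snd }
    ; h-ex    = λ { {_ , inj₁ _} _ (witness _ p) r⊑s q → ex p r⊑s q }
    ; h-⊑     = λ { {_ , inj₁ _} → sub }
    ; h-≡ˡ    = λ { {_ , inj₁ _} → unfold }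
    ; h-≡ʳ    = λ { {_ , inj₁ _} → fold }
    ; h-ran   = λ { {q = inj₁ _} → rng }
    }

-- Inversion of derivations in a terminology

module Inversion {T : TBox} (term : IsTerminology T) where
  open IsTerminology term

  noRan⊓ : NoRanges⊓ T
  noRan⊓ ax with form ax
  ... | incl () _

  infix 4 _▹_ _▹ʳ_

  -- L ▹ A: the name A, if non-conjunctive, is reached from L along inclusions from
  -- basic concepts, except for a last use of the definition of A.
  data _▹_ : Concept → NC → Set where
    hit  : ∀ {A} → atom A ▹ A
    sub  : ∀ {A B D} → (atom B ⊑ D) ∈ T → D ▹ A → atom B ▹ A
    eqn  : ∀ {A B D} → (atom B ≡ᶜ D) ∈ T → D ▹ A → atom B ▹ A
    fst  : ∀ {A C D} → C ▹ A → C ⊓ D ▹ A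
    snd  : ∀ {A C D} → D ▹ A → C ⊓ D ▹ A
    dom  : ∀ {A D L s t} → (∃⟨ t ⟩ ⊤ ⊑ D) ∈ T → T ⊢ s ⊑* t → D ▹ A → ∃⟨ s ⟩ L ▹ A
    def  : ∀ {A B L s t} → (atom A ≡ᶜ ∃⟨ t ⟩ B) ∈ T → T ⊢ s ⊑* t → T ⊢ just s , L ⊩ B → ∃⟨ s ⟩ L ▹ A

  data _▹ʳ_ : Maybe NR → NC → Set where
    rng : ∀ {A D r s} → (ran⟨ s ⟩⊑ D) ∈ T → T ⊢ r ⊑* s → D ▹ A → just r ▹ʳ A

  ▹-sound : ∀ {e L A} → T ⊢ e ⊩ L → L ▹ A → T ⊢ e ⊩ atom A
  ▹-sound p hit                = p
  ▹-sound p (sub ax d)         = ▹-sound (sub ax p) d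
  ▹-sound p (eqn ax d)         = ▹-sound (unfold ax p) d
  ▹-sound p (fst d)            = ▹-sound (fst p) d
  ▹-sound p (snd d)            = ▹-sound (snd p) d
  ▹-sound p (dom ax s⊑t d)     = ▹-sound (sub ax (ex p s⊑t top)) d
  ▹-sound p (def ax s⊑t q)     = fold ax (ex p s⊑t q)

  ▹ʳ-sound : ∀ {m K A} → m ▹ʳ A → T ⊢ m , K ⊩ atom A
  ▹ʳ-sound (rng ax r⊑s d) = ▹-sound (rng ax r⊑s) d

  -- Induction on the derivation, with the path `L ▹ A` as accumulator: the last rule is moved onto
  -- the path until `init` or `rng` is reached. A `fold` cancels against a following `eqn` because
  -- left-hand sides are unique. A `fold` yielding `A` itself contradicts pseudo-primitivity or
  -- becomes a `def` step. Since a path out of a conjunction enters a single conjunct, this gives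
  -- primeness.
  invert : ∀ {m K L A} → NonConjunctive T A → T ⊢ m , K ⊩ L → L ▹ A → m ▹ʳ A ⊎ K ▹ A
  invert nc init          d = inj₂ d
  invert nc (pair p q)    (fst d) = invert nc p d
  invert nc (pair p q)    (snd d) = invert nc q d
  invert nc (fst p)       d = invert nc p (fst d)
  invert nc (snd p)       d = invert nc p (snd d)
  invert nc (ex p r⊑s q)  (dom ax s⊑t d) = invert nc p (dom ax (⊑*-trans r⊑s s⊑t) d)
  invert nc (ex p r⊑s q)  (def ax s⊑t b) = invert nc p (def ax (⊑*-trans r⊑s s⊑t) (cut (below r⊑s) q b))
  invert nc (sub ax p)    d with form ax
  ... | incl name   _ = invert nc p (sub ax d)
  ... | incl domain _ = invert nc p (dom ax done d)
  invert nc (unfold ax p) d with form ax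
  ... | eqn _ = invert nc p (eqn ax d)
  invert nc (fold ax p)   d with form ax
  invert (inj₁ prim) (fold ax p) hit | eqn _ = contradiction ax (prim _)
  invert nc@(inj₂ (r , C , ax′)) (fold ax p) hit | eqn _ with uniqueLHS ax ax′ eqn eqn
  ... | refl = invert nc p (def ax done init)
  invert nc (fold ax p) (sub ax′ d) | eqn _ with uniqueLHS ax ax′ eqn incl
  ... | ()
  invert nc (fold ax p) (eqn ax′ d) | eqn _ with uniqueLHS ax ax′ eqn eqn
  ... | refl = invert nc p d
  invert nc (rng ax r⊑s)  d = inj₁ (rng ax r⊑s d)

  inverted : ∀ {m K A} → NonConjunctive T A → T ⊢ m , K ⊩ atom A → m ▹ʳ A ⊎ K ▹ A
  inverted nc p = invert nc p hit

-- The graph of concepts that avoid a name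

module Avoidance {T : TBox} (norm : IsNormalisedTerminology T) (Sig : List Name) (Ns : List NC)
  (Ns-closed : ∀ {A F B} → (A ≡ᶜ F) ∈ T → atom B ≼ F → B ∈ Ns) where

  open IsNormalisedTerminology norm
  open Inversion isTerminology

  -- A Σ-concept fails to entail the non-conjunctive name A iff it holds at node just A;
  -- every Σ-concept holds at node nothing.
  avoid : Graph
  avoid = record { Node = Maybe NC ; label = label ; edge = edge }
    module Avoid where
    label : Maybe NC → NC → Set
    label nothing  B = inj₁ B ∈ Sig
    label (just A) B = inj₁ B ∈ Sig × ¬ (T ⊢ nothing , atom B ⊩ atom A)

    Defined : NR → NC → Set
    Defined r A = ∃[ t ] ∃[ C ] (atom A ≡ᶜ ∃⟨ t ⟩ C) ∈ T × T ⊢ r ⊑* t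

    -- An edge must not force `A` through the domain of `r`. If no definition of `A` uses a
    -- superrole of `r`, the successor is unconstrained and is the node `nothing`. If `A` is defined
    -- as ∃t.C with `r` below `t`, the successor must fail `C`, hence avoid some non-conjunctive `B`
    -- that `C` entails; this is possible only if the range of `r` does not force `B`.
    edge : NR → Maybe NC → Maybe NC → Set
    edge r nothing  nothing  = inj₂ r ∈ Sig
    edge r nothing  (just _) = ⊥
    edge r (just A) nothing  =
      inj₂ r ∈ Sig × ¬ (T ⊢ nothing , ∃⟨ r ⟩ ⊤ ⊩ atom A) × ¬ Defined r A
    edge r (just A) (just B) =
      inj₂ r ∈ Sig × ¬ (T ⊢ nothing , ∃⟨ r ⟩ ⊤ ⊩ atom A) ×
      B ∈ Ns × NonConjunctive T B × ¬ (T ⊢ just r , ⊤ ⊩ atom B) ×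
      (∃[ t ] ∃[ C ] (atom A ≡ᶜ ∃⟨ t ⟩ C) ∈ T × T ⊢ r ⊑* t × T ⊢ nothing , C ⊩ atom B)

  open Graph avoid using (_∋_)

  ∋-names : ∀ {x} C → x ∋ C → All (_∈ Sig) (conceptNames C)
  ∋-names {nothing} (atom B) h       = h ∷ []
  ∋-names {just A}  (atom B) (h , _) = h ∷ []
  ∋-names ⊤         h                = []
  ∋-names (C ⊓ D)   (hC , hD)        = ++⁺ (∋-names C hC) (∋-names D hD)
  ∋-names {nothing} (∃⟨ r ⟩ C) (nothing , r∈ , h)       = r∈ ∷ ∋-names C h
  ∋-names {just A}  (∃⟨ r ⟩ C) (nothing , (r∈ , _) , h) = r∈ ∷ ∋-names C h
  ∋-names {just A}  (∃⟨ r ⟩ C) (just B , (r∈ , _) , h)  = r∈ ∷ ∋-names C h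

  full : ∀ C → All (_∈ Sig) (conceptNames C) → nothing ∋ C
  full (atom B)   (B∈ ∷ [])  = B∈
  full ⊤          _          = tt
  full (C ⊓ D)    Σ          = full C (++⁻ˡ (conceptNames C) Σ) , full D (++⁻ʳ (conceptNames C) Σ)
  full (∃⟨ r ⟩ C) (r∈ ∷ Σ)   = nothing , r∈ , full C Σ

  -- At a node, truth is a negative statement and thus needs no decision. If the incoming role
  -- already forces `A`, or `A` is conjunctive, the element satisfies everything; this is what makes
  -- the range axioms true there.
  Holds : Element T avoid (λ _ → Unit) → Concept → Set
  Holds (m , inj₁ K)        L = T ⊢ m , K ⊩ L
  Holds (m , inj₂ nothing)  L = Unit
  Holds (m , inj₂ (just A)) L =
    NonConjunctive T A → ¬ (T ⊢ m , ⊤ ⊩ atom A) → ¬ (T ⊢ nothing , L ⊩ atom A)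

  Holds-step : ∀ {e C D} → (∀ {c} → T ⊢ c ⊩ C → T ⊢ c ⊩ D) → Holds e C → Holds e D
  Holds-step {_ , inj₁ K}        f h         = f h
  Holds-step {_ , inj₂ nothing}  f h         = tt
  Holds-step {_ , inj₂ (just A)} f h nc m⊮ d = h nc m⊮ (cut any (f init) d)

  Holds-pair : ∀ {e C D} → Holds e C → Holds e D → Holds e (C ⊓ D)
  Holds-pair {_ , inj₁ K}        p q = pair p q
  Holds-pair {_ , inj₂ nothing}  p q = tt
  Holds-pair {_ , inj₂ (just A)} p q nc m⊮ d with inverted nc d
  ... | inj₂ (fst d′) = p nc m⊮ (▹-sound init d′)
  ... | inj₂ (snd d′) = q nc m⊮ (▹-sound init d′)

  -- If ∃s.L entailed `A`, inversion would leave a domain axiom, which the edge excludes, or the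
  -- definition of `A`. In the latter case `L` below an `s`-edge entails the filler of the
  -- definition, hence the target name; as that name is non-conjunctive, it would follow from a
  -- range or from `L` alone, and both are excluded.
  Holds-ex : ∀ {e r s q L} → Edge T avoid (λ _ → Unit) Holds r e q → T ⊢ r ⊑* s →
             Holds (just r , q) L → Holds e (∃⟨ s ⟩ L)
  Holds-ex {m , inj₁ K}        (witness _ p) r⊑s h = ex p r⊑s h
  Holds-ex {m , inj₂ nothing}  _             r⊑s h = tt
  Holds-ex {m , inj₂ (just A)} (witness _ p) r⊑s h nc m⊮ d = p nc m⊮ (cut any (ex init r⊑s h) d)
  Holds-ex {m , inj₂ (just A)} (known {y = nothing} (_ , dom⊮ , undef)) r⊑s h nc m⊮ d with inverted nc d
  ... | inj₂ (dom ax s⊑t d′) = dom⊮ (▹-sound init (dom ax (⊑*-trans r⊑s s⊑t) d′))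
  ... | inj₂ (def ax s⊑t _)  = undef (_ , _ , ax , ⊑*-trans r⊑s s⊑t)
  Holds-ex {m , inj₂ (just A)} (known {y = just B} (_ , dom⊮ , _ , ncB , r⊮ , t , C , ax , _ , C⊩)) r⊑s h nc m⊮ d
    with inverted nc d
  ... | inj₂ (dom ax′ s⊑t d′) = dom⊮ (▹-sound init (dom ax′ (⊑*-trans r⊑s s⊑t) d′))
  ... | inj₂ (def ax′ s⊑t b) with IsTerminology.uniqueLHS isTerminology ax ax′ eqn eqn
  ...   | refl with inverted ncB (cut any b C⊩)
  ...     | inj₁ (rng ax″ s⊑u d′) = r⊮ (▹ʳ-sound (rng ax″ (⊑*-trans r⊑s s⊑u) d′))
  ...     | inj₂ d′ = h ncB r⊮ (▹-sound init d′)

  saturated : Saturated T avoid (λ _ → Unit) Holds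
  saturated = record
    { U-fst = _ ; U-snd = _ ; U-under = _ ; U-⊑ = _ ; U-≡ = _ ; U-ran = _
    ; h-init  = λ _ → init
    ; h-label = λ { {x = nothing} _ → tt ; {x = just A} (_ , B⊮) _ _ → B⊮ }
    ; h-top   = λ { {_ , inj₁ _} _ → top ; {_ , inj₂ nothing} _ → tt
                  ; {m , inj₂ (just A)} _ nc m⊮ d → m⊮ (cut any top d) }
    ; h-pair  = λ {e} _ → Holds-pair {e}
    ; h-fst   = λ {e} _ → Holds-step {e} fst
    ; h-snd   = λ {e} _ → Holds-step {e} snd
    ; h-ex    = λ {e} _ → Holds-ex {e}
    ; h-⊑     = λ {e} ax → Holds-step {e} (sub ax)
    ; h-≡ˡ    = λ {e} ax → Holds-step {e} (unfold ax)
    ; h-≡ʳ    = λ {e} ax → Holds-step {e} (fold ax)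
    ; h-ran   = λ { {q = inj₁ _} → rng ; {q = inj₂ nothing} _ _ → tt
                  ; {q = inj₂ (just A)} ax r⊑s nc m⊮ d → m⊮ (cut any (rng ax r⊑s) d) }
    }

  avoids : ∀ {m A C} → NonConjunctive T A → ¬ (T ⊢ m , ⊤ ⊩ atom A) → just A ∋ C →
           ¬ (T ⊨ query m C (atom A))
  avoids {m} {A} {C} nc m⊮ h T⊨ = consequence {m} {inj₂ (just A)} {C} T⊨ tt (embed C h) nc m⊮ init
    where open Canonical saturated noRan⊓

  Leaf : NC → NC → Set
  Leaf B A = NonConjunctive T A × A ∈ Ns × T ⊢ nothing , atom B ⊩ atom A

  conjuncts : ∀ {P F} → ConjunctionOf P F →
    ∃[ As ] All (λ A → P A × atom A ≼ F × T ⊢ nothing , F ⊩ atom A) As ×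
            (∀ {e} → All (λ A → T ⊢ e ⊩ atom A) As → T ⊢ e ⊩ F)
  conjuncts (single {A} p) = A ∷ [] , (p , self , init) ∷ [] , λ { (a ∷ []) → a }
  conjuncts (F ⊓ G) with conjuncts F | conjuncts G
  ... | As , As✓ , joinᶠ | Bs , Bs✓ , joinᵍ =
    As ++ Bs ,
    ++⁺ (All.map (λ (p , A≼ , d) → p , left A≼ , cut any (fst init) d) As✓)
        (All.map (λ (p , B≼ , d) → p , right B≼ , cut any (snd init) d) Bs✓) ,
    λ ds → pair (joinᶠ (++⁻ˡ As ds)) (joinᵍ (++⁻ʳ As ds))

  defines? : ∀ B α → Dec (∃[ F ] α ≡ (atom B ≡ᶜ F))
  defines? B (atom A ≡ᶜ F) = map′ (λ { refl → F , refl }) (λ { (_ , refl) → refl }) (A ≟ B)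
  defines? B (⊤ ≡ᶜ F)                = no λ ()
  defines? B ((_ ⊓ _) ≡ᶜ F)          = no λ ()
  defines? B (∃⟨ _ ⟩ _ ≡ᶜ F)         = no λ ()
  defines? B (C ⊑ D)                 = no λ ()
  defines? B (ran⟨ r ⟩⊑ D)           = no λ ()
  defines? B (ran⟨ r ⟩⊓ C ⊑ D)       = no λ ()
  defines? B (r ⊑ʳ s)                = no λ ()

  -- In a normalised terminology the conjuncts of a definition are themselves non-conjunctive, so
  -- one unfolding is enough. A name without a conjunctive definition is its own leaf.
  leaves : ∀ B → B ∈ Ns →
    ∃[ As ] All (Leaf B) As × (∀ {e} → All (λ A → T ⊢ e ⊩ atom A) As → T ⊢ e ⊩ atom B)
  leaves B B∈ with any? (defines? B) T
  ... | no undefined =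
    B ∷ [] , (inj₁ (λ C ax → undefined (lose ax (C , refl))) , B∈ , init) ∷ [] , λ { (b ∷ []) → b }
  ... | yes defined with find defined
  ...   | _ , ax , F , refl with normalForm ax
  ...     | eqn-∃ = B ∷ [] , (inj₂ (_ , _ , ax) , B∈ , init) ∷ [] , λ { (b ∷ []) → b }
  ...     | eqn-⊓ conj with conjuncts conj
  ...       | As , As✓ , join =
    As , All.map (λ (nc , A≼ , d) → nc , Ns-closed ax A≼ , cut any (unfold ax init) d) As✓ ,
    λ ds → fold ax (join ds)

  -- The entailments on which the argument branches are assumed decidable here, only for names in
  -- `Ns` and the signature; the saturation of T₂ will provide the decisions.
  module Dichotomy
    (name?   : ∀ {A B} → A ∈ Ns → inj₁ B ∈ Sig → Dec (T ⊢ nothing , atom B ⊩ atom A))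
    (domain? : ∀ {A r} → A ∈ Ns → inj₂ r ∈ Sig → Dec (T ⊢ nothing , ∃⟨ r ⟩ ⊤ ⊩ atom A))
    (range?  : ∀ {A r} → A ∈ Ns → inj₂ r ∈ Sig → Dec (T ⊢ just r , ⊤ ⊩ atom A))
    (role?   : ∀ {r} A → inj₂ r ∈ Sig → Dec (Avoid.Defined r A))
    where


    split : ∀ {P Q R : NC → Set} {As} → (∀ {A} → P A → Q A ⊎ R A) → All P As →
            (∃[ A ] P A × Q A) ⊎ All R As
    split f []       = inj₂ []
    split f (p ∷ ps) with f p | split f ps
    ... | inj₁ q | _                  = inj₁ (_ , p , q)
    ... | inj₂ r | inj₁ found         = inj₁ found
    ... | inj₂ r | inj₂ rs            = inj₂ (r ∷ rs)

    -- The induction on `C` treats all `A` at once. For an existential below a definition of `A`,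
    -- its filler is tested against all leaves of the defining filler: one that is avoided gives the
    -- target of an edge, and if there is none, the leaves together yield the definition of `A`.
    dichotomy : ∀ C {A} → All (_∈ Sig) (conceptNames C) → A ∈ Ns → NonConjunctive T A →
                just A ∋ C ⊎ T ⊢ nothing , C ⊩ atom A
    dichotomy (atom B) (B∈ ∷ []) A∈ nc with name? A∈ B∈
    ... | yes d = inj₂ d
    ... | no ¬d = inj₁ (B∈ , ¬d)
    dichotomy ⊤ Σ A∈ nc = inj₁ tt
    dichotomy (C ⊓ D) Σ A∈ nc
      with dichotomy C (++⁻ˡ (conceptNames C) Σ) A∈ nc | dichotomy D (++⁻ʳ (conceptNames C) Σ) A∈ nc
    ... | inj₁ hC | inj₁ hD = inj₁ (hC , hD)
    ... | inj₂ d  | _       = inj₂ (cut any (fst init) d)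
    ... | inj₁ _  | inj₂ d  = inj₂ (cut any (snd init) d)
    dichotomy (∃⟨ r ⟩ C) {A} (r∈ ∷ Σ) A∈ nc with domain? A∈ r∈
    ... | yes d = inj₂ (cut any (ex init done top) d)
    ... | no dom⊮ with role? A r∈
    ...   | no undef = inj₁ (nothing , (r∈ , dom⊮ , undef) , full C Σ)
    ...   | yes (t , D , ax , r⊑t) with normalForm ax
    ...     | eqn-∃ {B = B} with leaves B (Ns-closed ax (under self))
    ...       | As , As✓ , join with split reach As✓
      where
      reach : ∀ {A′} → Leaf B A′ → (¬ (T ⊢ just r , ⊤ ⊩ atom A′) × just A′ ∋ C) ⊎ T ⊢ just r , C ⊩ atom A′
      reach (ncA′ , A′∈ , _) with range? A′∈ r∈
      ... | yes d = inj₂ (cut (below done) top d)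
      ... | no r⊮ with dichotomy C Σ A′∈ ncA′
      ...   | inj₁ h = inj₁ (r⊮ , h)
      ...   | inj₂ d = inj₂ (cut any init d)
    ...         | inj₁ (A′ , (ncA′ , A′∈ , d) , r⊮ , h) =
      inj₁ (just A′ , (r∈ , dom⊮ , A′∈ , ncA′ , r⊮ , t , _ , ax , r⊑t , d) , h)
    ...         | inj₂ ds = inj₂ (fold ax (ex init r⊑t (join ds)))

    avoidable : ∀ m {A C} → All (_∈ Sig) (conceptNames C) → (∀ {r} → m ≡ just r → inj₂ r ∈ Sig) →
      A ∈ Ns → ¬ (T ⊢ m , C ⊩ atom A) →
      ∃[ A′ ] Leaf A A′ × ¬ (T ⊢ m , ⊤ ⊩ atom A′) × just A′ ∋ C
    avoidable m {A} {C} Σ m∈ A∈ C⊮ with leaves A A∈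
    ... | As , As✓ , join with split reach As✓
      where
      range?ᵐ : ∀ {A′} m → (∀ {r} → m ≡ just r → inj₂ r ∈ Sig) → Leaf A A′ → Dec (T ⊢ m , ⊤ ⊩ atom A′)
      range?ᵐ (just r) m∈ (_ , A′∈ , _) = range? A′∈ (m∈ refl)
      -- Nothing has to be decided without an incoming role: no path leads from `⊤` to a name.
      range?ᵐ nothing  m∈ (nc , _)      = no λ d → unreachable (inverted nc d)
        where
        unreachable : ∀ {A′} → ¬ (nothing ▹ʳ A′ ⊎ ⊤ ▹ A′)
        unreachable (inj₁ ())
        unreachable (inj₂ ())
      reach : ∀ {A′} → Leaf A A′ → (¬ (T ⊢ m , ⊤ ⊩ atom A′) × just A′ ∋ C) ⊎ T ⊢ m , C ⊩ atom A′
      reach leaf@(nc , A′∈ , _) with range?ᵐ m m∈ leaf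
      ... | yes d = inj₂ (cut (⊒-refl m) top d)
      ... | no m⊮ with dichotomy C Σ A′∈ nc
      ...   | inj₁ h = inj₁ (m⊮ , h)
      ...   | inj₂ d = inj₂ (cut any init d)
    ...   | inj₁ (A′ , leaf , m⊮ , h) = A′ , leaf , m⊮ , h
    ...   | inj₂ ds = contradiction (join ds) C⊮

-- Comprehensions over lists

module _ {A B : Set} (f : A → List B) where

  ∈-for⁺ : ∀ {as a b} → a ∈ as → b ∈ f a → b ∈ concatMap f as
  ∈-for⁺ a∈ b∈ = ∈-concatMap⁺ f (lose a∈ b∈)

  ∈-for⁻ : ∀ as {b} → b ∈ concatMap f as → ∃[ a ] a ∈ as × b ∈ f a
  ∈-for⁻ as b∈ = find (∈-concatMap⁻ f {as} b∈)

mapᴾ : ∀ {σ α β l f} → PTime σ (list α) l → PTime (α ×ᵗ σ) β f →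
       PTime σ (list β) (λ x → map (λ a → f (a , x)) (l x))
mapᴾ {l = l} {f} L F = ≗-PTime (λ x → eq x (l x)) (concatMapᴾ L (singletonᴾ F))
  where
  eq : ∀ x as → concatMap (λ a → f (a , x) ∷ []) as ≡ map (λ a → f (a , x)) as
  eq x []       = refl
  eq x (a ∷ as) = cong (f (a , x) ∷_) (eq x as)

pairs : ∀ {A B : Set} → List A → List B → List (A × B)
pairs as bs = concatMap (λ a → map (a ,_) bs) as

∈-pairs⁺ : ∀ {A B : Set} {as : List A} {bs : List B} {a b} → a ∈ as → b ∈ bs → (a , b) ∈ pairs as bs
∈-pairs⁺ {bs = bs} a∈ b∈ = ∈-for⁺ (λ a → map (a ,_) bs) a∈ (∈-map⁺ _ b∈)

∈-pairs⁻ : ∀ {A B : Set} (as : List A) (bs : List B) {a b} → (a , b) ∈ pairs as bs → a ∈ as × b ∈ bs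
∈-pairs⁻ as bs p∈ with ∈-for⁻ (λ a → map (a ,_) bs) as p∈
... | a , a∈ , ab∈ with ∈-map⁻ (a ,_) ab∈
...   | b , b∈ , refl = a∈ , b∈

pairsᴾ : ∀ {σ α β k l} → PTime σ (list α) k → PTime σ (list β) l →
         PTime σ (list (α ×ᵗ β)) (λ x → pairs (k x) (l x))
pairsᴾ K L = concatMapᴾ K (mapᴾ (L ∘ᴾ sndᴾ) (pairᴾ (fstᴾ ∘ᴾ sndᴾ) fstᴾ))

-- Environments are nested pairs, the innermost bound variable first; F ↑ skips it.
infix 20 _↑

_↑ : ∀ {σ α τ f} → PTime σ τ f → PTime (α ×ᵗ σ) τ (f ∘ proj₂)
F ↑ = F ∘ᴾ sndᴾ

-- The algorithm

-- In a fact ((m , q) , L), the state q is a concept of which an element is taken, or a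
-- node of the graph avoid below.
tbox roles state fact : Ty
tbox  = list inclusion
roles = list (name ×ᵗ name)
state = concept ⊎ᵗ opt name
fact  = (opt name ×ᵗ state) ×ᵗ concept

module Roles where

  Rule : El ((name ×ᵗ name) ×ᵗ (roles ×ᵗ (tbox ×ᵗ list name))) → Set
  Rule ((r , t) , S , T , Rs) =
    r ≡ t ⊎ (∃[ α ] α ∈ T × ∃[ ax ] ax ∈ asRole α × proj₂ ax ≡ t × (r , proj₁ ax) ∈ S)

  ruleᴰ : Decider ((name ×ᵗ name) ×ᵗ (roles ×ᵗ (tbox ×ᵗ list name))) Rule
  ruleᴰ = ≡ᴰ rᴾ tᴾ ⊎ᴰ
          ∃ᴰ (fstᴾ ∘ᴾ sndᴾ ∘ᴾ sndᴾ) (∃ᴰ (asRoleᴾ ∘ᴾ fstᴾ)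
            (≡ᴰ (sndᴾ ∘ᴾ fstᴾ) (tᴾ ↑ ↑) ×ᴰ ∈ᴰ (pairᴾ (rᴾ ↑ ↑) (fstᴾ ∘ᴾ fstᴾ)) ((fstᴾ ∘ᴾ sndᴾ) ↑ ↑)))
    where
    rᴾ = fstᴾ ∘ᴾ fstᴾ
    tᴾ = sndᴾ ∘ᴾ fstᴾ

  module Fixpoint = Limit {l = λ (T , Rs) → pairs Rs Rs} (pairsᴾ sndᴾ sndᴾ) ruleᴰ

  opaque

    closure : TBox → List NR → List (NR × NR)
    closure T Rs = Fixpoint.At.limit (T , Rs)

    closureᴾ : ∀ {σ f g} → PTime σ tbox f → PTime σ (list name) g → PTime σ roles (λ x → closure (f x) (g x))
    closureᴾ F G = Fixpoint.limitᴾ ∘ᴾ pairᴾ F G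

    closure-sound : ∀ {T Rs r s} → (r , s) ∈ closure T Rs → T ⊢ r ⊑* s
    closure-sound {T} {Rs} = Fixpoint.At.limit-least (T , Rs) (λ (r , s) → T ⊢ r ⊑* s) rule
      where
      rule : ∀ {rt S} → (∀ {rs} → rs ∈ S → T ⊢ proj₁ rs ⊑* proj₂ rs) → Rule (rt , S , T , Rs) →
             T ⊢ proj₁ rt ⊑* proj₂ rt
      rule {_ , _} hyp (inj₁ refl) = done
      rule {_ , _} hyp (inj₂ ((t ⊑ʳ s) , ax , _ , here refl , refl , p)) = step (hyp p) ax

    -- `Rs` contains the right-hand sides of all role inclusions, so a chain starting in `Rs` never
    -- leaves the candidates.
    closure-complete : ∀ {T Rs r s} → (∀ {r s} → (r ⊑ʳ s) ∈ T → s ∈ Rs) →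
                       r ∈ Rs → T ⊢ r ⊑* s → (r , s) ∈ closure T Rs
    closure-complete {T} {Rs} {r} Rs-closed r∈ p = proj₁ (go p)
      where
      go : ∀ {s} → T ⊢ r ⊑* s → (r , s) ∈ closure T Rs × s ∈ Rs
      go done        = Fixpoint.At.limit-closed (T , Rs) (∈-pairs⁺ r∈ r∈) (inj₁ refl) , r∈
      go (step p ax) = Fixpoint.At.limit-closed (T , Rs) (∈-pairs⁺ r∈ (Rs-closed ax))
                         (inj₂ (_ , ax , _ , here refl , refl , proj₁ (go p))) , Rs-closed ax

-- The components: a TBox, its role hierarchy, the relevant concepts and roles,
-- the states, and the labels and edges of a graph.
problem : Ty
problem = tbox ×ᵗ roles ×ᵗ list concept ×ᵗ list name ×ᵗ list state ×ᵗ
          list (state ×ᵗ concept) ×ᵗ list (state ×ᵗ name ×ᵗ state)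

module Saturate where

  -- The rules of the calculus read backwards from the fact `c`, with premises in `S`; `init` is
  -- absorbed into the labels. For an existential, the search first picks a fact about the filler,
  -- whose element supplies the role and the successor.
  Rule : El (fact ×ᵗ list fact ×ᵗ problem) → Set
  Rule (((m , q) , c) , S , T , H , Cs , Rs , Qs , labels , edges) =
      (q , c) ∈ labels
    ⊎ c ≡ ⊤
    ⊎ (∃[ CD ] CD ∈ asAnd c × ((m , q) , proj₁ CD) ∈ S × ((m , q) , proj₂ CD) ∈ S)
    ⊎ (∃[ f ] f ∈ S × proj₁ f ≡ (m , q) ×
        ∃[ CD ] CD ∈ asAnd (proj₂ f) × (proj₁ CD ≡ c ⊎ proj₂ CD ≡ c))
    ⊎ (∃[ sL ] sL ∈ asEx c × ∃[ f ] f ∈ S × proj₂ f ≡ proj₂ sL ×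
        ∃[ r ] r ∈ asJust (proj₁ (proj₁ f)) × (r , proj₁ sL) ∈ H ×
          ((q , r , proj₂ (proj₁ f)) ∈ edges ⊎
           (∃[ K ] K ∈ asInj₁ (proj₂ (proj₁ f)) × ((m , q) , ∃⟨ r ⟩ K) ∈ S)))
    ⊎ (∃[ α ] α ∈ T ×
        ( (∃[ CD ] CD ∈ asSub α × proj₂ CD ≡ c × ((m , q) , proj₁ CD) ∈ S)
        ⊎ (∃[ CD ] CD ∈ asEqn α × ( (proj₂ CD ≡ c × ((m , q) , proj₁ CD) ∈ S)
                                  ⊎ (proj₁ CD ≡ c × ((m , q) , proj₂ CD) ∈ S)))
        ⊎ (∃[ sD ] sD ∈ asRan α × proj₂ sD ≡ c × ∃[ r ] r ∈ asJust m × (r , proj₁ sD) ∈ H)))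

  ruleᴰ : Decider (fact ×ᵗ list fact ×ᵗ problem) Rule
  ruleᴰ =
       ∈ᴰ (pairᴾ qᴾ cᴾ) labelsᴾ
    ⊎ᴰ ≡ᴰ cᴾ ⊤ᴾ
    ⊎ᴰ ∃ᴰ (asAndᴾ ∘ᴾ cᴾ)
         (∈ᴰ (pairᴾ (eᴾ ↑) (fstᴾ ∘ᴾ fstᴾ)) (Sᴾ ↑) ×ᴰ ∈ᴰ (pairᴾ (eᴾ ↑) (sndᴾ ∘ᴾ fstᴾ)) (Sᴾ ↑))
    ⊎ᴰ ∃ᴰ Sᴾ
         (≡ᴰ (fstᴾ ∘ᴾ fstᴾ) (eᴾ ↑) ×ᴰ ∃ᴰ (asAndᴾ ∘ᴾ sndᴾ ∘ᴾ fstᴾ)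
           (≡ᴰ (fstᴾ ∘ᴾ fstᴾ) (cᴾ ↑ ↑) ⊎ᴰ ≡ᴰ (sndᴾ ∘ᴾ fstᴾ) (cᴾ ↑ ↑)))
    ⊎ᴰ ∃ᴰ (asExᴾ ∘ᴾ cᴾ) (∃ᴰ (Sᴾ ↑)
         (≡ᴰ (sndᴾ ∘ᴾ fstᴾ) (sndᴾ ∘ᴾ fstᴾ ∘ᴾ sndᴾ) ×ᴰ
          ∃ᴰ (asJustᴾ ∘ᴾ fstᴾ ∘ᴾ fstᴾ ∘ᴾ fstᴾ)
            (∈ᴰ (pairᴾ fstᴾ ((fstᴾ ∘ᴾ fstᴾ) ↑ ↑)) (Hᴾ ↑ ↑ ↑) ×ᴰ
              ( ∈ᴰ (pairᴾ (qᴾ ↑ ↑ ↑) (pairᴾ fstᴾ ((sndᴾ ∘ᴾ fstᴾ ∘ᴾ fstᴾ) ↑))) (edgesᴾ ↑ ↑ ↑)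
              ⊎ᴰ ∃ᴰ (asInj₁ᴾ ∘ᴾ (sndᴾ ∘ᴾ fstᴾ ∘ᴾ fstᴾ) ↑)
                   (∈ᴰ (pairᴾ (eᴾ ↑ ↑ ↑ ↑) (exᴾ ∘ᴾ pairᴾ (fstᴾ ↑) fstᴾ)) (Sᴾ ↑ ↑ ↑ ↑))))))
    ⊎ᴰ ∃ᴰ Tᴾ
         (  ∃ᴰ (asSubᴾ ∘ᴾ fstᴾ)
              (≡ᴰ (sndᴾ ∘ᴾ fstᴾ) (cᴾ ↑ ↑) ×ᴰ ∈ᴰ (pairᴾ (eᴾ ↑ ↑) (fstᴾ ∘ᴾ fstᴾ)) (Sᴾ ↑ ↑))
         ⊎ᴰ ∃ᴰ (asEqnᴾ ∘ᴾ fstᴾ)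
              ( (≡ᴰ (sndᴾ ∘ᴾ fstᴾ) (cᴾ ↑ ↑) ×ᴰ ∈ᴰ (pairᴾ (eᴾ ↑ ↑) (fstᴾ ∘ᴾ fstᴾ)) (Sᴾ ↑ ↑))
              ⊎ᴰ (≡ᴰ (fstᴾ ∘ᴾ fstᴾ) (cᴾ ↑ ↑) ×ᴰ ∈ᴰ (pairᴾ (eᴾ ↑ ↑) (sndᴾ ∘ᴾ fstᴾ)) (Sᴾ ↑ ↑)))
         ⊎ᴰ ∃ᴰ (asRanᴾ ∘ᴾ fstᴾ)
              (≡ᴰ (sndᴾ ∘ᴾ fstᴾ) (cᴾ ↑ ↑) ×ᴰ
               ∃ᴰ (asJustᴾ ∘ᴾ (fstᴾ ∘ᴾ eᴾ) ↑ ↑) (∈ᴰ (pairᴾ fstᴾ ((fstᴾ ∘ᴾ fstᴾ) ↑)) (Hᴾ ↑ ↑ ↑))))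
    where
    eᴾ      = fstᴾ ∘ᴾ fstᴾ
    qᴾ      = sndᴾ ∘ᴾ eᴾ
    cᴾ      = sndᴾ ∘ᴾ fstᴾ
    Sᴾ      = fstᴾ ↑
    Tᴾ      = fstᴾ ↑ ↑
    Hᴾ      = fstᴾ ↑ ↑ ↑
    labelsᴾ = fstᴾ ↑ ↑ ↑ ↑ ↑ ↑ ↑
    edgesᴾ  = sndᴾ ↑ ↑ ↑ ↑ ↑ ↑ ↑

  contexts : List NR → List (Maybe NR)
  contexts Rs = nothing ∷ map just Rs

  contextsᴾ : ∀ {σ f} → PTime σ (list name) f → PTime σ (list (opt name)) (λ x → contexts (f x))
  contextsᴾ F = consᴾ nothingᴾ (mapᴾ F (justᴾ ∘ᴾ fstᴾ))

  candidates : El problem → List (El fact)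
  candidates (T , H , Cs , Rs , Qs , _) = pairs (pairs (contexts Rs) Qs) Cs

  candidatesᴾ : PTime problem (list fact) candidates
  candidatesᴾ = pairsᴾ (pairsᴾ (contextsᴾ (fstᴾ ↑ ↑ ↑)) (fstᴾ ↑ ↑ ↑ ↑)) (fstᴾ ↑ ↑)

  module Fixpoint = Limit {l = candidates} candidatesᴾ ruleᴰ

  opaque

    saturate : El problem → List (El fact)
    saturate x = Fixpoint.At.limit x

    saturateᴾ : PTime problem (list fact) saturate
    saturateᴾ = Fixpoint.limitᴾ

    saturate-closed : ∀ x {f} → f ∈ candidates x → Rule (f , saturate x , x) → f ∈ saturate x
    saturate-closed x = Fixpoint.At.limit-closed x

    saturate-least : ∀ x (Q : El fact → Set) →
      (∀ f S → (∀ {g} → g ∈ S → Q g) → Rule (f , S , x) → Q f) → ∀ {f} → f ∈ saturate x → Q f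
    saturate-least x Q rule = Fixpoint.At.limit-least x Q (λ {f} {S} → rule f S)

-- Correctness of the saturation

module SaturateCorrect
  {T : TBox} {H : List (NR × NR)} {Cs : List Concept} {Rs : List NR} {Qs : List (Concept ⊎ Maybe NC)}
  {labels : List ((Concept ⊎ Maybe NC) × Concept)}
  {edges : List ((Concept ⊎ Maybe NC) × NR × (Concept ⊎ Maybe NC))}
  (label : Maybe NC → NC → Set) (edge : NR → Maybe NC → Maybe NC → Set) where

  open Saturate

  graph : Graph
  graph = record { Node = Maybe NC ; label = label ; edge = edge }

  open Graph graph using (_∋_)

  problemᵛ : El problem
  problemᵛ = T , H , Cs , Rs , Qs , labels , edges

  facts : List (El fact)
  facts = saturate problemᵛ

  -- At a node, one concept must account for the fact. Such witnesses can be combined: by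
  -- conjunction when a rule has two premises at the node, and by prefixing an existential when an
  -- edge is crossed. This is how the graph is unravelled.
  Entailed : El fact → Set
  Entailed ((m , inj₁ K) , L) = T ⊢ m , K ⊩ L
  Entailed ((m , inj₂ x) , L) = ∃[ C ] x ∋ C × T ⊢ m , C ⊩ L

  module _
    (H-sound   : ∀ {r s} → (r , s) ∈ H → T ⊢ r ⊑* s)
    (labels⁻₁  : ∀ {K L} → (inj₁ K , L) ∈ labels → K ≡ L)
    (labels⁻₂  : ∀ {x L} → (inj₂ x , L) ∈ labels → ∃[ B ] L ≡ atom B × label x B)
    (edges⁻    : ∀ {q r q′} → (q , r , q′) ∈ edges →
                 ∃[ x ] ∃[ y ] q ≡ inj₂ x × q′ ≡ inj₂ y × edge r x y)
    where

    entailed-step : ∀ e {C D} → (∀ {c} → T ⊢ c ⊩ C → T ⊢ c ⊩ D) → Entailed (e , C) → Entailed (e , D)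
    entailed-step (m , inj₁ K) f d           = f d
    entailed-step (m , inj₂ x) f (C , xC , d) = C , xC , f d

    entailed-pair : ∀ e {C D} → Entailed (e , C) → Entailed (e , D) → Entailed (e , C ⊓ D)
    entailed-pair (m , inj₁ K) d d′ = pair d d′
    entailed-pair (m , inj₂ x) (C , xC , d) (D , xD , d′) =
      C ⊓ D , (xC , xD) , pair (cut (⊒-refl m) (fst init) d) (cut (⊒-refl m) (snd init) d′)

    entailed-top : ∀ e → Entailed (e , ⊤)
    entailed-top (m , inj₁ K) = top
    entailed-top (m , inj₂ x) = ⊤ , tt , top

    entailed-label : ∀ m q {L} → (q , L) ∈ labels → Entailed ((m , q) , L)
    entailed-label m (inj₁ K) l∈ with labels⁻₁ l∈
    ... | refl = init
    entailed-label m (inj₂ x) l∈ with labels⁻₂ l∈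
    ... | B , refl , l = atom B , l , init

    entailed-edge : ∀ m {x y r s L} → edge r x y → T ⊢ r ⊑* s →
                    Entailed ((just r , inj₂ y) , L) → Entailed ((m , inj₂ x) , ∃⟨ s ⟩ L)
    entailed-edge m {r = r} xy r⊑s (C , yC , d) = ∃⟨ r ⟩ C , (_ , xy , yC) , ex init r⊑s d

    entailed-range : ∀ r q {s D} → (ran⟨ s ⟩⊑ D) ∈ T → T ⊢ r ⊑* s → Entailed ((just r , q) , D)
    entailed-range r (inj₁ K) ax r⊑s = rng ax r⊑s
    entailed-range r (inj₂ x) ax r⊑s = ⊤ , tt , rng ax r⊑s

    facts-entailed : ∀ {f} → f ∈ facts → Entailed f
    facts-entailed = saturate-least problemᵛ Entailed rule
      where
      rule : ∀ f S → (∀ {g} → g ∈ S → Entailed g) →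
             Rule (f , S , T , H , Cs , Rs , Qs , labels , edges) → Entailed f
      rule ((m , q) , c) S hyp (inj₁ l∈) = entailed-label m q l∈
      rule (e , ⊤) S hyp (inj₂ (inj₁ refl)) = entailed-top e
      rule (e , C ⊓ D) S hyp (inj₂ (inj₂ (inj₁ (_ , here refl , c , d)))) = entailed-pair e (hyp c) (hyp d)
      rule (e , c) S hyp (inj₂ (inj₂ (inj₂ (inj₁ ((_ , C ⊓ D) , f∈ , refl , _ , here refl , inj₁ refl))))) =
        entailed-step e fst (hyp f∈)
      rule (e , c) S hyp (inj₂ (inj₂ (inj₂ (inj₁ ((_ , C ⊓ D) , f∈ , refl , _ , here refl , inj₂ refl))))) =
        entailed-step e snd (hyp f∈)
      rule ((m , q) , ∃⟨ s ⟩ L) S hyp (inj₂ (inj₂ (inj₂ (inj₂ (inj₁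
        (_ , here refl , ((just r , q′) , _) , f∈ , refl , _ , here refl , rs∈ , inj₁ e∈)))))) with edges⁻ e∈
      ... | x , y , refl , refl , xy = entailed-edge m xy (H-sound rs∈) (hyp f∈)
      rule (e , ∃⟨ s ⟩ L) S hyp (inj₂ (inj₂ (inj₂ (inj₂ (inj₁
        (_ , here refl , ((just r , inj₁ K) , _) , f∈ , refl , _ , here refl , rs∈ , inj₂ (_ , here refl , w∈))))))) =
        entailed-step e (λ d → ex d (H-sound rs∈) (hyp f∈)) (hyp w∈)
      rule (e , c) S hyp (inj₂ (inj₂ (inj₂ (inj₂ (inj₂
        ((C ⊑ D) , ax , inj₁ (_ , here refl , refl , p))))))) = entailed-step e (sub ax) (hyp p)
      rule (e , c) S hyp (inj₂ (inj₂ (inj₂ (inj₂ (inj₂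
        ((C ≡ᶜ D) , ax , inj₂ (inj₁ (_ , here refl , inj₁ (refl , p))))))))) = entailed-step e (unfold ax) (hyp p)
      rule (e , c) S hyp (inj₂ (inj₂ (inj₂ (inj₂ (inj₂
        ((C ≡ᶜ D) , ax , inj₂ (inj₁ (_ , here refl , inj₂ (refl , p))))))))) = entailed-step e (fold ax) (hyp p)
      rule ((just r , q) , c) S hyp (inj₂ (inj₂ (inj₂ (inj₂ (inj₂
        ((ran⟨ s ⟩⊑ D) , ax , inj₂ (inj₂ (_ , here refl , refl , _ , here refl , rs∈)))))))) =
        entailed-range r q ax (H-sound rs∈)

  module _
    (Cs-⊤      : ⊤ ∈ Cs)
    (Cs-≼      : ∀ {C D} → C ≼ D → D ∈ Cs → C ∈ Cs)
    (Cs-⊑      : ∀ {C D} → (C ⊑ D) ∈ T → C ∈ Cs × D ∈ Cs)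
    (Cs-≡      : ∀ {C D} → (C ≡ᶜ D) ∈ T → C ∈ Cs × D ∈ Cs)
    (Cs-ran    : ∀ {s D} → (ran⟨ s ⟩⊑ D) ∈ T → D ∈ Cs)
    (Cs-label  : ∀ {x B} → label x B → atom B ∈ Cs)
    (Rs-ex     : ∀ {r C} → ∃⟨ r ⟩ C ∈ Cs → r ∈ Rs)
    (H-complete : ∀ {r s} → r ∈ Rs → T ⊢ r ⊑* s → (r , s) ∈ H)
    (Qs-Cs     : ∀ {K} → K ∈ Cs → inj₁ K ∈ Qs)
    (labels⁺₁  : ∀ {K} → K ∈ Cs → (inj₁ K , K) ∈ labels)
    (labels⁺₂  : ∀ {x B} → inj₂ x ∈ Qs → label x B → (inj₂ x , atom B) ∈ labels)
    (edges⁺    : ∀ {r x y} → inj₂ x ∈ Qs → edge r x y →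
                 (inj₂ x , r , inj₂ y) ∈ edges × r ∈ Rs × inj₂ y ∈ Qs)
    (noRan⊓    : NoRanges⊓ T)
    where

    -- Elements outside the finite universe of the computation satisfy everything.
    Holds : Element T graph (_∈ Cs) → Concept → Set
    Holds (m , q) L = m ∈ contexts Rs → q ∈ Qs → ((m , q) , L) ∈ facts

    fact⁺ : ∀ {m q L} → m ∈ contexts Rs → q ∈ Qs → L ∈ Cs →
            Rule (((m , q) , L) , facts , T , H , Cs , Rs , Qs , labels , edges) → ((m , q) , L) ∈ facts
    fact⁺ m∈ q∈ L∈ = saturate-closed problemᵛ (∈-pairs⁺ (∈-pairs⁺ m∈ q∈) L∈)

    role⁺ : ∀ {r} → r ∈ Rs → just r ∈ contexts Rs
    role⁺ r∈ = there (∈-map⁺ just r∈)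

    role⁻ : ∀ {r} → just r ∈ contexts Rs → r ∈ Rs
    role⁻ (there m∈) with ∈-map⁻ just m∈
    ... | _ , r∈ , refl = r∈

    holds-ex : ∀ {e r s q L} → ∃⟨ s ⟩ L ∈ Cs → Edge T graph (_∈ Cs) Holds r e q → T ⊢ r ⊑* s →
               Holds (just r , q) L → Holds e (∃⟨ s ⟩ L)
    holds-ex u (known xy) r⊑s h m∈ q∈ with edges⁺ q∈ xy
    ... | e∈ , r∈ , y∈ = fact⁺ m∈ q∈ u (inj₂ (inj₂ (inj₂ (inj₂ (inj₁
      (_ , here refl , _ , h (role⁺ r∈) y∈ , refl , _ , here refl , H-complete r∈ r⊑s , inj₁ e∈))))))
    holds-ex {r = r} u (witness w∈ w) r⊑s h m∈ q∈ = fact⁺ m∈ q∈ u (inj₂ (inj₂ (inj₂ (inj₂ (inj₁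
      (_ , here refl , _ , h (role⁺ r∈) (Qs-Cs (Cs-≼ (under self) w∈)) , refl , _ , here refl ,
       H-complete r∈ r⊑s , inj₂ (_ , here refl , w m∈ q∈)))))))
      where
      r∈ : r ∈ Rs
      r∈ = Rs-ex w∈

    saturated : Saturated T graph (_∈ Cs) Holds
    saturated = record
      { U-fst   = Cs-≼ (left self)
      ; U-snd   = Cs-≼ (right self)
      ; U-under = Cs-≼ (under self)
      ; U-⊑     = Cs-⊑
      ; U-≡     = Cs-≡
      ; U-ran   = Cs-ran
      ; h-init  = λ u m∈ q∈ → fact⁺ m∈ q∈ u (inj₁ (labels⁺₁ u))
      ; h-label = λ l m∈ q∈ → fact⁺ m∈ q∈ (Cs-label l) (inj₁ (labels⁺₂ q∈ l))
      ; h-top   = λ u m∈ q∈ → fact⁺ m∈ q∈ u (inj₂ (inj₁ refl))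
      ; h-pair  = λ u p q m∈ q∈ → fact⁺ m∈ q∈ u (inj₂ (inj₂ (inj₁ (_ , here refl , p m∈ q∈ , q m∈ q∈))))
      ; h-fst   = λ u p m∈ q∈ → fact⁺ m∈ q∈ (Cs-≼ (left self) u)
                    (inj₂ (inj₂ (inj₂ (inj₁ (_ , p m∈ q∈ , refl , _ , here refl , inj₁ refl)))))
      ; h-snd   = λ u p m∈ q∈ → fact⁺ m∈ q∈ (Cs-≼ (right self) u)
                    (inj₂ (inj₂ (inj₂ (inj₁ (_ , p m∈ q∈ , refl , _ , here refl , inj₂ refl)))))
      ; h-ex    = holds-ex
      ; h-⊑     = λ ax p m∈ q∈ → fact⁺ m∈ q∈ (proj₂ (Cs-⊑ ax))
                    (inj₂ (inj₂ (inj₂ (inj₂ (inj₂ (_ , ax , inj₁ (_ , here refl , refl , p m∈ q∈)))))))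
      ; h-≡ˡ    = λ ax p m∈ q∈ → fact⁺ m∈ q∈ (proj₂ (Cs-≡ ax))
                    (inj₂ (inj₂ (inj₂ (inj₂ (inj₂ (_ , ax , inj₂ (inj₁ (_ , here refl , inj₁ (refl , p m∈ q∈)))))))))
      ; h-≡ʳ    = λ ax p m∈ q∈ → fact⁺ m∈ q∈ (proj₁ (Cs-≡ ax))
                    (inj₂ (inj₂ (inj₂ (inj₂ (inj₂ (_ , ax , inj₂ (inj₁ (_ , here refl , inj₂ (refl , p m∈ q∈)))))))))
      ; h-ran   = λ ax r⊑s m∈ q∈ → fact⁺ m∈ q∈ (Cs-ran ax)
                    (inj₂ (inj₂ (inj₂ (inj₂ (inj₂ (_ , ax , inj₂ (inj₂
                      (_ , here refl , refl , _ , here refl , H-complete (role⁻ m∈) r⊑s))))))))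
      }

    open Canonical saturated noRan⊓

    facts-concept : ∀ {m K L} → T ⊨ query m K L → m ∈ contexts Rs → K ∈ Cs → L ∈ Cs →
                    ((m , inj₁ K) , L) ∈ facts
    facts-concept T⊨ m∈ K∈ L∈ = consequence-self T⊨ K∈ L∈ m∈ (Qs-Cs K∈)

    facts-node : ∀ {m x C L} → T ⊨ query m C L → m ∈ contexts Rs → inj₂ x ∈ Qs → L ∈ Cs → x ∋ C →
                 ((m , inj₂ x) , L) ∈ facts
    facts-node {C = C} T⊨ m∈ x∈ L∈ xC = consequence T⊨ L∈ (embed C xC) m∈ x∈

-- The finite universe of an input

input : Ty
input = tbox ×ᵗ tbox ×ᵗ list (name ⊎ᵗ name)

sides : Concept × Concept → List Concept
sides (C , D) = C ∷ D ∷ []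

parts : Inclusion → List Concept
parts α = concatMap sides (asSub α) ++ concatMap sides (asEqn α) ++ map proj₂ (asRan α)

partsᴾ : PTime inclusion (list concept) parts
partsᴾ = ++ᴾ (concatMapᴾ asSubᴾ sidesᴾ) (++ᴾ (concatMapᴾ asEqnᴾ sidesᴾ) (mapᴾ asRanᴾ (sndᴾ ∘ᴾ fstᴾ)))
  where
  sidesᴾ : ∀ {σ} → PTime ((concept ×ᵗ concept) ×ᵗ σ) (list concept) (λ ((C , D) , _) → C ∷ D ∷ [])
  sidesᴾ = consᴾ (fstᴾ ∘ᴾ fstᴾ) (singletonᴾ (sndᴾ ∘ᴾ fstᴾ))

sigConcepts : Name → List Concept
sigConcepts n = map atom (asInj₁ n) ++ map (λ r → ∃⟨ r ⟩ ⊤) (asInj₂ n)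

sigConceptsᴾ : PTime (name ⊎ᵗ name) (list concept) sigConcepts
sigConceptsᴾ = ++ᴾ (mapᴾ asInj₁ᴾ (atomᴾ ∘ᴾ fstᴾ)) (mapᴾ asInj₂ᴾ (exᴾ ∘ᴾ pairᴾ fstᴾ ⊤ᴾ))

-- Besides the sides of axioms, the universe needs `⊤`, the names of the signature and `∃⟨ r ⟩ ⊤`
-- for its roles, since entailments from these are tested when the graph is built and the answer is
-- read off.
roots : El input → List Concept
roots (T₁ , T₂ , Sig) = ⊤ ∷ (concatMap parts (T₁ ++ T₂) ++ concatMap sigConcepts Sig)

rootsᴾ : PTime input (list concept) roots
rootsᴾ = consᴾ ⊤ᴾ (++ᴾ (concatMapᴾ (++ᴾ fstᴾ (fstᴾ ↑)) (partsᴾ ∘ᴾ fstᴾ))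
                       (concatMapᴾ (sndᴾ ↑) (sigConceptsᴾ ∘ᴾ fstᴾ)))

concepts : El input → List Concept
concepts x = concatMap subs (roots x)

conceptsᴾ : PTime input (list concept) concepts
conceptsᴾ = concatMapᴾ rootsᴾ (subsᴾ ∘ᴾ fstᴾ)

-- Every role under an existential of the universe occurs, including those of the signature; the
-- right-hand sides of role inclusions make the list closed under superroles.
roleNames : El input → List NR
roleNames x@(T₁ , T₂ , Sig) =
  concatMap (λ C → map proj₁ (asEx C)) (concepts x) ++
  concatMap (λ α → map proj₂ (asRole α)) (T₁ ++ T₂)

roleNamesᴾ : PTime input (list name) roleNames
roleNamesᴾ = ++ᴾ (concatMapᴾ conceptsᴾ (mapᴾ (asExᴾ ∘ᴾ fstᴾ) (fstᴾ ∘ᴾ fstᴾ)))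
                 (concatMapᴾ (++ᴾ fstᴾ (fstᴾ ↑)) (mapᴾ (asRoleᴾ ∘ᴾ fstᴾ) (sndᴾ ∘ᴾ fstᴾ)))

atoms : List Concept → List NC
atoms = concatMap asAtom

module Universe (x : El input) where

  T₁ T₂ : TBox
  T₁ = proj₁ x
  T₂ = proj₁ (proj₂ x)

  Sig : List Name
  Sig = proj₂ (proj₂ x)

  Cs : List Concept
  Cs = concepts x

  Rs : List NR
  Rs = roleNames x

  root⇒∈ : ∀ {C} → C ∈ roots x → C ∈ Cs
  root⇒∈ C∈ = ∈-for⁺ subs C∈ (subsOnto⁺ self [])

  Cs-⊤ : ⊤ ∈ Cs
  Cs-⊤ = root⇒∈ (here refl)

  Cs-≼ : ∀ {C D} → C ≼ D → D ∈ Cs → C ∈ Cs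
  Cs-≼ C≼D D∈ with ∈-for⁻ subs (roots x) D∈
  ... | R , R∈ , D∈R with subsOnto⁻ R D∈R
  ...   | inj₁ D≼R = ∈-for⁺ subs R∈ (subsOnto⁺ (≼-trans C≼D D≼R) [])
  ...   | inj₂ ()

  Cs-axiom : ∀ {α C} → α ∈ T₁ ++ T₂ → C ∈ parts α → C ∈ Cs
  Cs-axiom ax C∈ = root⇒∈ (there (∈-++⁺ˡ (∈-for⁺ parts ax C∈)))

  Cs-sig : ∀ {n C} → n ∈ Sig → C ∈ sigConcepts n → C ∈ Cs
  Cs-sig n∈ C∈ = root⇒∈ (there (∈-++⁺ʳ (concatMap parts (T₁ ++ T₂)) (∈-for⁺ sigConcepts n∈ C∈)))

  Cs-name : ∀ {A} → inj₁ A ∈ Sig → atom A ∈ Cs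
  Cs-name A∈ = Cs-sig A∈ (here refl)

  Cs-domain : ∀ {r} → inj₂ r ∈ Sig → ∃⟨ r ⟩ ⊤ ∈ Cs
  Cs-domain r∈ = Cs-sig r∈ (here refl)

  Rs-ex : ∀ {r C} → ∃⟨ r ⟩ C ∈ Cs → r ∈ Rs
  Rs-ex C∈ = ∈-++⁺ˡ (∈-for⁺ (λ C → map proj₁ (asEx C)) C∈ (here refl))

  Rs-sig : ∀ {r} → inj₂ r ∈ Sig → r ∈ Rs
  Rs-sig r∈ = Rs-ex (Cs-domain r∈)

  Rs-axiom : ∀ {r s} → (r ⊑ʳ s) ∈ T₁ ++ T₂ → s ∈ Rs
  Rs-axiom ax = ∈-++⁺ʳ (concatMap (λ C → map proj₁ (asEx C)) Cs) (∈-for⁺ (λ α → map proj₂ (asRole α)) ax (here refl))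

  atoms⁺ : ∀ {A} → atom A ∈ Cs → A ∈ atoms Cs
  atoms⁺ A∈ = ∈-for⁺ asAtom A∈ (here refl)

  atoms⁻ : ∀ {A} → A ∈ atoms Cs → atom A ∈ Cs
  atoms⁻ A∈ with ∈-for⁻ asAtom Cs A∈
  ... | atom _ , C∈ , here refl = C∈

  module Axioms {T} (T⊆ : ∀ {α} → α ∈ T → α ∈ T₁ ++ T₂) where

    Cs-⊑ : ∀ {C D} → (C ⊑ D) ∈ T → C ∈ Cs × D ∈ Cs
    Cs-⊑ ax = Cs-axiom (T⊆ ax) (here refl) , Cs-axiom (T⊆ ax) (there (here refl))

    Cs-≡ : ∀ {C D} → (C ≡ᶜ D) ∈ T → C ∈ Cs × D ∈ Cs
    Cs-≡ ax = Cs-axiom (T⊆ ax) (here refl) , Cs-axiom (T⊆ ax) (there (here refl))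

    Cs-ran : ∀ {s D} → (ran⟨ s ⟩⊑ D) ∈ T → D ∈ Cs
    Cs-ran ax = Cs-axiom (T⊆ ax) (here refl)

    Rs-⊑ : ∀ {r s} → (r ⊑ʳ s) ∈ T → s ∈ Rs
    Rs-⊑ ax = Rs-axiom (T⊆ ax)

-- The two saturations and the answer

env₁ env₂ env₃ : Ty
env₁ = (list concept ×ᵗ list name) ×ᵗ input
env₂ = list fact ×ᵗ env₁
env₃ = list fact ×ᵗ env₂

withUniverse : El input → El env₁
withUniverse x = (concepts x , roleNames x) , x

conceptLabels : List Concept → List ((Concept ⊎ Maybe NC) × Concept)
conceptLabels = map (λ K → inj₁ K , K)

problem₂ : El env₁ → El problem
problem₂ ((Cs , Rs) , T₁ , T₂ , Sig) =
  T₂ , closure T₂ Rs , Cs , Rs , map inj₁ Cs , conceptLabels Cs , []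
  where open Roles

conceptLabelsᴾ : ∀ {σ f} → PTime σ (list concept) f →
                 PTime σ (list (state ×ᵗ concept)) (λ x → conceptLabels (f x))
conceptLabelsᴾ F = mapᴾ F (pairᴾ (inj₁ᴾ ∘ᴾ fstᴾ) fstᴾ)

problem₂ᴾ : PTime env₁ problem problem₂
problem₂ᴾ = pairᴾ (fstᴾ ↑ ↑) (pairᴾ (Roles.closureᴾ (fstᴾ ↑ ↑) (sndᴾ ∘ᴾ fstᴾ)) (pairᴾ (fstᴾ ∘ᴾ fstᴾ)
  (pairᴾ (sndᴾ ∘ᴾ fstᴾ) (pairᴾ (mapᴾ (fstᴾ ∘ᴾ fstᴾ) (inj₁ᴾ ∘ᴾ fstᴾ))
  (pairᴾ (conceptLabelsᴾ (fstᴾ ∘ᴾ fstᴾ)) nilᴾ)))))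

trueᴰ : ∀ {σ} → Decider σ (λ _ → Unit)
trueᴰ = record { dec = λ _ → yes tt ; ptime = trueᴾ }

NonConjunctiveRule : El (name ×ᵗ tbox) → Set
NonConjunctiveRule (A , T) =
    (¬ (∃[ α ] α ∈ T × ∃[ CD ] CD ∈ asEqn α × proj₁ CD ≡ atom A))
  ⊎ (∃[ α ] α ∈ T × ∃[ CD ] CD ∈ asEqn α × proj₁ CD ≡ atom A × ∃[ rC ] rC ∈ asEx (proj₂ CD) × Unit)

nonConjunctiveRuleᴰ : Decider (name ×ᵗ tbox) NonConjunctiveRule
nonConjunctiveRuleᴰ =
    (¬ᴰ (∃ᴰ sndᴾ (∃ᴰ (asEqnᴾ ∘ᴾ fstᴾ) (≡ᴰ (fstᴾ ∘ᴾ fstᴾ) (atomᴾ ∘ᴾ fstᴾ ↑ ↑)))))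
  ⊎ᴰ ∃ᴰ sndᴾ (∃ᴰ (asEqnᴾ ∘ᴾ fstᴾ) (≡ᴰ (fstᴾ ∘ᴾ fstᴾ) (atomᴾ ∘ᴾ fstᴾ ↑ ↑) ×ᴰ
       ∃ᴰ (asExᴾ ∘ᴾ sndᴾ ∘ᴾ fstᴾ) trueᴰ))

nonConjunctiveᴰ : Decider (name ×ᵗ tbox) (λ (A , T) → NonConjunctive T A)
nonConjunctiveᴰ = mapᴰ to from nonConjunctiveRuleᴰ
  where
  to : ∀ {x} → NonConjunctiveRule x → NonConjunctive (proj₂ x) (proj₁ x)
  to (inj₁ undefined) = inj₁ λ C ax → undefined (_ , ax , _ , here refl , refl)
  to (inj₂ ((_ ≡ᶜ ∃⟨ _ ⟩ _) , ax , _ , here refl , refl , _ , here refl , _)) = inj₂ (_ , _ , ax)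
  from : ∀ {x} → NonConjunctive (proj₂ x) (proj₁ x) → NonConjunctiveRule x
  from (inj₁ prim)         = inj₁ λ { ((_ ≡ᶜ _) , ax , _ , here refl , refl) → prim _ ax }
  from (inj₂ (r , C , ax)) = inj₂ (_ , ax , _ , here refl , refl , _ , here refl , tt)

nodes : List Concept → List (Maybe NC)
nodes Cs = nothing ∷ map just (atoms Cs)

nodesᴾ : ∀ {σ f} → PTime σ (list concept) f → PTime σ (list (opt name)) (λ x → nodes (f x))
nodesᴾ F = consᴾ nothingᴾ (mapᴾ (concatMapᴾ F (asAtomᴾ ∘ᴾ fstᴾ)) (justᴾ ∘ᴾ fstᴾ))

sigAtoms : List Name → List NC
sigAtoms = concatMap asInj₁

sigAtomsᴾ : ∀ {σ f} → PTime σ (list (name ⊎ᵗ name)) f → PTime σ (list name) (λ x → sigAtoms (f x))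
sigAtomsᴾ F = concatMapᴾ F (asInj₁ᴾ ∘ᴾ fstᴾ)

sigRoles : List Name → List NR
sigRoles = concatMap asInj₂

sigRolesᴾ : ∀ {σ f} → PTime σ (list (name ⊎ᵗ name)) f → PTime σ (list name) (λ x → sigRoles (f x))
sigRolesᴾ F = concatMapᴾ F (asInj₂ᴾ ∘ᴾ fstᴾ)

sigAtoms⁺ : ∀ {Sig A} → inj₁ A ∈ Sig → A ∈ sigAtoms Sig
sigAtoms⁺ A∈ = ∈-for⁺ asInj₁ A∈ (here refl)

sigAtoms⁻ : ∀ {Sig A} → A ∈ sigAtoms Sig → inj₁ A ∈ Sig
sigAtoms⁻ {Sig} A∈ with ∈-for⁻ asInj₁ Sig A∈
... | inj₁ _ , n∈ , here refl = n∈

sigRoles⁺ : ∀ {Sig r} → inj₂ r ∈ Sig → r ∈ sigRoles Sig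
sigRoles⁺ r∈ = ∈-for⁺ asInj₂ r∈ (here refl)

sigRoles⁻ : ∀ {Sig r} → r ∈ sigRoles Sig → inj₂ r ∈ Sig
sigRoles⁻ {Sig} r∈ with ∈-for⁻ asInj₂ Sig r∈
... | inj₂ _ , n∈ , here refl = n∈

LabelRule : El ((opt name ×ᵗ name) ×ᵗ env₂) → Set
LabelRule ((x , B) , R₂ , _) =
  x ≡ nothing ⊎ (∃[ A ] A ∈ asJust x × ((nothing , inj₁ (atom B)) , atom A) ∉ R₂)

labelRuleᴰ : Decider ((opt name ×ᵗ name) ×ᵗ env₂) LabelRule
labelRuleᴰ = ≡ᴰ (fstᴾ ∘ᴾ fstᴾ) nothingᴾ ⊎ᴰ ∃ᴰ (asJustᴾ ∘ᴾ fstᴾ ∘ᴾ fstᴾ)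
  (¬ᴰ (∈ᴰ (pairᴾ (pairᴾ nothingᴾ (inj₁ᴾ ∘ᴾ atomᴾ ∘ᴾ (sndᴾ ∘ᴾ fstᴾ) ↑)) (atomᴾ ∘ᴾ fstᴾ)) (fstᴾ ↑ ↑)))

DefinedRule : El ((name ×ᵗ name) ×ᵗ tbox ×ᵗ roles) → Set
DefinedRule ((r , A) , T , H) =
  ∃[ α ] α ∈ T × ∃[ CD ] CD ∈ asEqn α × proj₁ CD ≡ atom A ×
  ∃[ tC ] tC ∈ asEx (proj₂ CD) × (r , proj₁ tC) ∈ H

definedᴰ : Decider ((name ×ᵗ name) ×ᵗ tbox ×ᵗ roles) DefinedRule
definedᴰ = ∃ᴰ (fstᴾ ↑) (∃ᴰ (asEqnᴾ ∘ᴾ fstᴾ) (≡ᴰ (fstᴾ ∘ᴾ fstᴾ) (atomᴾ ∘ᴾ (sndᴾ ∘ᴾ fstᴾ) ↑ ↑) ×ᴰ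
  ∃ᴰ (asExᴾ ∘ᴾ sndᴾ ∘ᴾ fstᴾ) (∈ᴰ (pairᴾ ((fstᴾ ∘ᴾ fstᴾ) ↑ ↑ ↑) (fstᴾ ∘ᴾ fstᴾ)) (sndᴾ ↑ ↑ ↑ ↑))))

EdgeRule : El ((opt name ×ᵗ name ×ᵗ opt name) ×ᵗ env₂) → Set
EdgeRule ((x , r , y) , R₂ , (Cs , Rs) , T₁ , T₂ , Sig) =
  inj₂ r ∈ Sig ×
  ( (x ≡ nothing × y ≡ nothing)
  ⊎ (∃[ A ] A ∈ asJust x × ((nothing , inj₁ (∃⟨ r ⟩ ⊤)) , atom A) ∉ R₂ ×
      ( (y ≡ nothing × ¬ DefinedRule ((r , A) , T₂ , Roles.closure T₂ Rs))
      ⊎ (∃[ B ] B ∈ asJust y × NonConjunctive T₂ B × ((just r , inj₁ ⊤) , atom B) ∉ R₂ ×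
           ∃[ α ] α ∈ T₂ × ∃[ CD ] CD ∈ asEqn α × proj₁ CD ≡ atom A ×
           ∃[ tC ] tC ∈ asEx (proj₂ CD) × (r , proj₁ tC) ∈ Roles.closure T₂ Rs ×
             ((nothing , inj₁ (proj₂ tC)) , atom B) ∈ R₂))))

edgeRuleᴰ : Decider ((opt name ×ᵗ name ×ᵗ opt name) ×ᵗ env₂) EdgeRule
edgeRuleᴰ =
  ∈ᴰ (inj₂ᴾ ∘ᴾ rᴾ) (sndᴾ ↑ ↑ ↑ ↑) ×ᴰ
  (  ≡ᴰ xᴾ nothingᴾ ×ᴰ ≡ᴰ yᴾ nothingᴾ
  ⊎ᴰ ∃ᴰ (asJustᴾ ∘ᴾ xᴾ)
       ( ¬ᴰ (∈ᴰ (pairᴾ (pairᴾ nothingᴾ (inj₁ᴾ ∘ᴾ exᴾ ∘ᴾ pairᴾ (rᴾ ↑) ⊤ᴾ)) (atomᴾ ∘ᴾ fstᴾ)) (R₂ᴾ ↑)) ×ᴰ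
         (  ≡ᴰ (yᴾ ↑) nothingᴾ ×ᴰ
            ¬ᴰ (definedᴰ [ pairᴾ (pairᴾ (rᴾ ↑) fstᴾ) (pairᴾ (T₂ᴾ ↑) (Hᴾ ↑)) ]ᴰ)
         ⊎ᴰ ∃ᴰ (asJustᴾ ∘ᴾ yᴾ ↑)
              ( nonConjunctiveᴰ [ pairᴾ fstᴾ (T₂ᴾ ↑ ↑) ]ᴰ ×ᴰ
                ¬ᴰ (∈ᴰ (pairᴾ (pairᴾ (justᴾ ∘ᴾ rᴾ ↑ ↑) (inj₁ᴾ ∘ᴾ ⊤ᴾ)) (atomᴾ ∘ᴾ fstᴾ)) (R₂ᴾ ↑ ↑)) ×ᴰ
                ∃ᴰ (T₂ᴾ ↑ ↑) (∃ᴰ (asEqnᴾ ∘ᴾ fstᴾ) (≡ᴰ (fstᴾ ∘ᴾ fstᴾ) (atomᴾ ∘ᴾ fstᴾ ↑ ↑ ↑) ×ᴰ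
                  ∃ᴰ (asExᴾ ∘ᴾ sndᴾ ∘ᴾ fstᴾ) (∈ᴰ (pairᴾ (rᴾ ↑ ↑ ↑ ↑ ↑) (fstᴾ ∘ᴾ fstᴾ)) (Hᴾ ↑ ↑ ↑ ↑ ↑) ×ᴰ
                    ∈ᴰ (pairᴾ (pairᴾ nothingᴾ (inj₁ᴾ ∘ᴾ sndᴾ ∘ᴾ fstᴾ)) (atomᴾ ∘ᴾ fstᴾ ↑ ↑ ↑)) (R₂ᴾ ↑ ↑ ↑ ↑ ↑))))))))
  where
  xᴾ  = fstᴾ ∘ᴾ fstᴾ
  rᴾ  = fstᴾ ∘ᴾ sndᴾ ∘ᴾ fstᴾ
  yᴾ  = sndᴾ ∘ᴾ sndᴾ ∘ᴾ fstᴾ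
  R₂ᴾ = fstᴾ ↑
  T₂ᴾ = fstᴾ ↑ ↑ ↑ ↑
  Hᴾ  = Roles.closureᴾ T₂ᴾ ((sndᴾ ∘ᴾ fstᴾ) ↑ ↑)

opaque

  graphLabels : El env₂ → List ((Concept ⊎ Maybe NC) × Concept)
  graphLabels env@(R₂ , (Cs , Rs) , T₁ , T₂ , Sig) =
    map (λ (x , B) → inj₂ x , atom B)
        (filter (λ l → dec labelRuleᴰ (l , env)) (pairs (nodes Cs) (sigAtoms Sig)))

  graphLabelsᴾ : PTime env₂ (list (state ×ᵗ concept)) graphLabels
  graphLabelsᴾ = mapᴾ (filterᴾ (pairsᴾ (nodesᴾ ((fstᴾ ∘ᴾ fstᴾ) ↑)) (sigAtomsᴾ (sndᴾ ↑ ↑ ↑))) labelRuleᴰ)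
    (pairᴾ (inj₂ᴾ ∘ᴾ fstᴾ ∘ᴾ fstᴾ) (atomᴾ ∘ᴾ sndᴾ ∘ᴾ fstᴾ))

  graphLabels⁺ : (env@(R₂ , (Cs , Rs) , T₁ , T₂ , Sig) : El env₂) → ∀ {x B} → x ∈ nodes Cs → inj₁ B ∈ Sig →
                 LabelRule ((x , B) , env) → (inj₂ x , atom B) ∈ graphLabels env
  graphLabels⁺ env x∈ B∈ rule = ∈-map⁺ (λ (x , B) → inj₂ x , atom B)
    (∈-filter⁺ (λ l → dec labelRuleᴰ (l , env)) (∈-pairs⁺ x∈ (sigAtoms⁺ B∈)) rule)

  graphLabels⁻ : (env@(R₂ , (Cs , Rs) , T₁ , T₂ , Sig) : El env₂) → ∀ {q L} → (q , L) ∈ graphLabels env →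
                 ∃[ x ] ∃[ B ] q ≡ inj₂ x × L ≡ atom B ×
                   x ∈ nodes Cs × inj₁ B ∈ Sig × LabelRule ((x , B) , env)
  graphLabels⁻ env@(R₂ , (Cs , Rs) , T₁ , T₂ , Sig) l∈ with ∈-map⁻ (λ (x , B) → inj₂ x , atom B) l∈
  ... | (x , B) , xB∈ , refl
    with ∈-filter⁻ (λ l → dec labelRuleᴰ (l , env)) {xs = pairs (nodes Cs) (sigAtoms Sig)} xB∈
  ...   | p∈ , rule with ∈-pairs⁻ (nodes Cs) (sigAtoms Sig) p∈
  ...     | x∈ , B∈ = x , B , refl , refl , x∈ , sigAtoms⁻ B∈ , rule

opaque

  edgeᴰ : Decider ((opt name ×ᵗ name ×ᵗ opt name) ×ᵗ env₂) EdgeRule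
  edgeᴰ = edgeRuleᴰ

opaque

  graphEdges : El env₂ → List ((Concept ⊎ Maybe NC) × NR × (Concept ⊎ Maybe NC))
  graphEdges env@(R₂ , (Cs , Rs) , T₁ , T₂ , Sig) =
    map (λ (x , r , y) → inj₂ x , r , inj₂ y)
        (filter (λ e → dec edgeᴰ (e , env)) (pairs (nodes Cs) (pairs Rs (nodes Cs))))

  graphEdgesᴾ : PTime env₂ (list (state ×ᵗ name ×ᵗ state)) graphEdges
  graphEdgesᴾ = mapᴾ
    (filterᴾ (pairsᴾ (nodesᴾ ((fstᴾ ∘ᴾ fstᴾ) ↑)) (pairsᴾ ((sndᴾ ∘ᴾ fstᴾ) ↑) (nodesᴾ ((fstᴾ ∘ᴾ fstᴾ) ↑)))) edgeᴰ)
    (pairᴾ (inj₂ᴾ ∘ᴾ fstᴾ ∘ᴾ fstᴾ) (pairᴾ (fstᴾ ∘ᴾ sndᴾ ∘ᴾ fstᴾ) (inj₂ᴾ ∘ᴾ sndᴾ ∘ᴾ sndᴾ ∘ᴾ fstᴾ)))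

  graphEdges⁺ : (env@(R₂ , (Cs , Rs) , T₁ , T₂ , Sig) : El env₂) → ∀ {x r y} → x ∈ nodes Cs → r ∈ Rs → y ∈ nodes Cs →
                EdgeRule ((x , r , y) , env) → (inj₂ x , r , inj₂ y) ∈ graphEdges env
  graphEdges⁺ env x∈ r∈ y∈ rule = ∈-map⁺ (λ (x , r , y) → inj₂ x , r , inj₂ y)
    (∈-filter⁺ (λ e → dec edgeᴰ (e , env)) (∈-pairs⁺ x∈ (∈-pairs⁺ r∈ y∈)) rule)

  graphEdges⁻ : (env@(R₂ , (Cs , Rs) , T₁ , T₂ , Sig) : El env₂) → ∀ {q r q′} → (q , r , q′) ∈ graphEdges env →
                ∃[ x ] ∃[ y ] q ≡ inj₂ x × q′ ≡ inj₂ y ×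
                  x ∈ nodes Cs × y ∈ nodes Cs × EdgeRule ((x , r , y) , env)
  graphEdges⁻ env@(R₂ , (Cs , Rs) , T₁ , T₂ , Sig) e∈ with ∈-map⁻ (λ (x , r , y) → inj₂ x , r , inj₂ y) e∈
  ... | (x , r , y) , xry∈ , refl
    with ∈-filter⁻ (λ e → dec edgeᴰ (e , env)) {xs = pairs (nodes Cs) (pairs Rs (nodes Cs))} xry∈
  ...   | p∈ , rule with ∈-pairs⁻ (nodes Cs) (pairs Rs (nodes Cs)) p∈
  ...     | x∈ , ry∈ with ∈-pairs⁻ Rs (nodes Cs) ry∈
  ...       | _ , y∈ = x , y , refl , refl , x∈ , y∈ , rule

problem₁ : El env₂ → El problem
problem₁ env@(R₂ , (Cs , Rs) , T₁ , T₂ , Sig) =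
  T₁ , Roles.closure T₁ Rs , Cs , Rs , map inj₁ Cs ++ map inj₂ (nodes Cs) ,
  conceptLabels Cs ++ graphLabels env , graphEdges env

problem₁ᴾ : PTime env₂ problem problem₁
problem₁ᴾ = pairᴾ (fstᴾ ↑ ↑) (pairᴾ (Roles.closureᴾ (fstᴾ ↑ ↑) ((sndᴾ ∘ᴾ fstᴾ) ↑)) (pairᴾ cᴾ
  (pairᴾ ((sndᴾ ∘ᴾ fstᴾ) ↑) (pairᴾ (++ᴾ (mapᴾ cᴾ (inj₁ᴾ ∘ᴾ fstᴾ)) (mapᴾ (nodesᴾ cᴾ) (inj₂ᴾ ∘ᴾ fstᴾ)))
  (pairᴾ (++ᴾ (conceptLabelsᴾ cᴾ) graphLabelsᴾ) graphEdgesᴾ)))))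
  where
  cᴾ = (fstᴾ ∘ᴾ fstᴾ) ↑

-- The context `m` distinguishes the two kinds of witness: `nothing` stands for C ⊑ A, and a role of
-- the signature for an inclusion with its range.
AnswerRule : El (name ×ᵗ env₃) → Set
AnswerRule (A , R₁ , R₂ , (Cs , Rs) , T₁ , T₂ , Sig) =
  ∃[ m ] m ∈ Saturate.contexts (sigRoles Sig) × ∃[ B ] B ∈ atoms Cs × NonConjunctive T₂ B ×
    ((nothing , inj₁ (atom A)) , atom B) ∈ R₂ ×
    ((m , inj₁ ⊤) , atom B) ∉ R₂ ×
    ((m , inj₂ (just B)) , atom A) ∈ R₁

answerRuleᴰ : Decider (name ×ᵗ env₃) AnswerRule
answerRuleᴰ =
  ∃ᴰ (Saturate.contextsᴾ (sigRolesᴾ (sndᴾ ↑ ↑ ↑ ↑ ↑))) (∃ᴰ (concatMapᴾ ((fstᴾ ∘ᴾ fstᴾ) ↑ ↑ ↑ ↑) (asAtomᴾ ∘ᴾ fstᴾ))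
    ( nonConjunctiveᴰ [ pairᴾ fstᴾ (fstᴾ ↑ ↑ ↑ ↑ ↑ ↑ ↑) ]ᴰ
    ×ᴰ ∈ᴰ (pairᴾ (pairᴾ nothingᴾ (inj₁ᴾ ∘ᴾ atomᴾ ∘ᴾ fstᴾ ↑ ↑)) (atomᴾ ∘ᴾ fstᴾ)) (fstᴾ ↑ ↑ ↑ ↑)
    ×ᴰ (¬ᴰ (∈ᴰ (pairᴾ (pairᴾ (fstᴾ ↑) (inj₁ᴾ ∘ᴾ ⊤ᴾ)) (atomᴾ ∘ᴾ fstᴾ)) (fstᴾ ↑ ↑ ↑ ↑)))
    ×ᴰ ∈ᴰ (pairᴾ (pairᴾ (fstᴾ ↑) (inj₂ᴾ ∘ᴾ justᴾ ∘ᴾ fstᴾ)) (atomᴾ ∘ᴾ fstᴾ ↑ ↑)) (fstᴾ ↑ ↑ ↑)))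

opaque

  answer₃ : El env₃ → List NC
  answer₃ env@(R₁ , R₂ , u , T₁ , T₂ , Sig) = filter (λ A → dec answerRuleᴰ (A , env)) (sigAtoms Sig)

  answer₃ᴾ : PTime env₃ (list name) answer₃
  answer₃ᴾ = filterᴾ (sigAtomsᴾ (sndᴾ ↑ ↑ ↑ ↑)) answerRuleᴰ

  answer₃⁺ : (env@(R₁ , R₂ , u , T₁ , T₂ , Sig) : El env₃) → ∀ {A} → inj₁ A ∈ Sig → AnswerRule (A , env) → A ∈ answer₃ env
  answer₃⁺ env A∈ rule = ∈-filter⁺ (λ A → dec answerRuleᴰ (A , env)) (sigAtoms⁺ A∈) rule

  answer₃⁻ : (env@(R₁ , R₂ , u , T₁ , T₂ , Sig) : El env₃) → ∀ {A} → A ∈ answer₃ env → inj₁ A ∈ Sig × AnswerRule (A , env)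
  answer₃⁻ env@(R₁ , R₂ , u , T₁ , T₂ , Sig) A∈
    with ∈-filter⁻ (λ A → dec answerRuleᴰ (A , env)) {xs = sigAtoms Sig} A∈
  ... | A∈Sig , rule = sigAtoms⁻ A∈Sig , rule

facts₂ : El env₁ → List (El fact)
facts₂ env = Saturate.saturate (problem₂ env)

facts₁ : El env₂ → List (El fact)
facts₁ env = Saturate.saturate (problem₁ env)

-- Each result is put in front of the environment before the next phase runs, so that later rules
-- read it as data.
answer₁ : El env₂ → List NC
answer₁ env = answer₃ (facts₁ env , env)

answer₂ : El env₁ → List NC
answer₂ env = answer₁ (facts₂ env , env)

answer : El input → List NC
answer x = answer₂ (withUniverse x)

withUniverseᴾ : PTime input env₁ withUniverse
withUniverseᴾ = pairᴾ (pairᴾ conceptsᴾ roleNamesᴾ) idᴾ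

answer₁ᴾ : PTime env₂ (list name) answer₁
answer₁ᴾ = answer₃ᴾ ∘ᴾ pairᴾ (Saturate.saturateᴾ ∘ᴾ problem₁ᴾ) idᴾ

answer₂ᴾ : PTime env₁ (list name) answer₂
answer₂ᴾ = answer₁ᴾ ∘ᴾ pairᴾ (Saturate.saturateᴾ ∘ᴾ problem₂ᴾ) idᴾ

answerᴾ : PTime input (list name) answer
answerᴾ = _∘ᴾ_ {g = answer₂} {f = withUniverse} answer₂ᴾ withUniverseᴾ

nodes⁺ : ∀ {Cs A} → A ∈ atoms Cs → just A ∈ nodes Cs
nodes⁺ A∈ = there (∈-map⁺ just A∈)

nodes⁻ : ∀ {Cs A} → just A ∈ nodes Cs → A ∈ atoms Cs
nodes⁻ (there x∈) with ∈-map⁻ just x∈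
... | _ , A∈ , refl = A∈

conceptLabels⁻₁ : ∀ {Cs K L} → (inj₁ K , L) ∈ conceptLabels Cs → K ≡ L
conceptLabels⁻₁ l∈ with ∈-map⁻ (λ K → inj₁ K , K) l∈
... | _ , _ , refl = refl

conceptLabels⁻₂ : ∀ {Cs x L} → ¬ ((inj₂ x , L) ∈ conceptLabels Cs)
conceptLabels⁻₂ l∈ with ∈-map⁻ (λ K → inj₁ K , K) l∈
... | _ , _ , ()

_∈fact?_ : ∀ (f : El fact) (S : List (El fact)) → Dec (f ∈ S)
f ∈fact? S = dec (∈ᴰ {fact ×ᵗ list fact} fstᴾ sndᴾ) (f , S)

-- Correctness of the algorithm

module Correct (x : El input)
  (norm₁ : IsNormalisedTerminology (proj₁ x)) (norm₂ : IsNormalisedTerminology (proj₁ (proj₂ x))) where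

  open Universe x

  Ns : List NC
  Ns = atoms Cs

  noRan⊓₁ : NoRanges⊓ T₁
  noRan⊓₁ = Inversion.noRan⊓ (IsNormalisedTerminology.isTerminology norm₁)

  noRan⊓₂ : NoRanges⊓ T₂
  noRan⊓₂ = Inversion.noRan⊓ (IsNormalisedTerminology.isTerminology norm₂)

  module Axioms₁ = Axioms {T₁} ∈-++⁺ˡ
  module Axioms₂ = Axioms {T₂} (∈-++⁺ʳ T₁)

  H₁ H₂ : List (NR × NR)
  H₁ = Roles.closure T₁ Rs
  H₂ = Roles.closure T₂ Rs

  module Phase₂ = SaturateCorrect {T₂} {H₂} {Cs} {Rs} {map inj₁ Cs} {conceptLabels Cs} {[]}
    (λ _ _ → ⊥) (λ _ _ _ → ⊥)

  R₂ : List (El fact)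
  R₂ = facts₂ ((Cs , Rs) , x)

  R₂-sound : ∀ {m K L} → ((m , inj₁ K) , L) ∈ R₂ → T₂ ⊢ m , K ⊩ L
  R₂-sound = Phase₂.facts-entailed Roles.closure-sound (conceptLabels⁻₁ {Cs})
    (λ l∈ → contradiction l∈ (conceptLabels⁻₂ {Cs})) (λ ())

  R₂-complete : ∀ {m K L} → m ∈ Saturate.contexts Rs → K ∈ Cs → L ∈ Cs → T₂ ⊢ m , K ⊩ L →
                ((m , inj₁ K) , L) ∈ R₂
  R₂-complete {m} {K} {L} m∈ K∈ L∈ d = Phase₂.facts-concept Cs-⊤ Cs-≼
    Axioms₂.Cs-⊑ Axioms₂.Cs-≡ Axioms₂.Cs-ran (λ ()) Rs-ex
    (Roles.closure-complete Axioms₂.Rs-⊑) (∈-map⁺ inj₁) (∈-map⁺ (λ K → inj₁ K , K))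
    (λ _ ()) (λ _ ()) noRan⊓₂ (sound m d) m∈ K∈ L∈

  nothing∈ : nothing ∈ Saturate.contexts Rs
  nothing∈ = here refl

  just∈ : ∀ {r} → inj₂ r ∈ Sig → just r ∈ Saturate.contexts Rs
  just∈ r∈ = there (∈-map⁺ just (Rs-sig r∈))

  -- Soundness and completeness of the first saturation make membership in `R₂` a decision of
  -- entailment in T₂; every case distinction of `Dichotomy` except the one on definitions rests on
  -- it.
  entails? : ∀ {m K L} → m ∈ Saturate.contexts Rs → K ∈ Cs → L ∈ Cs → Dec (T₂ ⊢ m , K ⊩ L)
  entails? {m} {K} {L} m∈ K∈ L∈ =
    map′ R₂-sound (R₂-complete m∈ K∈ L∈) (((m , inj₁ K) , L) ∈fact? R₂)

  open Avoidance norm₂ Sig Ns (λ ax B≼ → atoms⁺ (Cs-≼ B≼ (proj₂ (Axioms₂.Cs-≡ ax))))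
    hiding (saturated)

  defined⁻ : ∀ {r A} → DefinedRule ((r , A) , T₂ , H₂) → Avoid.Defined r A
  defined⁻ ((_ ≡ᶜ ∃⟨ t ⟩ C) , ax , _ , here refl , refl , _ , here refl , rt∈) =
    t , C , ax , Roles.closure-sound rt∈

  defined⁺ : ∀ {r A} → inj₂ r ∈ Sig → Avoid.Defined r A → DefinedRule ((r , A) , T₂ , H₂)
  defined⁺ r∈ (t , C , ax , r⊑t) =
    _ , ax , _ , here refl , refl , _ , here refl , Roles.closure-complete Axioms₂.Rs-⊑ (Rs-sig r∈) r⊑t

  open Dichotomy
    (λ A∈ B∈ → entails? nothing∈ (Cs-name B∈) (atoms⁻ A∈))
    (λ A∈ r∈ → entails? nothing∈ (Cs-domain r∈) (atoms⁻ A∈))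
    (λ A∈ r∈ → entails? (just∈ r∈) Cs-⊤ (atoms⁻ A∈))
    (λ {r} A r∈ → map′ defined⁻ (defined⁺ r∈) (dec definedᴰ ((r , A) , T₂ , H₂)))

  env : El env₂
  env = R₂ , (Cs , Rs) , x

  -- On the finitely many nodes, the computed graph is the graph `avoid`. The conditions are
  -- negative, so completeness of `R₂` turns absence of a fact into non-entailment, and soundness
  -- serves the converse.
  label⁻ : ∀ {y B} → y ∈ nodes Cs → inj₁ B ∈ Sig → LabelRule ((y , B) , env) → Avoid.label y B
  label⁻ {nothing} y∈ B∈ _ = B∈
  label⁻ {just A}  y∈ B∈ (inj₂ (_ , here refl , ∉R₂)) =
    B∈ , λ d → ∉R₂ (R₂-complete nothing∈ (Cs-name B∈) (atoms⁻ (nodes⁻ {Cs} y∈)) d)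

  label⁺ : ∀ y {B} → Avoid.label y B → inj₁ B ∈ Sig × LabelRule ((y , B) , env)
  label⁺ nothing  B∈       = B∈ , inj₁ refl
  label⁺ (just A) (B∈ , ⊮) = B∈ , inj₂ (_ , here refl , λ ∈R₂ → ⊮ (R₂-sound ∈R₂))

  edge⁻ : ∀ {y r z} → y ∈ nodes Cs → z ∈ nodes Cs → EdgeRule ((y , r , z) , env) → Avoid.edge r y z
  edge⁻ y∈ z∈ (r∈ , inj₁ (refl , refl)) = r∈
  edge⁻ {just A} {r} y∈ z∈ (r∈ , inj₂ (_ , here refl , ∉R₂ , inj₁ (refl , undefined))) =
    r∈ , (λ d → ∉R₂ (R₂-complete nothing∈ (Cs-domain r∈) (atoms⁻ (nodes⁻ {Cs} y∈)) d)) ,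
    (λ d → undefined (defined⁺ r∈ d))
  edge⁻ {just A} {r} {just B} y∈ z∈ (r∈ , inj₂ (_ , here refl , ∉R₂ , inj₂ (_ , here refl , nc , r∉ ,
    (_ ≡ᶜ ∃⟨ t ⟩ C) , ax , _ , here refl , refl , _ , here refl , rt∈ , C∈))) =
    r∈ , (λ d → ∉R₂ (R₂-complete nothing∈ (Cs-domain r∈) (atoms⁻ (nodes⁻ {Cs} y∈)) d)) ,
    nodes⁻ {Cs} z∈ , nc , (λ d → r∉ (R₂-complete (just∈ r∈) Cs-⊤ (atoms⁻ (nodes⁻ {Cs} z∈)) d)) ,
    t , C , ax , Roles.closure-sound rt∈ , R₂-sound C∈

  edge⁺ : ∀ {r} y z → y ∈ nodes Cs → Avoid.edge r y z →
          inj₂ r ∈ Sig × z ∈ nodes Cs × EdgeRule ((y , r , z) , env)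
  edge⁺ nothing  nothing  y∈ r∈ = r∈ , here refl , r∈ , inj₁ (refl , refl)
  edge⁺ (just A) nothing  y∈ (r∈ , dom⊮ , undefined) =
    r∈ , here refl , r∈ , inj₂ (_ , here refl , (λ ∈R₂ → dom⊮ (R₂-sound ∈R₂)) ,
      inj₁ (refl , λ d → undefined (defined⁻ d)))
  edge⁺ (just A) (just B) y∈ (r∈ , dom⊮ , B∈ , nc , r⊮ , t , C , ax , r⊑t , d) =
    r∈ , nodes⁺ {Cs} B∈ , r∈ , inj₂ (_ , here refl , (λ ∈R₂ → dom⊮ (R₂-sound ∈R₂)) ,
      inj₂ (_ , here refl , nc , (λ ∈R₂ → r⊮ (R₂-sound ∈R₂)) ,
        _ , ax , _ , here refl , refl , _ , here refl ,
        Roles.closure-complete Axioms₂.Rs-⊑ (Rs-sig r∈) r⊑t ,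
        R₂-complete nothing∈ (Cs-≼ (under self) (proj₂ (Axioms₂.Cs-≡ ax))) (atoms⁻ B∈) d))

  Qs : List (Concept ⊎ Maybe NC)
  Qs = map inj₁ Cs ++ map inj₂ (nodes Cs)

  Qs⁺ : ∀ {y} → y ∈ nodes Cs → inj₂ y ∈ Qs
  Qs⁺ y∈ = ∈-++⁺ʳ (map inj₁ Cs) (∈-map⁺ inj₂ y∈)

  Qs⁻ : ∀ {y} → inj₂ y ∈ Qs → y ∈ nodes Cs
  Qs⁻ q∈ with ∈-++⁻ (map inj₁ Cs) q∈
  ... | inj₁ q∈′ with ∈-map⁻ inj₁ q∈′
  ...   | _ , _ , ()
  Qs⁻ q∈ | inj₂ q∈′ with ∈-map⁻ inj₂ q∈′
  ...   | _ , y∈ , refl = y∈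

  labels : List ((Concept ⊎ Maybe NC) × Concept)
  labels = conceptLabels Cs ++ graphLabels env

  labels⁻₁ : ∀ {K L} → (inj₁ K , L) ∈ labels → K ≡ L
  labels⁻₁ l∈ with ∈-++⁻ (conceptLabels Cs) l∈
  ... | inj₁ l∈′ = conceptLabels⁻₁ {Cs} l∈′
  ... | inj₂ l∈′ with graphLabels⁻ env l∈′
  ...   | _ , _ , () , _

  labels⁻₂ : ∀ {y L} → (inj₂ y , L) ∈ labels → ∃[ B ] L ≡ atom B × Avoid.label y B
  labels⁻₂ l∈ with ∈-++⁻ (conceptLabels Cs) l∈
  ... | inj₁ l∈′ = contradiction l∈′ (conceptLabels⁻₂ {Cs})
  ... | inj₂ l∈′ with graphLabels⁻ env l∈′
  ...   | _ , B , refl , refl , y∈ , B∈ , rule = B , refl , label⁻ y∈ B∈ rule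

  labels⁺ : ∀ {y B} → inj₂ y ∈ Qs → Avoid.label y B → (inj₂ y , atom B) ∈ labels
  labels⁺ {y} q∈ l = let B∈ , rule = label⁺ y l in
    ∈-++⁺ʳ (conceptLabels Cs) (graphLabels⁺ env (Qs⁻ q∈) B∈ rule)

  edges⁻ : ∀ {q r q′} → (q , r , q′) ∈ graphEdges env →
           ∃[ y ] ∃[ z ] q ≡ inj₂ y × q′ ≡ inj₂ z × Avoid.edge r y z
  edges⁻ e∈ with graphEdges⁻ env e∈
  ... | y , z , refl , refl , y∈ , z∈ , rule = y , z , refl , refl , edge⁻ y∈ z∈ rule

  edges⁺ : ∀ {r y z} → inj₂ y ∈ Qs → Avoid.edge r y z →
           (inj₂ y , r , inj₂ z) ∈ graphEdges env × r ∈ Rs × inj₂ z ∈ Qs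
  edges⁺ {r} {y} {z} q∈ e = let r∈ , z∈ , rule = edge⁺ y z (Qs⁻ q∈) e in
    graphEdges⁺ env (Qs⁻ q∈) (Rs-sig r∈) z∈ rule , Rs-sig r∈ , Qs⁺ z∈

  label-atom : ∀ {y B} → Avoid.label y B → atom B ∈ Cs
  label-atom {y} l = Cs-name (proj₁ (label⁺ y l))

  module Phase₁ = SaturateCorrect {T₁} {H₁} {Cs} {Rs} {Qs} {labels} {graphEdges env} Avoid.label Avoid.edge

  open Graph avoid using (_∋_)

  R₁ : List (El fact)
  R₁ = facts₁ env

  R₁-sound : ∀ {m y L} → ((m , inj₂ y) , L) ∈ R₁ → ∃[ C ] y ∋ C × T₁ ⊢ m , C ⊩ L
  R₁-sound = Phase₁.facts-entailed Roles.closure-sound labels⁻₁ labels⁻₂ edges⁻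

  R₁-complete : ∀ {m y C L} → m ∈ Saturate.contexts Rs → y ∈ nodes Cs → L ∈ Cs → y ∋ C →
                T₁ ⊨ query m C L → ((m , inj₂ y) , L) ∈ R₁
  R₁-complete m∈ y∈ L∈ yC T₁⊨ = Phase₁.facts-node Cs-⊤ Cs-≼
    Axioms₁.Cs-⊑ Axioms₁.Cs-≡ Axioms₁.Cs-ran (λ {y} → label-atom {y}) Rs-ex
    (Roles.closure-complete Axioms₁.Rs-⊑) (λ K∈ → ∈-++⁺ˡ (∈-map⁺ inj₁ K∈))
    (λ K∈ → ∈-++⁺ˡ (∈-map⁺ (λ K → inj₁ K , K) K∈)) labels⁺ edges⁺ noRan⊓₁ T₁⊨ m∈ (Qs⁺ y∈) L∈ yC

  InSig : Maybe NR → Set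
  InSig m = ∀ {r} → m ≡ just r → inj₂ r ∈ Sig

  sigContexts⁺ : ∀ m → InSig m → m ∈ Saturate.contexts (sigRoles Sig)
  sigContexts⁺ nothing  m∈ = here refl
  sigContexts⁺ (just r) m∈ = there (∈-map⁺ just (sigRoles⁺ (m∈ refl)))

  sigContexts⁻ : ∀ {m} → m ∈ Saturate.contexts (sigRoles Sig) → InSig m
  sigContexts⁻ (there m∈) refl with ∈-map⁻ just m∈
  ... | _ , r∈ , refl = sigRoles⁻ r∈

  contexts⁺ : ∀ m → InSig m → m ∈ Saturate.contexts Rs
  contexts⁺ nothing  m∈ = nothing∈
  contexts⁺ (just r) m∈ = just∈ (m∈ refl)

  Difference : Maybe NR → Concept → NC → Set₁
  Difference m C A = All (_∈ Sig) (conceptNames C) × T₁ ⊨ query m C (atom A) × ¬ (T₂ ⊨ query m C (atom A))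

  -- A concept from which T₂ does not derive `A` holds at the node of some leaf of `A`; as T₁
  -- derives `A` from it, the second saturation finds `A` at that node.
  difference⇒answer : ∀ m {C A} → InSig m → inj₁ A ∈ Sig → Difference m C A → A ∈ answer x
  difference⇒answer m {C} {A} m∈ A∈ (Σ , T₁⊨ , T₂⊭) =
    let B , (nc , B∈ , A⊩B) , m⊮B , h = avoidable m Σ m∈ (atoms⁺ (Cs-name A∈)) (λ d → T₂⊭ (sound m d)) in
    answer₃⁺ (R₁ , env) A∈
      (m , sigContexts⁺ m m∈ , B , B∈ , nc , R₂-complete nothing∈ (Cs-name A∈) (atoms⁻ B∈) A⊩B ,
       (λ ∈R₂ → m⊮B (R₂-sound ∈R₂)) , R₁-complete (contexts⁺ m m∈) (nodes⁺ {Cs} B∈) (Cs-name A∈) h T₁⊨)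

  answer⇒difference : ∀ {A} → A ∈ answer x →
    inj₁ A ∈ Sig × ∃[ m ] InSig m × ∃[ C ] Difference m C A
  answer⇒difference {A} A∈ =
    let A∈Sig , m , m∈ , B , B∈ , nc , AB∈ , m∉ , h∈ = answer₃⁻ (R₁ , env) A∈
        C , h , d = R₁-sound h∈
    in A∈Sig , m , sigContexts⁻ m∈ , C , ∋-names C h , sound m d ,
       -- If T₂ entailed `A` from `C`, it would also entail `B`, which the node excludes. The detour
       -- through completeness is taken because `cut` composes derivations.
       λ T₂⊨ → avoids nc
         (λ d → m∉ (R₂-complete (contexts⁺ m (sigContexts⁻ m∈)) Cs-⊤ (atoms⁻ B∈) d)) h
         (sound m (cut any (complete noRan⊓₂ m T₂⊨) (R₂-sound AB∈)))

  answer-correct : ∀ A → A ∈ answer x ⇔ cWtnʳʰˢ (_∈ Sig) T₁ T₂ A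
  answer-correct A = mk⇔ (λ A∈ → to (answer⇒difference A∈)) from
    where
    to : inj₁ A ∈ Sig × (∃[ m ] InSig m × ∃[ C ] Difference m C A) → cWtnʳʰˢ (_∈ Sig) T₁ T₂ A
    to (A∈ , nothing , m∈ , C , Σ , diff) = A∈ , C , inj₁ (++⁺ Σ (A∈ ∷ []) , diff)
    to (A∈ , just r  , m∈ , C , Σ , diff) =
      A∈ , C , inj₂ (r , m∈ refl , m∈ refl ∷ ++⁺ Σ (A∈ ∷ []) , diff)
    from : cWtnʳʰˢ (_∈ Sig) T₁ T₂ A → A ∈ answer x
    from (A∈ , C , inj₁ (Σ , diff)) =
      difference⇒answer nothing {C} (λ ()) A∈ (++⁻ˡ (conceptNames C) Σ , diff)
    from (A∈ , C , inj₂ (r , r∈ , _ ∷ Σ , diff)) =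
      difference⇒answer (just r) {C} (λ { refl → r∈ }) A∈ (++⁻ˡ (conceptNames C) Σ , diff)

-- Transfer to the machine

enc-input : ∀ x → enc input x ≡ encInput x
enc-input (T₁ , T₂ , Sig) = cong (λ ns → encList encInclusion T₁ ∙ encList encInclusion T₂ ∙ foldr _∙_ nil ns)
  (map-cong (λ { (inj₁ A) → refl ; (inj₂ r) → refl }) Sig)

-- A polynomial bound becomes a single monomial because the size of an encoded input is positive.
PTime⇒PolyTimeSolvable : ∀ {a b p q σ τ f} {X : Set a} {Y : Set b} {Pre : X → Set p} {Post : X → Y → Set q}
  {encX : X → Tree} {encY : Y → Tree} → PTime σ τ f → (i : X → El σ) (o : El τ → Y) →
  (∀ x → enc σ (i x) ≡ encX x) → (∀ y → enc τ y ≡ encY (o y)) →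
  (∀ x → Pre x → Post x (o (f (i x)))) → PolyTimeSolvable encX encY Pre Post
PTime⇒PolyTimeSolvable {σ = σ} {τ} {f} F i o enc-i enc-o correct =
  let c , k , bounded = monomial-bound (time F) in
  program F , c , k , λ x pre →
    let n , P⇓ , n≤ = halts F (i x) in
    o (f (i x)) , n ,
    subst₂ (λ s t → program F ⊢ s ⇓ t [ n ]) (enc-i x) (enc-o (f (i x))) P⇓ ,
    subst (λ s → n ≤ c * size s ^ k) (enc-i x) (≤-trans n≤ (at {λ m → time F ⟨ m ⟩ ≤ c * m ^ k} bounded (size-pos (enc σ (i x))))) ,
    correct x pre
  where
  at : {P : ℕ → Set} → (∀ n → P (suc n)) → ∀ {n} → 1 ≤ n → P n
  at p {suc n} _ = p n

theorem56 : PolyTimeSolvable encInput encOutput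
    (λ (T₁ , T₂ , Σ) → IsNormalisedTerminology T₁ × IsNormalisedTerminology T₂)
    (λ (T₁ , T₂ , Σ) W → ∀ A → A ∈ W ⇔ cWtnʳʰˢ (_∈ Σ) T₁ T₂ A)
theorem56 = PTime⇒PolyTimeSolvable answerᴾ id id enc-input (λ _ → refl)
  (λ x (norm₁ , norm₂) → Correct.answer-correct x norm₁ norm₂)
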